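{- Let $t$ be a positive integer. (i) If $t\equiv 0\pmod 3$ and $\frac{4t}{3}+1$ is a prime power, then $r'_2(K_{2,t})=CR(K_{2,t},K_3)=\frac{4t}{3}+2$. (ii) If $t$ is even and $2t+1$ is a prime power, then $r'_2(K_{3,t})=CR(K_{3,t},K_3)=2t+2$.
   Context: An edge-colored graph $G$ on $p$ vertices with edge-coloring $\chi$ is called orderable if there exist an ordering $(v_1,\ldots,v_p)$ of $V(G)$ and a list $(c_1,\ldots,c_{p-1})$ of not necessarily distinct colors such that for every edge $v_iv_j\in E(G)$ with $i<j$ we have $\chi(v_iv_j)=c_i$. An edge-colored graph is rainbow if all its edges have pairwise different colors. For a graph $G$, $r'_2(G)$ is the minimum integer $n$ such that every 2-edge-coloring of $K_n$ (each edge gets one of two given colors) contains an orderable copy of $G$. For graphs $G,H$, $CR(G,H)$ is the minimum integer $n$ such that every edge-coloring of $K_n$ with any number of colors contains either an orderable copy of $G$ or a rainbow copy of $H$. Copies are (not necessarily induced) subgraphs with the inherited coloring. -}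

module Defs where

open import Data.Fin using (Fin; inject≤; toℕ)
open import Data.Nat using (ℕ; suc; _∸_; _^_; _≤_; _<_)
open import Data.Nat.Primality using (Prime)
open import Data.Nat.Properties using (m∸n≤m)
open import Data.Product using (_×_; ∃-syntax; Σ-syntax)
open import Data.Sum using (_⊎_; inj₁; inj₂)
open import Function using (_∘_)
open import Function.Bundles using (_⤖_; module Bijection)
open import Function.Definitions using (Injective)
open import Relation.Binary.Definitions using (Irreflexive; Symmetric)
open import Relation.Binary.PropositionalEquality using (_≡_; _≢_; ≢-sym)
open import Relation.Nullary using (¬_)

record Graph : Set₁ where
  infix 4 _~_
  field
    V        : Set
    _~_      : V → V → Set
    ~-sym    : Symmetric _~_
    ~-irrefl : Irreflexive _≡_ _~_

K : ℕ → Graph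
K n = record
  { V        = Fin n
  ; _~_      = _≢_
  ; ~-sym    = ≢-sym
  ; ~-irrefl = λ x≡y x≢y → x≢y x≡y
  }

data _~ᵇ_ {s t : ℕ} : Fin s ⊎ Fin t → Fin s ⊎ Fin t → Set where
  left-right : ∀ {i j} → inj₁ i ~ᵇ inj₂ j
  right-left : ∀ {i j} → inj₂ j ~ᵇ inj₁ i

~ᵇ-sym : ∀ {s t} → Symmetric (_~ᵇ_ {s} {t})
~ᵇ-sym left-right = right-left
~ᵇ-sym right-left = left-right

~ᵇ-irrefl : ∀ {s t} → Irreflexive _≡_ (_~ᵇ_ {s} {t})
~ᵇ-irrefl () left-right
~ᵇ-irrefl () right-left

Kᵇ : ℕ → ℕ → Graph
Kᵇ s t = record
  { V        = Fin s ⊎ Fin t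
  ; _~_      = _~ᵇ_
  ; ~-sym    = ~ᵇ-sym
  ; ~-irrefl = ~ᵇ-irrefl
  }

-- An edge uv is given by a proof of u ~ v or of v ~ u.  The field unordered
-- makes the color independent of the orientation and, applied twice, of the
-- choice of proof.
record EdgeColoring (G : Graph) (C : Set) : Set where
  open Graph G
  field
    color     : ∀ {u v} → u ~ v → C
    unordered : ∀ {u v} (e : u ~ v) (f : v ~ u) → color e ≡ color f

record Copy (G H : Graph) : Set where
  private
    module G = Graph G
    module H = Graph H
  field
    vertex    : G.V → H.V
    injective : Injective _≡_ _≡_ vertex
    edge      : ∀ {u v} → u G.~ v → vertex u H.~ vertex v

inherited : ∀ {G H C} → Copy G H → EdgeColoring H C → EdgeColoring G C
inherited φ χ = record
  { color     = color ∘ edge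
  ; unordered = λ e f → unordered (edge e) (edge f)
  }
  where
  open Copy φ
  open EdgeColoring χ

-- With indices from 0, position i of the color list is position
-- inject≤ i _ of the vertex ordering.
Orderable : ∀ {G C} → EdgeColoring G C → Set
Orderable {G} {C} χ =
  ∃[ p ] Σ[ ordering ∈ Fin p ⤖ V ] Σ[ c ∈ (Fin (p ∸ 1) → C) ]
    let v = Bijection.to ordering in
    ∀ (i : Fin (p ∸ 1)) (j : Fin p) → toℕ i < toℕ j →
    (e : v (inject≤ i (m∸n≤m p 1)) ~ v j) → color e ≡ c i
  where
  open Graph G
  open EdgeColoring χ

Rainbow : ∀ {G C} → EdgeColoring G C → Set
Rainbow {G} χ =
  ∀ {u v x y} (e : u ~ v) (f : x ~ y) →
  ¬ ((u ≡ x × v ≡ y) ⊎ (u ≡ y × v ≡ x)) →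
  color e ≢ color f
  where
  open Graph G
  open EdgeColoring χ

ContainsOrderable : ∀ {H C} → Graph → EdgeColoring H C → Set
ContainsOrderable {H} G χ = Σ[ φ ∈ Copy G H ] Orderable (inherited φ χ)

ContainsRainbow : ∀ {H C} → Graph → EdgeColoring H C → Set
ContainsRainbow {H} G χ = Σ[ φ ∈ Copy G H ] Rainbow (inherited φ χ)

IsMinimum : (ℕ → Set) → ℕ → Set
IsMinimum P n = P n × (∀ m → P m → n ≤ m)

-- r′₂[ G ]≡ n says that the minimum defining r′₂(G) exists and equals n;
-- likewise for CR[ G , H ]≡ n.
r′₂[_]≡_ : Graph → ℕ → Set
r′₂[ G ]≡ n =
  IsMinimum (λ m → (χ : EdgeColoring (K m) (Fin 2)) → ContainsOrderable G χ) n

-- A coloring of a finite graph uses finitely many colors, so "any number of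
-- colors" is a quantification over all palettes Fin k.
CR[_,_]≡_ : Graph → Graph → ℕ → Set
CR[ G , H ]≡ n =
  IsMinimum
    (λ m → ∀ k (χ : EdgeColoring (K m) (Fin k)) →
           ContainsOrderable G χ ⊎ ContainsRainbow H χ)
    n

PrimePower : ℕ → Set
PrimePower q = ∃[ p ] ∃[ k ] (Prime p × q ≡ p ^ suc k)

-- Lower bounds.  Let q ≡ 1 (mod 4) be a prime power and Q a symmetric conference
-- matrix of order q: zero diagonal, signs off the diagonal, rows of sum 0 and
-- pairwise inner product −1.  Color the edges of a complete graph on at most q
-- vertices by the signs of Q.  In an orderable K_{2,t} or K_{3,t} every vertex
-- of the large side avoids certain sign patterns to the small side, and the
-- inner products of Q say how many vertices have such a pattern.  No finite field
-- is needed for Q: for a prime p the Legendre symbol of x − y serves, and Turyn's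
-- product turns it into a matrix of order p ^ k.
--
-- Upper bounds.  In a coloring without rainbow triangle take a minimal module: a
-- set of at least two vertices that every outside vertex sees in one color.
-- Three colors cannot all be connected on a set, and a component of a
-- disconnected color is a smaller module, so a minimal module has at most two
-- colors.  Vertices outside the module are harmless for small sides chosen
-- inside it, and inside it an average over all small sides gives a good one.  A
-- module of two vertices is completed to a side of K_{3,t} by any third vertex.
module Submission where

open import Defs
open import Data.Empty using (⊥; ⊥-elim)
open import Data.Fin.Base as Fin using (Fin; zero; suc; toℕ; fromℕ<; inject≤)
open import Data.Fin.Patterns using (0F; 1F; 2F)
import Data.Fin.Properties as Fin
open import Data.Integer.Base as ℤ using (ℤ; +_; -[1+_]; +≤+; 0ℤ; 1ℤ; -1ℤ; ∣_∣)
import Data.Integer.Properties as ℤ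
open import Data.Integer.DivMod using (_%ℕ_; _/ℕ_; n%ℕd<d; a≡a%ℕn+[a/ℕn]*n)
open import Data.Integer.Tactic.RingSolver using (solve-∀)
open import Data.List.Base using (List; []; _∷_; _++_; length; map; filter; allFin; lookup;
    cartesianProductWith)
open import Data.List.Membership.Propositional using (_∈_; _∉_; lose)
open import Data.List.Membership.Propositional.Properties
  using (∈-allFin; ∈-lookup; ∈-map⁺; ∈-map⁻; ∈-++⁺ˡ; ∈-++⁺ʳ; ∈-filter⁺; ∈-filter⁻; ∈-cartesianProductWith⁺)
open import Data.List.Properties using (length-++; length-map; length-tabulate; filter-notAll)
open import Data.List.Relation.Binary.Permutation.Propositional using (↭-sym; ↭⇒↭ₛ)
open import Data.List.Relation.Binary.Permutation.Propositional.Properties using (∈-resp-↭)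
import Data.List.Relation.Binary.Permutation.Setoid.Properties as Permutationₛ
open import Data.List.Relation.Unary.All as All using ([]; _∷_)
open import Data.List.Relation.Unary.AllPairs using (AllPairs; []; _∷_)
open import Data.List.Relation.Unary.Any as Any using (here; there; index)
open import Data.List.Relation.Unary.Any.Properties using (lookup-index)
open import Data.List.Relation.Unary.Sorted.TotalOrder.Properties using (Sorted⇒AllPairs)
open import Data.List.Relation.Unary.Unique.Propositional using (Unique)
open import Data.List.Relation.Unary.Unique.Propositional.Properties using
    (allFin⁺; map⁺; ++⁺; filter⁺; cartesianProductWith⁺)
import Data.List.Sort
open import Data.Nat.Base as ℕ using (ℕ; zero; suc; _∸_; _^_; NonZero)
import Data.Nat.Divisibility as ℕ
import Data.Nat.Properties as ℕ
open import Data.Nat.Coprimality using (prime⇒coprime; coprime-Bézout)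
open import Data.Nat.DivMod using (m*n/n≡m)
open import Data.Nat.GCD using (module Bézout)
open import Data.Nat.Primality using (Prime; euclidsLemma; prime⇒nonZero; prime⇒nonTrivial)
open import Data.Product using (_×_; _,_; ∃-syntax; Σ-syntax; proj₁; proj₂)
open import Data.Sum using (_⊎_; inj₁; inj₂; [_,_]′)
open import Data.Sum.Properties using (inj₁-injective; inj₂-injective)
open import Data.Vec.Base as Vec using (Vec; []; _∷_)
import Data.Vec.Properties as Vec
open import Function using (_∘_; id)
open import Function.Bundles using (module Bijection; mk⤖)
open import Function.Definitions using (Injective)
open import Level using (0ℓ)
import Relation.Binary.Construct.On as On
open import Relation.Binary.Definitions using (DecidableEquality; tri<; tri≈; tri>)
open import Relation.Binary.PropositionalEquality
open import Relation.Nullary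
open import Relation.Nullary.Decidable
  using (¬¬-excluded-middle; decidable-stable; toWitness; _→-dec_; _×-dec_; _⊎-dec_; ¬?)
open import Relation.Unary using (Decidable; Pred)

-- Both values have the form 4μ + 2, with t = 3μ or t = 2μ, so matrices of order 4μ + 1 serve both
-- parts. For p ≡ 3 (mod 4) the Legendre matrix is skew and only its even powers are symmetric.
-- Instead of following the exponent, each matrix carries an unknown sign `ε`, and a count modulo 4
-- excludes skewness at order 4μ + 1. Vertices are counted in both bounds by products (1 - γs)(1 +
-- γs′), which are 4 on the counted sign pattern and 0 on the others; their sums need only row sums
-- and inner products. On the small side itself a sign is 0 and the product means nothing, so
-- correction terms cancel it there. These terms are the origin of the additive constants, on which
-- the agreement of the two bounds depends. In the averages the only unknown is the sum of the
-- squared row sums. It is nonnegative and enters with the favourable sign, so no regularity of the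
-- coloring is required. Color components are never computed: reachability is treated under double
-- negation. This is removed at the end, because the existence of a small side with few bad vertices
-- is decidable by search.

-- Finite sums of integers over lists.

module Sums where

  open import Data.Integer.Base using (_+_; _*_; -_; _-_; _≤_; _<_)
  open import Data.Integer.Divisibility.Signed using (_∣_; divides; ∣m∣n⇒∣m+n)

  private variable
    A B : Set

  infix 8 ⟦_⟧
  -- The Iverson bracket, with values in ℤ so that cardinalities and signed sums share one calculus.
  ⟦_⟧ : {P : Set} → Dec P → ℤ
  ⟦ yes _ ⟧ = 1ℤ
  ⟦ no  _ ⟧ = 0ℤ

  ⟦⟧-true : {P : Set} (d : Dec P) → P → ⟦ d ⟧ ≡ 1ℤ
  ⟦⟧-true (yes _) _ = refl
  ⟦⟧-true (no ¬p) p = ⊥-elim (¬p p)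

  ⟦⟧-false : {P : Set} (d : Dec P) → ¬ P → ⟦ d ⟧ ≡ 0ℤ
  ⟦⟧-false (yes p) ¬p = ⊥-elim (¬p p)
  ⟦⟧-false (no _)  _  = refl

  ⟦⟧-⇔ : {P Q : Set} (d : Dec P) (e : Dec Q) → (P → Q) → (Q → P) → ⟦ d ⟧ ≡ ⟦ e ⟧
  ⟦⟧-⇔ (yes p) e f g = sym (⟦⟧-true e (f p))
  ⟦⟧-⇔ (no ¬p) e f g = sym (⟦⟧-false e (¬p ∘ g))

  ⟦⟧≥0 : {P : Set} (d : Dec P) → 0ℤ ≤ ⟦ d ⟧
  ⟦⟧≥0 (yes _) = +≤+ ℕ.z≤n
  ⟦⟧≥0 (no _)  = +≤+ ℕ.z≤n

  ∑ : List A → (A → ℤ) → ℤ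
  ∑ []       f = 0ℤ
  ∑ (x ∷ xs) f = f x + ∑ xs f

  syntax ∑ l (λ x → e) = ∑[ x ∈ l ] e
  infixl 5 ∑


  ∑-cong-∈ : ∀ (l : List A) {f g : A → ℤ} → (∀ {x} → x ∈ l → f x ≡ g x) → ∑ l f ≡ ∑ l g
  ∑-cong-∈ []      h = refl
  ∑-cong-∈ (x ∷ l) h = cong₂ _+_ (h (here refl)) (∑-cong-∈ l (h ∘ there))

  ∑-cong : ∀ (l : List A) {f g : A → ℤ} → (∀ x → f x ≡ g x) → ∑ l f ≡ ∑ l g
  ∑-cong l h = ∑-cong-∈ l (λ {x} _ → h x)

  ∑-mono : ∀ (l : List A) {f g : A → ℤ} → (∀ {x} → x ∈ l → f x ≤ g x) → ∑ l f ≤ ∑ l g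
  ∑-mono []      h = ℤ.≤-refl
  ∑-mono (x ∷ l) h = ℤ.+-mono-≤ (h (here refl)) (∑-mono l (h ∘ there))

  ∑-+ : ∀ (l : List A) (f g : A → ℤ) → ∑ l (λ x → f x + g x) ≡ ∑ l f + ∑ l g
  ∑-+ []      f g = refl
  ∑-+ (x ∷ l) f g = trans (cong (_+_ (f x + g x)) (∑-+ l f g)) (lem (f x) (g x) _ _)
    where
    lem : ∀ a b c d → a + b + (c + d) ≡ a + c + (b + d)
    lem = solve-∀

  ∑-*ˡ : ∀ (l : List A) c (f : A → ℤ) → ∑ l (λ x → c * f x) ≡ c * ∑ l f
  ∑-*ˡ []      c f = sym (ℤ.*-zeroʳ c)
  ∑-*ˡ (x ∷ l) c f = trans (cong (_+_ (c * f x)) (∑-*ˡ l c f)) (sym (ℤ.*-distribˡ-+ c (f x) _))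

  ∑-*ʳ : ∀ (l : List A) (f : A → ℤ) c → ∑ l (λ x → f x * c) ≡ ∑ l f * c
  ∑-*ʳ l f c = trans (∑-cong l (λ x → ℤ.*-comm (f x) c)) (trans (∑-*ˡ l c f) (ℤ.*-comm c _))

  ∑-const : ∀ (l : List A) c → ∑ l (λ _ → c) ≡ + length l * c
  ∑-const []      c = refl
  ∑-const (x ∷ l) c = trans (cong (_+_ c) (∑-const l c)) (sym (ℤ.suc-* (+ length l) c))

  ∑-length : ∀ (l : List A) → ∑ l (λ _ → 1ℤ) ≡ + length l
  ∑-length l = trans (∑-const l 1ℤ) (ℤ.*-identityʳ (+ length l))

  ∑-zero : ∀ (l : List A) {f : A → ℤ} → (∀ {x} → x ∈ l → f x ≡ 0ℤ) → ∑ l f ≡ 0ℤ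
  ∑-zero []      h = refl
  ∑-zero (x ∷ l) h = cong₂ _+_ (h (here refl)) (∑-zero l (h ∘ there))

  ∑-nonneg : ∀ (l : List A) {f : A → ℤ} → (∀ x → 0ℤ ≤ f x) → 0ℤ ≤ ∑ l f
  ∑-nonneg l {f} h = subst (_≤ ∑ l f) (∑-zero l (λ _ → refl)) (∑-mono l (λ {x} _ → h x))

  ∑-swap : ∀ (l : List A) (l′ : List B) (f : A → B → ℤ) →
           ∑[ x ∈ l ] ∑[ y ∈ l′ ] f x y ≡ ∑[ y ∈ l′ ] ∑[ x ∈ l ] f x y
  ∑-swap []      l′ f = sym (∑-zero l′ (λ _ → refl))
  ∑-swap (x ∷ l) l′ f =
    trans (cong (_+_ (∑ l′ (f x))) (∑-swap l l′ f))
          (sym (∑-+ l′ (f x) (λ y → ∑ l (λ x → f x y))))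

  ∑-product : ∀ (l : List A) (l′ : List B) (f : A → ℤ) (g : B → ℤ) →
              ∑ l f * ∑ l′ g ≡ ∑[ x ∈ l ] ∑[ y ∈ l′ ] f x * g y
  ∑-product l l′ f g =
    trans (sym (∑-*ʳ l f _)) (∑-cong l (λ x → sym (∑-*ˡ l′ (f x) g)))

  ∑-map : ∀ (h : B → A) (l : List B) (f : A → ℤ) → ∑ (map h l) f ≡ ∑ l (f ∘ h)
  ∑-map h []      f = refl
  ∑-map h (x ∷ l) f = cong (_+_ (f (h x))) (∑-map h l f)

  ∑-filter : ∀ {P : Pred A 0ℓ} (P? : Decidable P) (l : List A) (f : A → ℤ) →
             ∑ (filter P? l) f ≡ ∑ l (λ x → ⟦ P? x ⟧ * f x)
  ∑-filter P? []      f = refl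
  ∑-filter P? (x ∷ l) f with P? x
  ... | yes _ = cong₂ _+_ (sym (ℤ.*-identityˡ (f x))) (∑-filter P? l f)
  ... | no  _ = trans (∑-filter P? l f) (sym (ℤ.+-identityˡ _))

  length-filter-∑ : ∀ {P : Pred A 0ℓ} (P? : Decidable P) (l : List A) →
                    + length (filter P? l) ≡ ∑ l (λ x → ⟦ P? x ⟧)
  length-filter-∑ P? l = trans (sym (ℤ.*-identityʳ _)) (trans (sym (∑-const (filter P? l) 1ℤ))
    (trans (∑-filter P? l (λ _ → 1ℤ)) (∑-cong l (λ x → ℤ.*-identityʳ _))))

  module _ {A : Set} (_≟_ : DecidableEquality A) where

    ∑-δ-∉ : ∀ {l : List A} {a} (g : A → ℤ) → a ∉ l → ∑[ y ∈ l ] (⟦ y ≟ a ⟧ * g y) ≡ 0ℤ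
    ∑-δ-∉ {l} {a} g a∉l = ∑-zero l (λ {y} y∈l →
      trans (cong (_* g y) (⟦⟧-false (y ≟ a) (λ { refl → a∉l y∈l }))) refl)

    ∑-δ : ∀ {l : List A} {a} (g : A → ℤ) → Unique l → a ∈ l → ∑[ y ∈ l ] (⟦ y ≟ a ⟧ * g y) ≡ g a
    ∑-δ {x ∷ l} {a} g (x∉ ∷ u) (here refl) = trans
      (cong₂ _+_ (trans (cong (_* g a) (⟦⟧-true (a ≟ a) refl)) (ℤ.*-identityˡ (g a)))
                 (∑-δ-∉ g (λ a∈l → All.lookup x∉ a∈l refl)))
      (ℤ.+-identityʳ (g a))
    ∑-δ {x ∷ l} {a} g (x∉ ∷ u) (there a∈l) = trans
      (cong₂ _+_ (trans (cong (_* g x) (⟦⟧-false (x ≟ a) (λ x≡a → All.lookup x∉ a∈l x≡a))) refl)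
                 (∑-δ g u a∈l))
      (ℤ.+-identityˡ (g a))

    ∑-δ₁ : ∀ {l : List A} {a} → Unique l → a ∈ l → ∑[ y ∈ l ] ⟦ y ≟ a ⟧ ≡ 1ℤ
    ∑-δ₁ {l} u a∈l = trans (∑-cong l (λ y → sym (ℤ.*-identityʳ _))) (∑-δ (λ _ → 1ℤ) u a∈l)

  ∑-zero⁻¹ : ∀ {A : Set} (l : List A) {f : A → ℤ} → (∀ x → 0ℤ ≤ f x) → ∑ l f ≡ 0ℤ → ∀ {x} → x ∈ l → f x ≡ 0ℤ
  ∑-zero⁻¹ (x ∷ l) {f} f≥0 eq x∈ = go x∈
    where
    tail≥0 = ∑-nonneg l f≥0
    head≡0 : f x ≡ 0ℤ
    head≡0 = ℤ.≤-antisym (subst (f x ≤_) eq (subst (_≤ f x + ∑ l f) (ℤ.+-identityʳ (f x))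
        (ℤ.+-monoʳ-≤ (f x) tail≥0))) (f≥0 x)
    tail≡0 : ∑ l f ≡ 0ℤ
    tail≡0 = trans (sym (ℤ.+-identityˡ _)) (trans (cong (_+ ∑ l f) (sym head≡0)) eq)
    go : ∀ {y} → y ∈ x ∷ l → f y ≡ 0ℤ
    go (here refl) = head≡0
    go (there y∈l) = ∑-zero⁻¹ l f≥0 tail≡0 y∈l

  ∑-++ : ∀ {A : Set} (l l′ : List A) (f : A → ℤ) → ∑ (l ++ l′) f ≡ ∑ l f + ∑ l′ f
  ∑-++ []      l′ f = sym (ℤ.+-identityˡ _)
  ∑-++ (x ∷ l) l′ f = trans (cong (_+_ (f x)) (∑-++ l l′ f)) (sym (ℤ.+-assoc (f x) _ _))

  ∑-cartesianProductWith : ∀ {A B C : Set} (h : A → B → C) (l : List A) (l′ : List B) (f : C → ℤ) →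
    ∑ (cartesianProductWith h l l′) f ≡ ∑[ x ∈ l ] ∑[ y ∈ l′ ] f (h x y)
  ∑-cartesianProductWith h []      l′ f = refl
  ∑-cartesianProductWith h (x ∷ l) l′ f =
    trans (∑-++ (map (h x) l′) _ f) (cong₂ _+_ (∑-map (h x) l′ f) (∑-cartesianProductWith h l l′ f))

  ∑-∣ : ∀ {A : Set} (l : List A) {d} {f : A → ℤ} → (∀ x → d ∣ f x) → d ∣ ∑ l f
  ∑-∣ []      h = divides 0ℤ refl
  ∑-∣ (x ∷ l) h = ∣m∣n⇒∣m+n (h x) (∑-∣ l h)

  -- Each term over `l` is spread over `l′` by a delta function. After exchanging the sums, an
  -- element of `l′` is hit at most once, as `l` has no repetitions.
  ∑-⊆ : ∀ {A : Set} (_≟_ : DecidableEquality A) {l l′ : List A} {w : A → ℤ} →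
    Unique l → Unique l′ → (∀ {x} → x ∈ l → x ∈ l′) → (∀ x → 0ℤ ≤ w x) → ∑ l w ≤ ∑ l′ w
  ∑-⊆ _≟_ {l} {l′} {w} u u′ l⊆l′ w≥0 = subst₂ _≤_ (sym spread) refl (∑-mono l′ λ {x} _ → bound x)
    where
    spread : ∑ l w ≡ ∑[ x ∈ l′ ] ∑[ y ∈ l ] (⟦ x ≟ y ⟧ * w x)
    spread = trans (∑-cong-∈ l (λ y∈l → sym (∑-δ _≟_ w u′ (l⊆l′ y∈l)))) (∑-swap l l′ _)
    at-most-1 : ∀ {l} x → Unique l → ∑[ y ∈ l ] ⟦ x ≟ y ⟧ ≤ 1ℤ
    at-most-1 {[]} x _ = +≤+ ℕ.z≤n
    at-most-1 {y ∷ l} x (y∉ ∷ u) with x ≟ y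
    ... | yes refl = ℤ.≤-reflexive (cong (_+_ 1ℤ) (∑-zero l
        (λ {y} y∈l → ⟦⟧-false (x ≟ y) (All.lookup y∉ y∈l))))
    ... | no _ = subst (_≤ 1ℤ) (sym (ℤ.+-identityˡ _)) (at-most-1 x u)
    bound : ∀ x → ∑[ y ∈ l ] (⟦ x ≟ y ⟧ * w x) ≤ w x
    bound x = subst₂ _≤_ (sym (∑-*ʳ l _ (w x))) (ℤ.*-identityˡ (w x))
      (ℤ.*-monoʳ-≤-nonNeg (w x) {{ℤ.nonNegative (w≥0 x)}} (at-most-1 x u))

  lookup-injective : ∀ {A : Set} {l : List A} → Unique l → ∀ {i j} → lookup l i ≡ lookup l j → i ≡ j
  lookup-injective (x∉ ∷ u) {zero}  {zero}  eq = refl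
  lookup-injective (x∉ ∷ u) {zero}  {suc j} eq = ⊥-elim (All.lookup x∉ (∈-lookup j) eq)
  lookup-injective (x∉ ∷ u) {suc i} {zero}  eq = ⊥-elim (All.lookup x∉ (∈-lookup i) (sym eq))
  lookup-injective (x∉ ∷ u) {suc i} {suc j} eq = cong suc (lookup-injective u eq)

  length-cartesianProductWith : ∀ {A B C : Set} (f : A → B → C) l l′ →
      length (cartesianProductWith f l l′) ≡ length l ℕ.* length l′
  length-cartesianProductWith f []      l′ = refl
  length-cartesianProductWith f (x ∷ l) l′ = trans (length-++ (map (f x) l′))
      (cong₂ ℕ._+_ (length-map (f x) l′) (length-cartesianProductWith f l l′))

open Sums

-- Cores of conference matrices.

module ConferenceMatrices where

  open import Data.Integer.Base using (_+_; _*_; -_; _-_; _≤_; _<_)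
  open import Data.Integer.Divisibility.Signed
    using (_∣_; divides; _∣?_; ∣ᵤ⇒∣; ∣⇒∣ᵤ; ∣m∣n⇒∣m+n; ∣n⇒∣m*n)

  ±1 : ℤ → Set
  ±1 s = s ≡ 1ℤ ⊎ s ≡ -1ℤ

  ±1-* : ∀ {a b} → ±1 a → ±1 b → ±1 (a * b)
  ±1-* (inj₁ refl) (inj₁ refl) = inj₁ refl
  ±1-* (inj₁ refl) (inj₂ refl) = inj₂ refl
  ±1-* (inj₂ refl) (inj₁ refl) = inj₂ refl
  ±1-* (inj₂ refl) (inj₂ refl) = inj₁ refl

  ±1-square : ∀ {a} → ±1 a → a * a ≡ 1ℤ
  ±1-square (inj₁ refl) = refl
  ±1-square (inj₂ refl) = refl

  ±1-≢ : ∀ {a b} → ±1 a → ±1 b → a ≢ b → a ≡ - b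
  ±1-≢ (inj₁ refl) (inj₁ refl) a≢b = ⊥-elim (a≢b refl)
  ±1-≢ (inj₁ refl) (inj₂ refl) _   = refl
  ±1-≢ (inj₂ refl) (inj₁ refl) _   = refl
  ±1-≢ (inj₂ refl) (inj₂ refl) a≢b = ⊥-elim (a≢b refl)

  -- This is the matrix left when a normalized conference matrix loses its border. The sign `ε`
  -- admits symmetric and skew matrices alike, since a skew one may have symmetric powers.
  record Conference (X : Set) : Set where
    field
      _≟_      : DecidableEquality X
      elems    : List X
      unique   : Unique elems
      complete : ∀ x → x ∈ elems
      Q        : X → X → ℤ
      diagonal : ∀ x → Q x x ≡ 0ℤ
      unit     : ∀ {x y} → x ≢ y → ±1 (Q x y)
      balanced : ∀ x → ∑[ z ∈ elems ] Q x z ≡ 0ℤ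
      orthogonal : ∀ {x y} → x ≢ y → ∑[ z ∈ elems ] (Q x z * Q y z) ≡ -1ℤ
      ε        : ℤ
      ε-unit   : ±1 ε
      reverse  : ∀ x y → Q y x ≡ ε * Q x y

    order : ℤ
    order = + length elems

  -- Quadratic residues modulo an odd prime.

  module Legendre (p : ℕ) (p-prime : Prime p) (p≢2 : p ≢ 2) where

    instance
      p-nonZero : NonZero p
      p-nonZero = prime⇒nonZero p-prime

    P : ℤ
    P = + p

    infix 4 _≈_ _≉_ _≈?_
    _≈_ _≉_ : ℤ → ℤ → Set
    a ≈ b = P ∣ a - b
    a ≉ b = ¬ (a ≈ b)

    _≈?_ : ∀ a b → Dec (a ≈ b)
    a ≈? b = P ∣? (a - b)

    -- Congruences are proved by certificates: the difference is written as an integer combination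
    -- of known multiples of p, and the identity is left to the ring solver.
    lin₁ : ∀ {T} α {A} → P ∣ A → T ≡ α * A → P ∣ T
    lin₁ α A refl = ∣n⇒∣m*n α A

    lin₂ : ∀ {T} α β {A B} → P ∣ A → P ∣ B → T ≡ α * A + β * B → P ∣ T
    lin₂ α β A B refl = ∣m∣n⇒∣m+n (∣n⇒∣m*n α A) (∣n⇒∣m*n β B)

    lin₃ : ∀ {T} α β γ {A B C} → P ∣ A → P ∣ B → P ∣ C → T ≡ α * A + β * B + γ * C → P ∣ T
    lin₃ α β γ A B C refl = ∣m∣n⇒∣m+n (∣m∣n⇒∣m+n (∣n⇒∣m*n α A) (∣n⇒∣m*n β B)) (∣n⇒∣m*n γ C)

    ≈-sym : ∀ a b → a ≈ b → b ≈ a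
    ≈-sym a b h = lin₁ -1ℤ h (eq a b)
      where
      eq : ∀ a b → b - a ≡ -1ℤ * (a - b)
      eq = solve-∀

    ≈-trans : ∀ a b c → a ≈ b → b ≈ c → a ≈ c
    ≈-trans a b c h k = lin₂ 1ℤ 1ℤ h k (eq a b c)
      where
      eq : ∀ a b c → a - c ≡ 1ℤ * (a - b) + 1ℤ * (b - c)
      eq = solve-∀

    F : List (Fin p)
    F = allFin p

    ⌜_⌝ : Fin p → ℤ
    ⌜ i ⌝ = + toℕ i

    residue : ∀ a → ∃[ i ] ⌜ i ⌝ ≈ a
    residue a = fromℕ< a%p<p , divides (- (a /ℕ p))
        (trans (cong₂ _-_ (cong +_ (Fin.toℕ-fromℕ< a%p<p)) (a≡a%ℕn+[a/ℕn]*n a p))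
        (eq (+ (a %ℕ p)) (a /ℕ p) P))
      where
      a%p<p = n%ℕd<d a p
      eq : ∀ r q P → r - (r + q * P) ≡ - q * P
      eq = solve-∀

    ⌜⌝-injective : ∀ {i j} → ⌜ i ⌝ ≈ ⌜ j ⌝ → i ≡ j
    ⌜⌝-injective {i} {j} h = Fin.toℕ-injective (ℤ.+-injective
        (ℤ.i-j≡0⇒i≡j _ _ (ℤ.∣i∣≡0⇒i≡0 (small (∣⇒∣ᵤ h)))))
      where
      bound : ∣ ⌜ i ⌝ - ⌜ j ⌝ ∣ ℕ.< p
      bound = ℕ.≤-<-trans (subst (λ z → ∣ z ∣ ℕ.≤ toℕ i ℕ.⊔ toℕ j) (sym (ℤ.m-n≡m⊖n (toℕ i) (toℕ j)))
          (ℤ.∣m⊝n∣≤m⊔n (toℕ i) (toℕ j)))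
                          (ℕ.⊔-lub (Fin.toℕ<n i) (Fin.toℕ<n j))
      small : p ℕ.∣ ∣ ⌜ i ⌝ - ⌜ j ⌝ ∣ → ∣ ⌜ i ⌝ - ⌜ j ⌝ ∣ ≡ 0
      small p∣ with ∣ ⌜ i ⌝ - ⌜ j ⌝ ∣ | bound
      ... | zero  | _ = refl
      ... | suc m | m<p = ⊥-elim (ℕ.>⇒∤ m<p p∣)

    Periodic : (ℤ → ℤ) → Set
    Periodic g = ∀ {a b} → a ≈ b → g a ≡ g b

    ∑F-δ : ∀ a g → Periodic g → ∑[ i ∈ F ] (⟦ ⌜ i ⌝ ≈? a ⟧ * g ⌜ i ⌝) ≡ g a
    ∑F-δ a g per with residue a
    ... | j , j≈a = trans
      (∑-cong F (λ i → cong (_* g ⌜ i ⌝)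
        (⟦⟧-⇔ (⌜ i ⌝ ≈? a) (i Fin.≟ j) (λ h → ⌜⌝-injective (≈-trans ⌜ i ⌝ a ⌜ j ⌝ h (≈-sym ⌜ j ⌝ a j≈a)))
            (λ { refl → j≈a }))))
      (trans (∑-δ Fin._≟_ (g ∘ ⌜_⌝) (allFin⁺ p) (∈-allFin j)) (per j≈a))

    ∑F-δ₁ : ∀ a → ∑[ i ∈ F ] ⟦ ⌜ i ⌝ ≈? a ⟧ ≡ 1ℤ
    ∑F-δ₁ a = trans (∑-cong F (λ i → sym (ℤ.*-identityʳ _))) (∑F-δ a (λ _ → 1ℤ) (λ _ → refl))

    ∑F-1 : ∑[ i ∈ F ] 1ℤ ≡ P
    ∑F-1 = trans (∑-length F) (cong +_ (length-tabulate {n = p} id))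

    -- Translation permutes the residues: for each j exactly one i satisfies j ≈ i + c, which a
    -- double sum over delta functions expresses without naming the permutation.
    ∑F-shift : ∀ c g → Periodic g → ∑[ i ∈ F ] g ⌜ i ⌝ ≡ ∑[ i ∈ F ] g (⌜ i ⌝ + c)
    ∑F-shift c g per = sym (begin
      ∑[ i ∈ F ] g (⌜ i ⌝ + c)
        ≡⟨ ∑-cong F (λ i → sym (∑F-δ (⌜ i ⌝ + c) g per)) ⟩
      ∑[ i ∈ F ] ∑[ j ∈ F ] (⟦ ⌜ j ⌝ ≈? ⌜ i ⌝ + c ⟧ * g ⌜ j ⌝)
        ≡⟨ ∑-swap F F _ ⟩
      ∑[ j ∈ F ] ∑[ i ∈ F ] (⟦ ⌜ j ⌝ ≈? ⌜ i ⌝ + c ⟧ * g ⌜ j ⌝)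
        ≡⟨ ∑-cong F (λ j → ∑-*ʳ F _ (g ⌜ j ⌝)) ⟩
      ∑[ j ∈ F ] ((∑[ i ∈ F ] ⟦ ⌜ j ⌝ ≈? ⌜ i ⌝ + c ⟧) * g ⌜ j ⌝)
        ≡⟨ ∑-cong F (λ j → trans (cong (_* g ⌜ j ⌝)
            (trans (∑-cong F (λ i → ⟦⟧-⇔ (⌜ j ⌝ ≈? ⌜ i ⌝ + c) (⌜ i ⌝ ≈? ⌜ j ⌝ - c)
             (λ h → lin₁ -1ℤ h (eq ⌜ i ⌝ ⌜ j ⌝ c)) (λ h → lin₁ -1ℤ h (eq′ ⌜ i ⌝ ⌜ j ⌝ c))))
                 (∑F-δ₁ (⌜ j ⌝ - c)))) (ℤ.*-identityˡ _)) ⟩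
      ∑[ j ∈ F ] g ⌜ j ⌝ ∎)
      where
      open ≡-Reasoning
      eq : ∀ i j c → i - (j - c) ≡ -1ℤ * (j - (i + c))
      eq = solve-∀
      eq′ : ∀ i j c → j - (i + c) ≡ -1ℤ * (i - (j - c))
      eq′ = solve-∀

    ≈0-split : ∀ a b → a * b ≈ 0ℤ → a ≈ 0ℤ ⊎ b ≈ 0ℤ
    ≈0-split a b h with euclidsLemma ∣ a ∣ ∣ b ∣ p-prime
      (subst (p ℕ.∣_) (trans (cong ∣_∣ (ℤ.+-identityʳ (a * b))) (ℤ.abs-* a b)) (∣⇒∣ᵤ h))
    ... | inj₁ h₁ = inj₁ (subst (P ∣_) (sym (ℤ.+-identityʳ a)) (∣ᵤ⇒∣ h₁))
    ... | inj₂ h₂ = inj₂ (subst (P ∣_) (sym (ℤ.+-identityʳ b)) (∣ᵤ⇒∣ h₂))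

    inverse : ∀ a → a ≉ 0ℤ → ∃[ b ] a * b ≈ 1ℤ
    inverse a a≉0 with residue a
    ... | i , i≈a with coprime-Bézout (prime⇒coprime p-prime {{ℕ.≢-nonZero i≢0}} (Fin.toℕ<n i))
      where
      i≢0 : toℕ i ≢ 0
      i≢0 eq = a≉0 (≈-sym 0ℤ a (subst (λ n → + n ≈ a) eq i≈a))
    -- Here 1 + y i = x p, so the inverse is - y; the other sign of the Bézout identity gives y
    -- itself.
    ... | Bézout.+- x y eq = - + y , lin₂ (+ y) (- + x) i≈a (divides 1ℤ (sym (ℤ.*-identityˡ P)))
          (poly a ⌜ i ⌝ (+ x) (+ y) P (cast eq))
      where
      cast : 1 ℕ.+ y ℕ.* toℕ i ≡ x ℕ.* p → 1ℤ + + y * ⌜ i ⌝ ≡ + x * P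
      cast e = trans (cong (_+_ 1ℤ) (sym (ℤ.pos-* y (toℕ i)))) (trans (cong +_ e) (ℤ.pos-* x p))
      ring₁ : ∀ a i x y P → a * - y - 1ℤ ≡ y * (i - a) + (- x) * P + (x * P - (1ℤ + y * i))
      ring₁ = solve-∀
      poly : ∀ a i x y P → 1ℤ + y * i ≡ x * P → a * - y - 1ℤ ≡ y * (i - a) + (- x) * P
      poly a i x y P e = trans (ring₁ a i x y P) (trans
          (cong (_+_ (y * (i - a) + (- x) * P)) (ℤ.i≡j⇒i-j≡0 (sym e))) (ℤ.+-identityʳ _))
    ... | Bézout.-+ x y eq = + y , lin₂ (- + y) (+ x) i≈a (divides 1ℤ (sym (ℤ.*-identityˡ P)))
          (poly a ⌜ i ⌝ (+ x) (+ y) P (cast eq))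
      where
      cast : 1 ℕ.+ x ℕ.* p ≡ y ℕ.* toℕ i → 1ℤ + + x * P ≡ + y * ⌜ i ⌝
      cast e = trans (cong (_+_ 1ℤ) (sym (ℤ.pos-* x p))) (trans (cong +_ e) (ℤ.pos-* y (toℕ i)))
      ring₁ : ∀ a i x y P → a * y - 1ℤ ≡ (- y) * (i - a) + x * P + (y * i - (1ℤ + x * P))
      ring₁ = solve-∀
      poly : ∀ a i x y P → 1ℤ + x * P ≡ y * i → a * y - 1ℤ ≡ (- y) * (i - a) + x * P
      poly a i x y P e = trans (ring₁ a i x y P) (trans
          (cong (_+_ ((- y) * (i - a) + x * P)) (ℤ.i≡j⇒i-j≡0 (sym e))) (ℤ.+-identityʳ _))

    2≉0 : + 2 ≉ 0ℤ
    2≉0 h = p≢2 (ℕ.≤-antisym (ℕ.∣⇒≤ (∣⇒∣ᵤ h)) (ℕ.nonTrivial⇒n>1 p {{prime⇒nonTrivial p-prime}}))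

    half : ℤ
    half = proj₁ (inverse (+ 2) 2≉0)

    half-spec : + 2 * half ≈ 1ℤ
    half-spec = proj₂ (inverse (+ 2) 2≉0)

    Root : ℤ → Set
    Root z = ∃[ i ] ⌜ i ⌝ * ⌜ i ⌝ ≈ z

    root? : ∀ z → Dec (Root z)
    root? z = Fin.any? (λ i → ⌜ i ⌝ * ⌜ i ⌝ ≈? z)

    root : ∀ s z → s * s ≈ z → Root z
    root s z h with residue s
    ... | i , i≈s = i , lin₂ (⌜ i ⌝ + s) 1ℤ i≈s h (eq ⌜ i ⌝ s z)
      where
      eq : ∀ i s z → i * i - z ≡ (i + s) * (i - s) + 1ℤ * (s * s - z)
      eq = solve-∀

    roots : ℤ → ℤ
    roots z = ∑[ i ∈ F ] ⟦ ⌜ i ⌝ * ⌜ i ⌝ ≈? z ⟧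

    square-periodic : ∀ z a b → a ≈ b → ⟦ a * a ≈? z ⟧ ≡ ⟦ b * b ≈? z ⟧
    square-periodic z a b a≈b = ⟦⟧-⇔ (a * a ≈? z) (b * b ≈? z)
        (λ h → lin₂ (- (a + b)) 1ℤ a≈b h (eq a b z)) (λ h → lin₂ (a + b) 1ℤ a≈b h (eq′ a b z))
      where
      eq : ∀ a b z → b * b - z ≡ - (a + b) * (a - b) + 1ℤ * (a * a - z)
      eq = solve-∀
      eq′ : ∀ a b z → a * a - z ≡ (a + b) * (a - b) + 1ℤ * (b * b - z)
      eq′ = solve-∀

    ≈-cong-⟦⟧ : ∀ c {a b} → a ≈ b → ⟦ c ≈? a ⟧ ≡ ⟦ c ≈? b ⟧
    ≈-cong-⟦⟧ c {a} {b} a≈b = ⟦⟧-⇔ (c ≈? a) (c ≈? b) (λ h → ≈-trans c a b h a≈b)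
        (λ h → ≈-trans c b a h (≈-sym a b a≈b))

    roots-periodic : Periodic roots
    roots-periodic a≈b = ∑-cong F (λ i → ≈-cong-⟦⟧ (⌜ i ⌝ * ⌜ i ⌝) a≈b)

    roots-0 : ∀ {z} → z ≈ 0ℤ → roots z ≡ 1ℤ
    roots-0 {z} z≈0 = trans (∑-cong F (λ i → ⟦⟧-⇔ (⌜ i ⌝ * ⌜ i ⌝ ≈? z) (⌜ i ⌝ ≈? 0ℤ)
        (λ h → [_,_]′ id id (≈0-split ⌜ i ⌝ ⌜ i ⌝ (≈-trans (⌜ i ⌝ * ⌜ i ⌝) z 0ℤ h z≈0)))
        (λ h → ≈-trans (⌜ i ⌝ * ⌜ i ⌝) 0ℤ z (lin₁ ⌜ i ⌝ h (eq ⌜ i ⌝)) (≈-sym z 0ℤ z≈0)))) (∑F-δ₁ 0ℤ)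
      where
      eq : ∀ i → i * i - 0ℤ ≡ i * (i - 0ℤ)
      eq = solve-∀

    roots-2 : ∀ {z} → z ≉ 0ℤ → Root z → roots z ≡ + 2
    roots-2 {z} z≉0 (j , j²≈z) = trans (∑-cong F pointwise)
        (trans (∑-+ F _ _) (cong₂ _+_ (∑F-δ₁ s) (∑F-δ₁ (- s))))
      where
      s = ⌜ j ⌝
      s≉-s : s ≉ - s
      s≉-s h with ≈0-split (+ 2) s (subst (P ∣_) (eq s) h)
        where
        eq : ∀ s → s - - s ≡ + 2 * s - 0ℤ
        eq = solve-∀
      ... | inj₁ 2≈0 = 2≉0 2≈0
      ... | inj₂ s≈0 = z≉0 (lin₂ s -1ℤ s≈0 j²≈z (eq s z))
        where
        eq : ∀ s z → z - 0ℤ ≡ s * (s - 0ℤ) + -1ℤ * (s * s - z)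
        eq = solve-∀
      pointwise : ∀ i → ⟦ ⌜ i ⌝ * ⌜ i ⌝ ≈? z ⟧ ≡ ⟦ ⌜ i ⌝ ≈? s ⟧ + ⟦ ⌜ i ⌝ ≈? - s ⟧
      pointwise i with ⌜ i ⌝ ≈? s | ⌜ i ⌝ ≈? - s
      ... | yes h | yes k = ⊥-elim (s≉-s (≈-trans s ⌜ i ⌝ (- s) (≈-sym ⌜ i ⌝ s h) k))
      ... | yes h | no  _ = ⟦⟧-true (⌜ i ⌝ * ⌜ i ⌝ ≈? z) (lin₂ (⌜ i ⌝ + s) 1ℤ h j²≈z (eq ⌜ i ⌝ s z))
        where
        eq : ∀ x s z → x * x - z ≡ (x + s) * (x - s) + 1ℤ * (s * s - z)
        eq = solve-∀
      ... | no  _ | yes k = ⟦⟧-true (⌜ i ⌝ * ⌜ i ⌝ ≈? z) (lin₂ (⌜ i ⌝ - s) 1ℤ k j²≈z (eq ⌜ i ⌝ s z))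
        where
        eq : ∀ x s z → x * x - z ≡ (x - s) * (x - - s) + 1ℤ * (s * s - z)
        eq = solve-∀
      ... | no ¬h | no ¬k = ⟦⟧-false (⌜ i ⌝ * ⌜ i ⌝ ≈? z) λ x²≈z →
          contra (≈0-split (⌜ i ⌝ - s) (⌜ i ⌝ + s) (lin₂ 1ℤ -1ℤ x²≈z j²≈z (eq ⌜ i ⌝ s z)))
        where
        eq : ∀ x s z → (x - s) * (x + s) - 0ℤ ≡ 1ℤ * (x * x - z) + -1ℤ * (s * s - z)
        eq = solve-∀
        e₁ : ∀ a → a - 0ℤ ≡ a
        e₁ = solve-∀
        e₂ : ∀ a s → a + s - 0ℤ ≡ a - - s
        e₂ = solve-∀
        contra : (⌜ i ⌝ - s) ≈ 0ℤ ⊎ (⌜ i ⌝ + s) ≈ 0ℤ → ⊥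
        contra (inj₁ h) = ¬h (subst (P ∣_) (e₁ _) h)
        contra (inj₂ h) = ¬k (subst (P ∣_) (e₂ ⌜ i ⌝ s) h)

    roots-none : ∀ {z} → ¬ Root z → roots z ≡ 0ℤ
    roots-none {z} ¬r = ∑-zero F (λ {i} _ → ⟦⟧-false (⌜ i ⌝ * ⌜ i ⌝ ≈? z) (λ h → ¬r (i , h)))

    -- Every i is a square root for exactly one j, namely a - i².
    ∑-roots : ∀ a → ∑[ j ∈ F ] roots (a - ⌜ j ⌝) ≡ P
    ∑-roots a = trans (∑-swap F F _) (trans (∑-cong F (λ i → trans
        (∑-cong F (λ j → ⟦⟧-⇔ (⌜ i ⌝ * ⌜ i ⌝ ≈? a - ⌜ j ⌝) (⌜ j ⌝ ≈? a - ⌜ i ⌝ * ⌜ i ⌝)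
            (λ h → lin₁ 1ℤ h (eq a ⌜ i ⌝ ⌜ j ⌝)) (λ h → lin₁ 1ℤ h (eq′ a ⌜ i ⌝ ⌜ j ⌝))))
        (∑F-δ₁ (a - ⌜ i ⌝ * ⌜ i ⌝)))) ∑F-1)
      where
      eq : ∀ a i j → j - (a - i * i) ≡ 1ℤ * (i * i - (a - j))
      eq = solve-∀
      eq′ : ∀ a i j → i * i - (a - j) ≡ 1ℤ * (j - (a - i * i))
      eq′ = solve-∀

    -- The equation y² = d + x² has p − 1 solutions: for each u ≠ 0 the substitution
    -- y = u + x leaves a linear equation for x.
    line-count : ∀ d → d ≉ 0ℤ → ∀ u →
      ∑[ x ∈ F ] ⟦ (⌜ u ⌝ + ⌜ x ⌝) * (⌜ u ⌝ + ⌜ x ⌝) ≈? d + ⌜ x ⌝ * ⌜ x ⌝ ⟧ ≡ 1ℤ - ⟦ ⌜ u ⌝ ≈? 0ℤ ⟧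
    line-count d d≉0 u with ⌜ u ⌝ ≈? 0ℤ
    ... | yes u≈0 = ∑-zero F (λ {x} _ → ⟦⟧-false ((⌜ u ⌝ + ⌜ x ⌝) * (⌜ u ⌝ + ⌜ x ⌝) ≈? d + ⌜ x ⌝ * ⌜ x ⌝)
        (λ h →
            d≉0 (lin₂ (⌜ u ⌝ + + 2 * ⌜ x ⌝) -1ℤ u≈0 h (eq ⌜ u ⌝ ⌜ x ⌝ d))))
      where
      eq : ∀ u x d → d - 0ℤ ≡ (u + + 2 * x) * (u - 0ℤ) + -1ℤ * ((u + x) * (u + x) - (d + x * x))
      eq = solve-∀
    ... | no u≉0 with inverse ⌜ u ⌝ u≉0
    ... | v , uv≈1 = trans (∑-cong F (λ x → ⟦⟧-⇔ ((⌜ u ⌝ + ⌜ x ⌝) * (⌜ u ⌝ + ⌜ x ⌝) ≈? d + ⌜ x ⌝ * ⌜ x ⌝)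
        (⌜ x ⌝ ≈? (d * v - ⌜ u ⌝) * half)
            (λ h → lin₃ (half * v) (- (half * ⌜ u ⌝ + + 2 * half * ⌜ x ⌝)) (- ⌜ x ⌝) h uv≈1 half-spec
                (eq ⌜ u ⌝ ⌜ x ⌝ d v half))
            (λ h → lin₃ (+ 2 * ⌜ u ⌝) (+ 2 * half * d) (d - ⌜ u ⌝ * ⌜ u ⌝) h uv≈1 half-spec
                (eq′ ⌜ u ⌝ ⌜ x ⌝ d v half))))
        (∑F-δ₁ ((d * v - ⌜ u ⌝) * half))
      where
      eq : ∀ u x d v h → x - (d * v - u) * h ≡
        (h * v) * ((u + x) * (u + x) - (d + x * x)) + (- (h * u + + 2 * h * x)) * (u * v - 1ℤ) + (- x) *
            (+ 2 * h - 1ℤ)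
      eq = solve-∀
      eq′ : ∀ u x d v h → (u + x) * (u + x) - (d + x * x) ≡
        (+ 2 * u) * (x - (d * v - u) * h) + (+ 2 * h * d) * (u * v - 1ℤ) + (d - u * u) * (+ 2 * h - 1ℤ)
      eq′ = solve-∀

    -- The sum counts solutions of x² ≈ a - j, y² ≈ b - j. Eliminating j leaves the hyperbola y² -
    -- x² ≈ b - a, which the shift y = u + x cuts into lines.
    ∑-roots-roots : ∀ a b → b - a ≉ 0ℤ → ∑[ j ∈ F ] (roots (a - ⌜ j ⌝) * roots (b - ⌜ j ⌝)) ≡ P - 1ℤ
    ∑-roots-roots a b b≉a = begin
      ∑[ j ∈ F ] (roots (a - ⌜ j ⌝) * roots (b - ⌜ j ⌝))
        ≡⟨ ∑-cong F (λ j → ∑-product F F _ _) ⟩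
      ∑[ j ∈ F ] ∑[ x ∈ F ] ∑[ y ∈ F ] (A x j * B y j)
        ≡⟨ ∑-swap F F _ ⟩
      ∑[ x ∈ F ] ∑[ j ∈ F ] ∑[ y ∈ F ] (A x j * B y j)
        ≡⟨ ∑-cong F (λ x → ∑-swap F F _) ⟩
      ∑[ x ∈ F ] ∑[ y ∈ F ] ∑[ j ∈ F ] (A x j * B y j)
        ≡⟨ ∑-cong F (λ x → ∑-cong F (λ y → eliminate x y)) ⟩
      ∑[ x ∈ F ] ∑[ y ∈ F ] ⟦ ⌜ y ⌝ * ⌜ y ⌝ ≈? (b - a) + ⌜ x ⌝ * ⌜ x ⌝ ⟧
        ≡⟨ ∑-cong F (λ x → ∑F-shift ⌜ x ⌝ (λ w → ⟦ w * w ≈? (b - a) + ⌜ x ⌝ * ⌜ x ⌝ ⟧)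
            (λ {w} {z} → square-periodic (b - a + ⌜ x ⌝ * ⌜ x ⌝) w z)) ⟩
      ∑[ x ∈ F ] ∑[ u ∈ F ] ⟦ (⌜ u ⌝ + ⌜ x ⌝) * (⌜ u ⌝ + ⌜ x ⌝) ≈? (b - a) + ⌜ x ⌝ * ⌜ x ⌝ ⟧
        ≡⟨ ∑-swap F F _ ⟩
      ∑[ u ∈ F ] ∑[ x ∈ F ] ⟦ (⌜ u ⌝ + ⌜ x ⌝) * (⌜ u ⌝ + ⌜ x ⌝) ≈? (b - a) + ⌜ x ⌝ * ⌜ x ⌝ ⟧
        ≡⟨ ∑-cong F (line-count (b - a) b≉a) ⟩
      ∑[ u ∈ F ] (1ℤ - ⟦ ⌜ u ⌝ ≈? 0ℤ ⟧)
        ≡⟨ ∑-cong F (λ u → cong (_+_ 1ℤ) (sym (ℤ.-1*i≡-i ⟦ ⌜ u ⌝ ≈? 0ℤ ⟧))) ⟩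
      ∑[ u ∈ F ] (1ℤ + -1ℤ * ⟦ ⌜ u ⌝ ≈? 0ℤ ⟧)
        ≡⟨ ∑-+ F _ _ ⟩
      (∑[ u ∈ F ] 1ℤ) + (∑[ u ∈ F ] (-1ℤ * ⟦ ⌜ u ⌝ ≈? 0ℤ ⟧))
        ≡⟨ cong₂ _+_ ∑F-1 (trans (∑-*ˡ F -1ℤ _) (cong (-1ℤ *_) (∑F-δ₁ 0ℤ))) ⟩
      P - 1ℤ ∎
      where
      open ≡-Reasoning
      A B : Fin p → Fin p → ℤ
      A x j = ⟦ ⌜ x ⌝ * ⌜ x ⌝ ≈? a - ⌜ j ⌝ ⟧
      B y j = ⟦ ⌜ y ⌝ * ⌜ y ⌝ ≈? b - ⌜ j ⌝ ⟧
      eq : ∀ a x j → j - (a - x * x) ≡ 1ℤ * (x * x - (a - j))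
      eq = solve-∀
      eq′ : ∀ a x j → x * x - (a - j) ≡ 1ℤ * (j - (a - x * x))
      eq′ = solve-∀
      eq″ : ∀ b z w → (b - z) - (b - w) ≡ -1ℤ * (z - w)
      eq″ = solve-∀
      eq‴ : ∀ a b x → b - (a - x * x) ≡ b - a + x * x
      eq‴ = solve-∀
      eliminate : ∀ x y → ∑[ j ∈ F ] (A x j * B y j) ≡ ⟦ ⌜ y ⌝ * ⌜ y ⌝ ≈? (b - a) + ⌜ x ⌝ * ⌜ x ⌝ ⟧
      eliminate x y = trans
        (∑-cong F (λ j → cong (_* B y j) (⟦⟧-⇔ (⌜ x ⌝ * ⌜ x ⌝ ≈? a - ⌜ j ⌝) (⌜ j ⌝ ≈? a - ⌜ x ⌝ * ⌜ x ⌝)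
          (λ h → lin₁ 1ℤ h (eq a ⌜ x ⌝ ⌜ j ⌝)) (λ h → lin₁ 1ℤ h (eq′ a ⌜ x ⌝ ⌜ j ⌝)))))
        (trans (∑F-δ (a - ⌜ x ⌝ * ⌜ x ⌝) (λ z → ⟦ ⌜ y ⌝ * ⌜ y ⌝ ≈? b - z ⟧)
                  (λ {z} {w} z≈w → ≈-cong-⟦⟧ (⌜ y ⌝ * ⌜ y ⌝) (lin₁ -1ℤ z≈w (eq″ b z w))))
               (cong (λ c → ⟦ ⌜ y ⌝ * ⌜ y ⌝ ≈? c ⟧) (eq‴ a b ⌜ x ⌝)))

    -- The Legendre symbol as the number of square roots minus one. In this form character sums are
    -- solution counts, and neither Euler's criterion nor multiplicativity enters.
    χ : ℤ → ℤ
    χ z = roots z - 1ℤ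

    χ-unit : ∀ {z} → z ≉ 0ℤ → ±1 (χ z)
    χ-unit {z} z≉0 with root? z
    ... | yes r = inj₁ (cong (_- 1ℤ) (roots-2 z≉0 r))
    ... | no ¬r = inj₂ (cong (_- 1ℤ) (roots-none ¬r))

    ∑-χ : ∀ a → ∑[ j ∈ F ] χ (a - ⌜ j ⌝) ≡ 0ℤ
    ∑-χ a = trans (∑-+ F _ _) (trans (cong₂ _+_ (∑-roots a)
        (trans (∑-cong F (λ _ → refl)) (trans (∑-*ˡ F -1ℤ (λ _ → 1ℤ)) (cong (-1ℤ *_) ∑F-1)))) (eq P))
      where
      eq : ∀ P → P + -1ℤ * P ≡ 0ℤ
      eq = solve-∀

    ∑-χ-χ : ∀ a b → b - a ≉ 0ℤ → ∑[ j ∈ F ] (χ (a - ⌜ j ⌝) * χ (b - ⌜ j ⌝)) ≡ -1ℤ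
    ∑-χ-χ a b b≉a = trans (∑-cong F (λ j → eq (roots (a - ⌜ j ⌝)) (roots (b - ⌜ j ⌝))))
      (trans (∑-+ F _ _) (trans (cong₂ _+_ (trans (∑-+ F _ _) (cong₂ _+_ (∑-roots-roots a b b≉a)
          (trans (∑-*ˡ F -1ℤ _) (cong (-1ℤ *_) (trans (∑-+ F _ _) (cong₂ _+_ (∑-roots a) (∑-roots b)))))))
              ∑F-1) (eq′ P)))
      where
      eq : ∀ r s → (r - 1ℤ) * (s - 1ℤ) ≡ r * s + -1ℤ * (r + s) + 1ℤ
      eq = solve-∀
      eq′ : ∀ P → P - 1ℤ + -1ℤ * (P + P) + P ≡ -1ℤ
      eq′ = solve-∀

    neg≈0 : ∀ {z} → z ≈ 0ℤ → - z ≈ 0ℤ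
    neg≈0 {z} h = lin₁ -1ℤ h (eq z)
      where
      eq : ∀ z → - z - 0ℤ ≡ -1ℤ * (z - 0ℤ)
      eq = solve-∀

    neg≉0 : ∀ {z} → z ≉ 0ℤ → - z ≉ 0ℤ
    neg≉0 {z} h k = h (subst (_≈ 0ℤ) (ℤ.neg-involutive z) (neg≈0 {(- z)} k))

    -- Multiplication by a root of -1 carries a root of z to a root of - z, and conversely.
    roots-neg-even : Root -1ℤ → ∀ z → roots (- z) ≡ roots z
    roots-neg-even (i , i²≈-1) z with z ≈? 0ℤ
    ... | yes z≈0 = trans (roots-0 (neg≈0 {z} z≈0)) (sym (roots-0 z≈0))
    ... | no z≉0 with root? z
    ...   | yes (s , s²≈z) = trans (roots-2 (neg≉0 {z} z≉0)
        (root (⌜ i ⌝ * ⌜ s ⌝) (- z) (lin₂ (⌜ s ⌝ * ⌜ s ⌝) -1ℤ i²≈-1 s²≈z (eq ⌜ i ⌝ ⌜ s ⌝ z))))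
                                   (sym (roots-2 z≉0 (s , s²≈z)))
      where
      eq : ∀ i s z → i * s * (i * s) - - z ≡ s * s * (i * i - -1ℤ) + -1ℤ * (s * s - z)
      eq = solve-∀
    ...   | no ¬r = trans (roots-none λ { (s , s²≈-z) →
        ¬r (root (⌜ i ⌝ * ⌜ s ⌝) z (lin₂ (⌜ s ⌝ * ⌜ s ⌝) -1ℤ i²≈-1 s²≈-z (eq ⌜ i ⌝ ⌜ s ⌝ z))) })
                          (sym (roots-none ¬r))
      where
      eq : ∀ i s z → i * s * (i * s) - z ≡ s * s * (i * i - -1ℤ) + -1ℤ * (s * s - - z)
      eq = solve-∀

    -- If nonzero z and - z were both squares, the quotient of their roots would be a root of -1.
    roots-neg-≤ : ¬ Root -1ℤ → ∀ z → 0ℤ ≤ + 2 - (roots z + roots (- z))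
    roots-neg-≤ ¬i z with z ≈? 0ℤ
    ... | yes z≈0 = subst₂ (λ a b → 0ℤ ≤ + 2 - (a + b)) (sym (roots-0 z≈0))
        (sym (roots-0 (neg≈0 {z} z≈0))) (+≤+ ℕ.z≤n)
    ... | no z≉0 with root? z | root? (- z)
    ...   | no ¬r | no ¬r′ = subst₂ (λ a b → 0ℤ ≤ + 2 - (a + b)) (sym (roots-none ¬r))
        (sym (roots-none ¬r′)) (+≤+ ℕ.z≤n)
    ...   | no ¬r | yes r′ = subst₂ (λ a b → 0ℤ ≤ + 2 - (a + b)) (sym (roots-none ¬r))
        (sym (roots-2 (neg≉0 {z} z≉0) r′)) (+≤+ ℕ.z≤n)
    ...   | yes r | no ¬r′ = subst₂ (λ a b → 0ℤ ≤ + 2 - (a + b)) (sym (roots-2 z≉0 r))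
        (sym (roots-none ¬r′)) (+≤+ ℕ.z≤n)
    ...   | yes (s , s²≈z) | yes (w , w²≈-z) = ⊥-elim (¬i (quotient-root (inverse ⌜ s ⌝ s≉0)))
      where
      s≉0 : ⌜ s ⌝ ≉ 0ℤ
      s≉0 h = z≉0 (lin₂ ⌜ s ⌝ -1ℤ h s²≈z (eq ⌜ s ⌝ z))
        where
        eq : ∀ s z → z - 0ℤ ≡ s * (s - 0ℤ) + -1ℤ * (s * s - z)
        eq = solve-∀
      quotient-root : ∃[ v ] ⌜ s ⌝ * v ≈ 1ℤ → Root -1ℤ
      quotient-root (v , sv≈1) = root (⌜ w ⌝ * v) -1ℤ
        (lin₃ (v * v) (v * v) (- (⌜ s ⌝ * v + 1ℤ)) w²≈-z s²≈z sv≈1 (eq ⌜ s ⌝ ⌜ w ⌝ v z))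
        where
        eq : ∀ s w v z → w * v * (w * v) - -1ℤ ≡ v * v * (w * w - - z) + v * v * (s * s - z) +
            (- (s * v + 1ℤ)) * (s * v - 1ℤ)
        eq = solve-∀

    -- The differences 2 - (roots z + roots (- z)) are nonnegative and sum to 2p - 2p = 0, so each
    -- vanishes. This replaces the count that half of the nonzero residues are squares.
    roots-neg-odd : ¬ Root -1ℤ → ∀ z → roots z + roots (- z) ≡ + 2
    roots-neg-odd ¬i z with residue z
    ... | j , j≈z = trans (cong₂ _+_ (roots-periodic (≈-sym ⌜ j ⌝ z j≈z))
        (roots-periodic (lin₁ 1ℤ j≈z (eq ⌜ j ⌝ z))))
          (sym (ℤ.i-j≡0⇒i≡j _ _ (∑-zero⁻¹ F (λ i → roots-neg-≤ ¬i ⌜ i ⌝) total (∈-allFin j))))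
      where
      eq : ∀ j z → - z - - j ≡ 1ℤ * (j - z)
      eq = solve-∀
      eq₂ : ∀ r s → + 2 - (r + s) ≡ + 2 * 1ℤ + -1ℤ * (r + s)
      eq₂ = solve-∀
      eq₃ : ∀ P → + 2 * P + -1ℤ * (P + P) ≡ 0ℤ
      eq₃ = solve-∀
      ∑-roots⁺ : ∑[ i ∈ F ] roots ⌜ i ⌝ ≡ P
      ∑-roots⁺ = trans (∑-swap F F _) (trans (∑-cong F
          (λ i → trans (∑-cong F (λ j → ⟦⟧-⇔ (⌜ i ⌝ * ⌜ i ⌝ ≈? ⌜ j ⌝) (⌜ j ⌝ ≈? ⌜ i ⌝ * ⌜ i ⌝)
          (≈-sym (⌜ i ⌝ * ⌜ i ⌝) ⌜ j ⌝) (≈-sym ⌜ j ⌝ (⌜ i ⌝ * ⌜ i ⌝)))) (∑F-δ₁ (⌜ i ⌝ * ⌜ i ⌝)))) ∑F-1)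
      ∑-roots⁻ : ∑[ i ∈ F ] roots (- ⌜ i ⌝) ≡ P
      ∑-roots⁻ = trans (∑-cong F (λ i → cong roots (sym (ℤ.+-identityˡ (- ⌜ i ⌝))))) (∑-roots 0ℤ)
      total : ∑[ i ∈ F ] (+ 2 - (roots ⌜ i ⌝ + roots (- ⌜ i ⌝))) ≡ 0ℤ
      total = trans (∑-cong F (λ i → eq₂ (roots ⌜ i ⌝) (roots (- ⌜ i ⌝))))
          (trans (∑-+ F _ _) (trans (cong₂ _+_ (trans (∑-*ˡ F (+ 2) _) (cong (+ 2 *_) ∑F-1))
        (trans (∑-*ˡ F -1ℤ _) (cong (-1ℤ *_) (trans (∑-+ F _ _) (cong₂ _+_ ∑-roots⁺ ∑-roots⁻))))) (eq₃ P)))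

    χ-parity : ∃[ ε ] ±1 ε × (∀ z → χ (- z) ≡ ε * χ z)
    χ-parity with root? -1ℤ
    ... | yes i = 1ℤ , inj₁ refl , λ z → trans (cong (_- 1ℤ) (roots-neg-even i z)) (sym (ℤ.*-identityˡ _))
    ... | no ¬i = -1ℤ , inj₂ refl , λ z → eq (roots z) (roots (- z)) (roots-neg-odd ¬i z)
      where
      ring₁ : ∀ a b → b - 1ℤ ≡ -1ℤ * (a - 1ℤ) + (a + b - + 2)
      ring₁ = solve-∀
      eq : ∀ a b → a + b ≡ + 2 → b - 1ℤ ≡ -1ℤ * (a - 1ℤ)
      eq a b e = trans (ring₁ a b) (trans (cong (_+_ (-1ℤ * (a - 1ℤ))) (ℤ.i≡j⇒i-j≡0 e)) (ℤ.+-identityʳ _))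

    legendre : Conference (Fin p)
    legendre = record
      { _≟_      = Fin._≟_
      ; elems    = F
      ; unique   = allFin⁺ p
      ; complete = ∈-allFin
      ; Q        = λ x y → χ (⌜ x ⌝ - ⌜ y ⌝)
      ; diagonal = λ x → cong (_- 1ℤ) (roots-0 (lin₁ 0ℤ (divides 1ℤ (sym (ℤ.*-identityˡ P)))
          (cong (_- 0ℤ) (ℤ.+-inverseʳ ⌜ x ⌝))))
      ; unit     = λ x≢y → χ-unit (apart x≢y)
      ; balanced = λ x → ∑-χ ⌜ x ⌝
      ; orthogonal = λ {x} {y} x≢y → ∑-χ-χ ⌜ x ⌝ ⌜ y ⌝ (apart (x≢y ∘ sym))
      ; ε        = proj₁ χ-parity
      ; ε-unit   = proj₁ (proj₂ χ-parity)
      ; reverse  = λ x y → trans (cong χ (flip-sub ⌜ x ⌝ ⌜ y ⌝)) (proj₂ (proj₂ χ-parity) (⌜ x ⌝ - ⌜ y ⌝))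
      }
      where
      apart : ∀ {x y} → x ≢ y → ⌜ x ⌝ - ⌜ y ⌝ ≉ 0ℤ
      apart {x} {y} x≢y h = x≢y (⌜⌝-injective (subst (P ∣_) (ℤ.+-identityʳ _) h))
      flip-sub : ∀ a b → b - a ≡ - (a - b)
      flip-sub = solve-∀

  -- The k-th Turyn power of Q is the signed sum of the tensor words of length k,
  -- read cyclically, over the tiles Q and I ⊗ J.  It is computed by an automaton
  -- that is pending after a factor I and then reads the factor J; the words in
  -- which a tile I ⊗ J wraps around start and end in the pending state.
  module Turyn {X : Set} (C : Conference X) where

    open Conference C

    data State : Set where
      free pending : State

    flip-state : State → State
    flip-state free    = pending
    flip-state pending = free

    δ : State → State → ℤ
    δ free    free    = 1ℤ
    δ pending pending = 1ℤ
    δ _       _       = 0ℤ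

    W : State → State → ∀ {k} → Vec X k → Vec X k → ℤ
    W s       e []       []       = δ s e
    W free    e (x ∷ xs) (z ∷ zs) = ⟦ z ≟ x ⟧ * W pending e xs zs + Q x z * W free e xs zs
    W pending e (x ∷ xs) (z ∷ zs) = W free e xs zs

    vecs : ∀ k → List (Vec X k)
    vecs zero    = [] ∷ []
    vecs (suc k) = cartesianProductWith _∷_ elems (vecs k)

    vecs-unique : ∀ k → Unique (vecs k)
    vecs-unique zero    = [] ∷ []
    vecs-unique (suc k) = cartesianProductWith⁺ _∷_ (λ { refl → refl , refl }) unique (vecs-unique k)

    vecs-complete : ∀ {k} (xs : Vec X k) → xs ∈ vecs k
    vecs-complete []       = here refl
    vecs-complete (x ∷ xs) = ∈-cartesianProductWith⁺ _∷_ (complete x) (vecs-complete xs)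

    ∑-vecs : ∀ {k} (c : X → ℤ) (h : Vec X k → ℤ) →
             ∑[ z ∈ elems ] ∑[ zs ∈ vecs k ] (c z * h zs) ≡ ∑ elems c * ∑ (vecs k) h
    ∑-vecs {k} c h = sym (∑-product elems (vecs k) c h)

    -- The indicators of even and of odd k, and (-1)ᵏ.
    ev od sg : ℕ → ℤ
    ev zero    = 1ℤ
    ev (suc k) = od k
    od zero    = 0ℤ
    od (suc k) = ev k
    sg zero    = 1ℤ
    sg (suc k) = - sg k

    parity : ∀ k → (sg k ≡ 1ℤ × ev k ≡ 1ℤ × od k ≡ 0ℤ) ⊎ (sg k ≡ -1ℤ × ev k ≡ 0ℤ × od k ≡ 1ℤ)
    parity zero = inj₁ (refl , refl , refl)
    parity (suc k) with parity k
    ... | inj₁ (a , b , c) = inj₂ (cong -_ a , c , b)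
    ... | inj₂ (a , b , c) = inj₁ (cong -_ a , c , b)

    -- For k = 2 this is Q ⊗ Q + I ⊗ J - J ⊗ I. For even k the sign of the wrapped words is -1,
    -- which makes the two diagonal contributions cancel.
    power : ∀ {k} → Vec X k → Vec X k → ℤ
    power {k} xs zs = W free free xs zs + - sg k * W pending pending xs zs

    module Correlation where

      coincide inner : X → X → ℤ
      coincide x y = ∑[ z ∈ elems ] (⟦ z ≟ x ⟧ * ⟦ z ≟ y ⟧)
      inner  x y = ∑[ z ∈ elems ] (Q x z * Q y z)

      coincide-≡ : ∀ x → coincide x x ≡ 1ℤ
      coincide-≡ x = trans (∑-δ _≟_ (λ z → ⟦ z ≟ x ⟧) unique (complete x)) (⟦⟧-true (x ≟ x) refl)

      coincide-≢ : ∀ {x y} → x ≢ y → coincide x y ≡ 0ℤ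
      coincide-≢ {x} {y} x≢y = trans (∑-δ _≟_ (λ z → ⟦ z ≟ y ⟧) unique (complete x)) (⟦⟧-false (x ≟ y) x≢y)

      square : ∀ x z → Q x z * Q x z ≡ 1ℤ + -1ℤ * ⟦ z ≟ x ⟧
      square x z with z ≟ x
      ... | yes refl = cong₂ _*_ (diagonal z) (diagonal z)
      ... | no z≢x = ±1-square (unit (z≢x ∘ sym))

      inner-≡ : ∀ x → inner x x ≡ order - 1ℤ
      inner-≡ x = trans (∑-cong elems (square x)) (trans (∑-+ elems _ _) (cong₂ _+_
        (∑-length elems)
        (trans (∑-*ˡ elems -1ℤ _) (cong (-1ℤ *_) (∑-δ₁ _≟_ unique (complete x))))))

      -- Transfer matrices: two copies of the automaton read the rows `xs` and `ys` against the same
      -- column, so the correlations for one more letter are linear in those for the remaining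
      -- letters.
      G : State → State → State → State → ∀ {k} → Vec X k → Vec X k → ℤ
      G s s′ e e′ {k} xs ys = ∑[ zs ∈ vecs k ] (W s e xs zs * W s′ e′ ys zs)

      private variable
        e e′ : State
        k : ℕ

      G-ff : ∀ x y (xs ys : Vec X k) → G free free e e′ (x ∷ xs) (y ∷ ys) ≡
        coincide x y * G pending pending e e′ xs ys + Q y x * G pending free e e′ xs ys
          + Q x y * G free pending e e′ xs ys + inner x y * G free free e e′ xs ys
      G-ff {k} {e} {e′} x y xs ys = begin
        G free free e e′ (x ∷ xs) (y ∷ ys)
          ≡⟨ ∑-cartesianProductWith _∷_ elems (vecs k) _ ⟩
        ∑[ z ∈ elems ] ∑[ zs ∈ vecs k ] (W free e (x ∷ xs) (z ∷ zs) * W free e′ (y ∷ ys) (z ∷ zs))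
          ≡⟨ ∑-cong elems (λ z → trans (∑-cong (vecs k) (λ zs → expand ⟦ z ≟ x ⟧ ⟦ z ≟ y ⟧ (Q x z) (Q y z)
               (W pending e xs zs) (W free e xs zs) (W pending e′ ys zs) (W free e′ ys zs)))
               (split z)) ⟩
        ∑[ z ∈ elems ] ((∑ (vecs k) (λ zs → t₁ z zs)) + (∑ (vecs k) (λ zs → t₂ z zs)) +
            (∑ (vecs k) (λ zs → t₃ z zs)) + (∑ (vecs k) (λ zs → t₄ z zs)))
          ≡⟨ trans (∑-+ elems _ _) (cong (_+ ∑ elems (λ z → ∑ (vecs k) (λ zs → t₄ z zs)))
              (trans (∑-+ elems _ _) (cong (_+ ∑ elems (λ z → ∑ (vecs k) (λ zs → t₃ z zs)))
              (∑-+ elems _ _)))) ⟩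
        (∑ elems (λ z → ∑ (vecs k) (λ zs → t₁ z zs))) + (∑ elems (λ z → ∑ (vecs k) (λ zs → t₂ z zs)))
          + (∑ elems (λ z → ∑ (vecs k) (λ zs → t₃ z zs))) + (∑ elems (λ z → ∑ (vecs k) (λ zs → t₄ z zs)))
          ≡⟨ cong₂ _+_ (cong₂ _+_ (cong₂ _+_
               (∑-vecs (λ z → ⟦ z ≟ x ⟧ * ⟦ z ≟ y ⟧) (λ zs → W pending e xs zs * W pending e′ ys zs))
               (trans (∑-vecs (λ z → ⟦ z ≟ x ⟧ * Q y z) (λ zs → W pending e xs zs * W free e′ ys zs))
                   (cong (_* G pending free e e′ xs ys) (∑-δ _≟_ (Q y) unique (complete x)))))
               (trans (∑-vecs (λ z → ⟦ z ≟ y ⟧ * Q x z) (λ zs → W free e xs zs * W pending e′ ys zs))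
                   (cong (_* G free pending e e′ xs ys) (∑-δ _≟_ (Q x) unique (complete y)))))
               (∑-vecs (λ z → Q x z * Q y z) (λ zs → W free e xs zs * W free e′ ys zs)) ⟩
        coincide x y * G pending pending e e′ xs ys + Q y x * G pending free e e′ xs ys
          + Q x y * G free pending e e′ xs ys + inner x y * G free free e e′ xs ys ∎
        where
        open ≡-Reasoning
        t₁ t₂ t₃ t₄ : X → Vec X k → ℤ
        t₁ z zs = ⟦ z ≟ x ⟧ * ⟦ z ≟ y ⟧ * (W pending e xs zs * W pending e′ ys zs)
        t₂ z zs = ⟦ z ≟ x ⟧ * Q y z * (W pending e xs zs * W free e′ ys zs)
        t₃ z zs = ⟦ z ≟ y ⟧ * Q x z * (W free e xs zs * W pending e′ ys zs)
        t₄ z zs = Q x z * Q y z * (W free e xs zs * W free e′ ys zs)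
        expand : ∀ i j p q a b c d → (i * a + p * b) * (j * c + q * d) ≡
          i * j * (a * c) + i * q * (a * d) + j * p * (b * c) + p * q * (b * d)
        expand = solve-∀
        split : ∀ z → ∑ (vecs k) (λ zs → t₁ z zs + t₂ z zs + t₃ z zs + t₄ z zs) ≡
          ∑ (vecs k) (t₁ z) + ∑ (vecs k) (t₂ z) + ∑ (vecs k) (t₃ z) + ∑ (vecs k) (t₄ z)
        split z = trans (∑-+ (vecs k) _ _) (cong (_+ ∑ (vecs k) (t₄ z))
            (trans (∑-+ (vecs k) _ _) (cong (_+ ∑ (vecs k) (t₃ z)) (∑-+ (vecs k) _ _))))

      private
        -- When the other factor reads J, the letter z is summed freely: the rows of I sum to 1 and
        -- those of Q to 0.
        combine : ∀ (x : X) {g h : Vec X k → ℤ} →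
          ∑[ z ∈ elems ] ∑[ zs ∈ vecs k ] (⟦ z ≟ x ⟧ * g zs + Q x z * h zs) ≡ ∑ (vecs k) g
        combine {k} x {g} {h} = trans (∑-cong elems (λ z → ∑-+ (vecs k) _ _)) (trans (∑-+ elems _ _)
          (trans (cong₂ _+_ (trans (∑-vecs (λ z → ⟦ z ≟ x ⟧) g)
              (cong (_* ∑ (vecs k) g) (∑-δ₁ _≟_ unique (complete x))))
                            (trans (∑-vecs (Q x) h) (cong (_* ∑ (vecs k) h) (balanced x))))
                                (simp (∑ (vecs k) g) (∑ (vecs k) h))))
          where
          simp : ∀ a b → 1ℤ * a + 0ℤ * b ≡ a
          simp = solve-∀

      G-fp : ∀ x y (xs ys : Vec X k) → G free pending e e′ (x ∷ xs) (y ∷ ys) ≡ G pending free e e′ xs ys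
      G-fp {k} {e} {e′} x y xs ys = trans (∑-cartesianProductWith _∷_ elems (vecs k) _)
        (trans (∑-cong elems (λ z → ∑-cong (vecs k)
            (λ zs → expand ⟦ z ≟ x ⟧ (Q x z) (W pending e xs zs) (W free e xs zs) (W free e′ ys zs))))
          (combine x {h = λ zs → W free e xs zs * W free e′ ys zs}))
        where
        expand : ∀ i q a b c → (i * a + q * b) * c ≡ i * (a * c) + q * (b * c)
        expand = solve-∀

      G-pf : ∀ x y (xs ys : Vec X k) → G pending free e e′ (x ∷ xs) (y ∷ ys) ≡ G free pending e e′ xs ys
      G-pf {k} {e} {e′} x y xs ys = trans (∑-cartesianProductWith _∷_ elems (vecs k) _)
        (trans (∑-cong elems (λ z → ∑-cong (vecs k)
            (λ zs → expand ⟦ z ≟ y ⟧ (Q y z) (W free e xs zs) (W pending e′ ys zs) (W free e′ ys zs))))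
          (combine y {h = λ zs → W free e xs zs * W free e′ ys zs}))
        where
        expand : ∀ i q a b c → a * (i * b + q * c) ≡ i * (a * b) + q * (a * c)
        expand = solve-∀

      G-pp : ∀ x y (xs ys : Vec X k) → G pending pending e e′ (x ∷ xs)
          (y ∷ ys) ≡ order * G free free e e′ xs ys
      G-pp {k} {e} {e′} x y xs ys = trans (∑-cartesianProductWith _∷_ elems (vecs k) _) (∑-const elems _)

      -- Two copies in opposite states exchange them at every letter, so they never end in the same
      -- state. By the same exchange, `fp-fp` and its companions depend only on the parity of k.
      mixed-fp : ∀ e → (xs ys : Vec X k) → G free pending e e xs ys ≡ 0ℤ
      mixed-pf : ∀ e → (xs ys : Vec X k) → G pending free e e xs ys ≡ 0ℤ
      mixed-fp free    [] [] = refl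
      mixed-fp pending [] [] = refl
      mixed-fp e (x ∷ xs) (y ∷ ys) = trans (G-fp x y xs ys) (mixed-pf e xs ys)
      mixed-pf free    [] [] = refl
      mixed-pf pending [] [] = refl
      mixed-pf e (x ∷ xs) (y ∷ ys) = trans (G-pf x y xs ys) (mixed-fp e xs ys)

      fp-fp : (xs ys : Vec X k) → G free pending free pending xs ys ≡ ev k
      pf-fp : (xs ys : Vec X k) → G pending free free pending xs ys ≡ od k
      fp-fp [] [] = refl
      fp-fp (x ∷ xs) (y ∷ ys) = trans (G-fp x y xs ys) (pf-fp xs ys)
      pf-fp [] [] = refl
      pf-fp (x ∷ xs) (y ∷ ys) = trans (G-pf x y xs ys) (fp-fp xs ys)

      pf-pf : (xs ys : Vec X k) → G pending free pending free xs ys ≡ ev k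
      fp-pf : (xs ys : Vec X k) → G free pending pending free xs ys ≡ od k
      pf-pf [] [] = refl
      pf-pf (x ∷ xs) (y ∷ ys) = trans (G-pf x y xs ys) (fp-pf xs ys)
      fp-pf [] [] = refl
      fp-pf (x ∷ xs) (y ∷ ys) = trans (G-fp x y xs ys) (pf-pf xs ys)

      G-ff-≡ : ∀ x (xs ys : Vec X k) → G free free e e′ (x ∷ xs) (x ∷ ys) ≡
        G pending pending e e′ xs ys + (order - 1ℤ) * G free free e e′ xs ys
      G-ff-≡ {k} {e} {e′} x xs ys = trans (G-ff x x xs ys)
          (simp {a = G pending pending e e′ xs ys} {G pending free e e′ xs ys} {G free pending e e′ xs ys}
          {G free free e e′ xs ys} (coincide-≡ x) (diagonal x) (inner-≡ x))
        where
        ring₁ : ∀ a b c d m → 1ℤ * a + 0ℤ * b + 0ℤ * c + m * d ≡ a + m * d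
        ring₁ = solve-∀
        simp : ∀ {i q m m′ a b c d} → i ≡ 1ℤ → q ≡ 0ℤ → m ≡ m′ → i * a + q * b + q * c + m * d ≡ a + m′ * d
        simp {m = m} {a = a} {b} {c} {d} refl refl refl = ring₁ a b c d m

      G-ff-≢ : ∀ {x y} → x ≢ y → (xs ys : Vec X k) →
          G free free e e xs ys ≡ G free free e e (x ∷ xs) (y ∷ ys) * -1ℤ
      G-ff-≢ {k} {e} {x} {y} x≢y xs ys = sym (trans (cong (_* -1ℤ) (G-ff x y xs ys))
        (simp {q = Q y x} {Q x y} {a = G pending pending e e xs ys} {d = G free free e e xs ys}
            (coincide-≢ x≢y) (mixed-pf e xs ys) (mixed-fp e xs ys) (orthogonal x≢y)))
        where
        ring₁ : ∀ a q q′ d → (0ℤ * a + q * 0ℤ + q′ * 0ℤ + -1ℤ * d) * -1ℤ ≡ d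
        ring₁ = solve-∀
        simp : ∀ {i q q′ m a b c d} → i ≡ 0ℤ → b ≡ 0ℤ → c ≡ 0ℤ → m ≡ -1ℤ →
            (i * a + q * b + q′ * c + m * d) * -1ℤ ≡ d
        simp {q = q} {q′} {a = a} {d = d} refl refl refl refl = ring₁ a q q′ d

      -- On the span of the states (free, free) and (pending, pending), the
      -- transfer matrices have the common eigenvector (1, - order) ...
      eigen-ff : (xs ys : Vec X k) → G free free free free xs ys - order * G free free pending pending xs
          ys ≡ sg k
      eigen-pp : (xs ys : Vec X k) → G pending pending free free xs ys - order * G pending pending pending
          pending xs ys ≡ - order * sg k
      eigen-ff [] [] = lem order
        where
        lem : ∀ n → 1ℤ - n * 0ℤ ≡ 1ℤ
        lem = solve-∀
      eigen-ff {suc k} (x ∷ xs) (y ∷ ys) with x ≟ y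
      ... | yes refl = trans (cong₂ (λ a b → a - order * b) (G-ff-≡ x xs ys) (G-ff-≡ x xs ys))
          (trans (lem order (G pending pending free free xs ys) (G free free free free xs ys)
              (G pending pending pending pending xs ys) (G free free pending pending xs ys))
          (trans (cong₂ (λ a b → a + (order - 1ℤ) * b) (eigen-pp xs ys) (eigen-ff xs ys))
              (lem′ order (sg k))))
        where
        lem : ∀ n a b c d → a + (n - 1ℤ) * b - n * (c + (n - 1ℤ) * d) ≡ (a - n * c) + (n - 1ℤ) * (b - n * d)
        lem = solve-∀
        lem′ : ∀ n s → - n * s + (n - 1ℤ) * s ≡ - s
        lem′ = solve-∀
      ... | no x≢y = trans (lem order (G free free free free (x ∷ xs) (y ∷ ys))
          (G free free pending pending (x ∷ xs) (y ∷ ys)))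
          (cong -_ (trans (cong₂ (λ a b → a - order * b) (sym (G-ff-≢ x≢y xs ys))
          (sym (G-ff-≢ x≢y xs ys))) (eigen-ff xs ys)))
        where
        lem : ∀ n a b → a - n * b ≡ - (a * -1ℤ - n * (b * -1ℤ))
        lem = solve-∀
      eigen-pp [] [] = lem order
        where
        lem : ∀ n → 0ℤ - n * 1ℤ ≡ - n * 1ℤ
        lem = solve-∀
      eigen-pp {suc k} (x ∷ xs) (y ∷ ys) = trans (cong₂ (λ a b → a - order * b) (G-pp x y xs ys)
          (G-pp x y xs ys))
        (trans (lem order _ _) (trans (cong (order *_) (eigen-ff xs ys)) (lem′ order (sg k))))
        where
        lem : ∀ n a b → n * a - n * (n * b) ≡ n * (a - n * b)
        lem = solve-∀
        lem′ : ∀ n s → n * s ≡ - n * - s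
        lem′ = solve-∀

      -- ... and on the quotient by it they act as the scalars order and 0,
      -- according as the two letters read agree or not.
      quotient : ∀ e → {xs ys : Vec X k} → xs ≢ ys →
          order * G free free e e xs ys + G pending pending e e xs ys ≡ 0ℤ
      quotient e {[]} {[]} ne = ⊥-elim (ne refl)
      quotient e {x ∷ xs} {y ∷ ys} ne with x ≟ y
      ... | yes refl = trans (cong₂ (λ a b → order * a + b) (G-ff-≡ x xs ys) (G-pp x x xs ys))
          (trans (lem order (G free free e e xs ys) (G pending pending e e xs ys))
              (trans (cong (order *_) (quotient e {xs} {ys} (λ { refl → ne refl }))) (ℤ.*-zeroʳ order)))
        where
        lem : ∀ n a b → n * (b + (n - 1ℤ) * a) + n * a ≡ n * (n * a + b)
        lem = solve-∀
      ... | no x≢y = trans (cong (_+_ (order * G free free e e (x ∷ xs) (y ∷ ys)))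
          (trans (G-pp x y xs ys) (cong (order *_) (G-ff-≢ x≢y xs ys))))
          (lem order (G free free e e (x ∷ xs) (y ∷ ys)))
        where
        lem : ∀ n a → n * a + n * (a * -1ℤ) ≡ 0ℤ
        lem = solve-∀

      -- Let a, b and c be the correlations free to free, free to pending and pending to pending,
      -- both copies being in the named state. The mixed terms contribute 2 for even k and 0 for odd
      -- k. The rest is a + c = (a - n b) + (n b + c), where `eigen-ff` and `quotient` give (-1)ᵏ
      -- and 0; b itself need not be known.
      power-orthogonal : {xs ys : Vec X k} → xs ≢ ys → ∑[ zs ∈ vecs k ] (power xs zs * power ys zs) ≡ -1ℤ
      power-orthogonal {k} {xs} {ys} ne = trans (∑-cong (vecs k)
          (λ zs → expand (sg k) (W free free xs zs) (W pending pending xs zs) (W free free ys zs)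
          (W pending pending ys zs)))
        (trans (∑-+ (vecs k) (λ zs → t₁ zs + - sg k * (t₂ zs + t₃ zs)) (λ zs → sg k * sg k * t₄ zs))
        (trans (cong₂ _+_ (trans (∑-+ (vecs k) t₁ (λ zs → - sg k * (t₂ zs + t₃ zs)))
            (cong (_+_ (∑ (vecs k) t₁)) (∑-*ˡ (vecs k) (- sg k) (λ zs → t₂ zs + t₃ zs))))
                          (∑-*ˡ (vecs k) (sg k * sg k) t₄))
        (trans (cong (λ m → G free free free free xs ys + - sg k * m + sg k * sg k * G pending pending
            pending pending xs ys)
                  (trans (∑-+ (vecs k) t₂ t₃) (cong₂ _+_ (fp-fp xs ys) (pf-pf xs ys))))
          (finish {a = G free free free free xs ys} {G free free pending pending xs ys} {n = order}
              (eigen-ff xs ys) (quotient pending {xs} {ys} ne) (parity k)))))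
        where
        t₁ t₂ t₃ t₄ : Vec X k → ℤ
        t₁ zs = W free free xs zs * W free free ys zs
        t₂ zs = W free free xs zs * W pending pending ys zs
        t₃ zs = W pending pending xs zs * W free free ys zs
        t₄ zs = W pending pending xs zs * W pending pending ys zs
        expand : ∀ s a b c d → (a + - s * b) * (c + - s * d) ≡ a * c + - s * (a * d + b * c) + s * s *
            (b * d)
        expand = solve-∀
        finish : ∀ {s v o a b c n} → a - n * b ≡ s → n * b + c ≡ 0ℤ →
          (s ≡ 1ℤ × v ≡ 1ℤ × o ≡ 0ℤ) ⊎ (s ≡ -1ℤ × v ≡ 0ℤ × o ≡ 1ℤ) →
          a + - s * (v + v) + s * s * c ≡ -1ℤ
        finish {s} {v} {o} {a} {b} {c} {n} h₁ h₂ (inj₁ (refl , refl , refl)) =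
          trans (lem a b c n) (cong₂ (λ x y → x + y - + 2) h₁ h₂)
          where
          lem : ∀ a b c n → a + - 1ℤ * (1ℤ + 1ℤ) + 1ℤ * 1ℤ * c ≡ (a - n * b) + (n * b + c) - + 2
          lem = solve-∀
        finish {s} {v} {o} {a} {b} {c} {n} h₁ h₂ (inj₂ (refl , refl , refl)) =
          trans (lem a b c n) (cong₂ _+_ h₁ h₂)
          where
          lem : ∀ a b c n → a + - -1ℤ * (0ℤ + 0ℤ) + -1ℤ * -1ℤ * c ≡ (a - n * b) + (n * b + c)
          lem = solve-∀

      R : State → State → Vec X k → ℤ
      R {k} s e xs = ∑[ zs ∈ vecs k ] W s e xs zs

      R-f : ∀ e x (xs : Vec X k) → R free e (x ∷ xs) ≡ R pending e xs
      R-f {k} e x xs = trans (∑-cartesianProductWith _∷_ elems (vecs k) _)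
          (combine x {h = λ zs → W free e xs zs})

      R-p : ∀ e x (xs : Vec X k) → R pending e (x ∷ xs) ≡ order * R free e xs
      R-p {k} e x xs = trans (∑-cartesianProductWith _∷_ elems (vecs k) _) (∑-const elems _)

      -- Two letters multiply both row sums by `order` and preserve the sign, so lengths 0 and 1
      -- suffice.
      R-balanced : (xs : Vec X k) → R free free xs + - sg k * R pending pending xs ≡ 0ℤ
      R-balanced [] = refl
      R-balanced (x ∷ []) = cong₂ (λ a b → a + - - 1ℤ * b) (R-f free x [])
          (trans (R-p pending x []) (ℤ.*-zeroʳ order))
      R-balanced {suc (suc k)} (x ∷ y ∷ xs) = trans
          (cong₂ (λ a b → a + - - - sg k * b) (trans (R-f free x (y ∷ xs)) (R-p free y xs))
          (trans (R-p pending x (y ∷ xs)) (cong (order *_) (R-f pending y xs))))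
        (trans (lem order (sg k) _ _) (trans (cong (order *_) (R-balanced xs)) (ℤ.*-zeroʳ order)))
        where
        lem : ∀ n s a b → n * a + - - - s * (n * b) ≡ n * (a + - s * b)
        lem = solve-∀

      power-balanced : (xs : Vec X k) → ∑[ zs ∈ vecs k ] power xs zs ≡ 0ℤ
      power-balanced {k} xs = trans (∑-+ (vecs k) _ _)
          (trans (cong (_+_ (R free free xs)) (∑-*ˡ (vecs k) (- sg k) _)) (R-balanced xs))

    open Correlation using (power-orthogonal; power-balanced)

    private variable
      k : ℕ

    W-≡ : ∀ e x (xs zs : Vec X k) → W free e (x ∷ xs) (x ∷ zs) ≡ W pending e xs zs
    W-≡ e x xs zs = trans (cong₂ (λ a b → a * W pending e xs zs + b * W free e xs zs)
        (⟦⟧-true (x ≟ x) refl) (diagonal x))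
      (trans (ℤ.+-identityʳ _) (ℤ.*-identityˡ _))

    W-≢ : ∀ e {x z} (xs zs : Vec X k) → z ≢ x → W free e (x ∷ xs) (z ∷ zs) ≡ Q x z * W free e xs zs
    W-≢ e {x} {z} xs zs z≢x = trans (cong (λ a → a * W pending e xs zs + Q x z * W free e xs zs)
        (⟦⟧-false (z ≟ x) z≢x)) (ℤ.+-identityˡ _)

    -- On given words the automaton is deterministic: equal letters allow only I, as Q has zero
    -- diagonal, and distinct letters allow only Q. Thus one end state has weight ±1 and the other
    -- has weight 0.
    Ends : State → State → Vec X k → Vec X k → Set
    Ends s e xs zs = ±1 (W s e xs zs) × W s (flip-state e) xs zs ≡ 0ℤ

    ends-≡ : ∀ {e} x {xs zs : Vec X k} → Ends pending e xs zs → Ends free e (x ∷ xs) (x ∷ zs)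
    ends-≡ x {xs} {zs} (u , v) = subst ±1 (sym (W-≡ _ x xs zs)) u , trans (W-≡ _ x xs zs) v

    ends-≢ : ∀ {e x z} {xs zs : Vec X k} → z ≢ x → Ends free e xs zs → Ends free e (x ∷ xs) (z ∷ zs)
    ends-≢ {x = x} {z} {xs} {zs} z≢x (u , v) =
      subst ±1 (sym (W-≢ _ xs zs z≢x)) (±1-* (unit (z≢x ∘ sym)) u) ,
      trans (W-≢ _ xs zs z≢x) (trans (cong (Q x z *_) v) (ℤ.*-zeroʳ (Q x z)))

    ends : ∀ s (xs zs : Vec X k) → ∃[ e ] Ends s e xs zs
    ends free    []       []       = free , inj₁ refl , refl
    ends pending []       []       = pending , inj₁ refl , refl
    ends free    (x ∷ xs) (z ∷ zs) = step (z ≟ x)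
      where
      step : Dec (z ≡ x) → ∃[ e ] Ends free e (x ∷ xs) (z ∷ zs)
      step (yes refl) = let e , h = ends pending xs zs in e , ends-≡ x {xs} {zs} h
      step (no z≢x)   = let e , h = ends free xs zs in e , ends-≢ {xs = xs} {zs} z≢x h
    ends pending (x ∷ xs) (z ∷ zs) = ends free xs zs

    -- Reading a pair of distinct letters frees both states.
    merge : ∀ {xs zs : Vec X k} → xs ≢ zs → ∃[ e ] (Ends free e xs zs × Ends pending e xs zs)
    merge {xs = []} {[]} ne = ⊥-elim (ne refl)
    merge {xs = x ∷ xs} {z ∷ zs} ne = step (z ≟ x)
      where
      step : Dec (z ≡ x) → ∃[ e ] (Ends free e (x ∷ xs) (z ∷ zs) × Ends pending e (x ∷ xs) (z ∷ zs))
      step (yes refl) = let e , h , h′ = merge {xs = xs} {zs} (λ { refl → ne refl }) in e , ends-≡ x {xs} {zs} h′ , h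
      step (no z≢x)   = let e , h = ends free xs zs in e , ends-≢ {xs = xs} {zs} z≢x h , h

    sg-unit : ∀ k → ±1 (- sg k)
    sg-unit k with parity k
    ... | inj₁ (e , _) = inj₂ (cong -_ e)
    ... | inj₂ (e , _) = inj₁ (cong -_ e)

    power-unit : ∀ {xs zs : Vec X k} → xs ≢ zs → ±1 (power xs zs)
    power-unit {k} {xs} {zs} ne with merge ne
    ... | free , (u , _) , (_ , v) = subst ±1 (sym
        (trans (cong (λ a → W free free xs zs + - sg k * a) v) (lem _ (sg k)))) u
      where
      lem : ∀ a s → a + - s * 0ℤ ≡ a
      lem = solve-∀
    ... | pending , (_ , v) , (u , _) = subst ±1 (sym
        (trans (cong (_+ - sg k * W pending pending xs zs) v) (ℤ.+-identityˡ _))) (±1-* (sg-unit k) u)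

    diag-f : ∀ (xs : Vec X k) → W free free xs xs ≡ ev k × W free pending xs xs ≡ od k
    diag-p : ∀ (xs : Vec X k) → W pending pending xs xs ≡ ev k × W pending free xs xs ≡ od k
    diag-f [] = refl , refl
    diag-f (x ∷ xs) = trans (W-≡ free x xs xs) (proj₂ (diag-p xs)) , trans (W-≡ pending x xs xs)
        (proj₁ (diag-p xs))
    diag-p [] = refl , refl
    diag-p (x ∷ xs) = proj₂ (diag-f xs) , proj₁ (diag-f xs)

    power-diagonal : ∀ (xs : Vec X k) → power xs xs ≡ 0ℤ
    power-diagonal {k} xs = trans (cong₂ (λ a b → a + - sg k * b) (proj₁ (diag-f xs)) (proj₁ (diag-p xs)))
        (lem (parity k))
      where
      lem : (sg k ≡ 1ℤ × ev k ≡ 1ℤ × od k ≡ 0ℤ) ⊎ (sg k ≡ -1ℤ × ev k ≡ 0ℤ × od k ≡ 1ℤ) →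
          ev k + - sg k * ev k ≡ 0ℤ
      lem (inj₁ (a , b , _)) rewrite a | b = refl
      lem (inj₂ (a , b , _)) rewrite a | b = refl

    ρ : ℕ → ℤ
    ρ zero    = 1ℤ
    ρ (suc k) = ε * ρ k

    ρ-unit : ∀ k → ±1 (ρ k)
    ρ-unit zero    = inj₁ refl
    ρ-unit (suc k) = ±1-* ε-unit (ρ-unit k)

    private
      reverse-step : ∀ {a b a′ b′ q q′} i r r′ → q′ ≡ ε * q → a′ ≡ r * a → b′ ≡ r′ * b → r ≡ ε * r′ →
          i * a′ + q′ * b′ ≡ r * (i * a + q * b)
      reverse-step {a} {b} {q = q} i r r′ refl refl refl refl = lem ε r′ i a b q
        where
        lem : ∀ e r i a b q → i * (e * r * a) + e * q * (r * b) ≡ e * r * (i * a + q * b)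
        lem = solve-∀

      ε² : ∀ r → r ≡ ε * (ε * r)
      ε² r = sym (trans (sym (ℤ.*-assoc ε ε r)) (trans (cong (_* r) (±1-square ε-unit)) (ℤ.*-identityˡ r)))

      ≟-flip : ∀ x z → ⟦ x ≟ z ⟧ ≡ ⟦ z ≟ x ⟧
      ≟-flip x z = ⟦⟧-⇔ (x ≟ z) (z ≟ x) sym sym

    -- Transposition costs one `ε` per factor Q. A tile I ⊗ J takes two letters, so a run ending
    -- where it started has as many factors Q as letters modulo 2, and any other run has the
    -- opposite parity.
    reverse-f : ∀ (xs zs : Vec X k) → W free free zs xs ≡ ρ k * W free free xs zs × W free pending zs xs ≡
        ε * ρ k * W free pending xs zs
    reverse-p : ∀ (xs zs : Vec X k) → W pending pending zs xs ≡ ρ k * W pending pending xs zs × W pending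
        free zs xs ≡ ε * ρ k * W pending free xs zs
    reverse-f [] [] = refl , sym (ℤ.*-zeroʳ (ε * 1ℤ))
    reverse-f {suc k} (x ∷ xs) (z ∷ zs) =
      trans (cong (λ i → i * W pending free zs xs + Q z x * W free free zs xs) (≟-flip x z))
        (reverse-step ⟦ z ≟ x ⟧ (ε * ρ k) (ρ k) (reverse x z) (proj₂ (reverse-p xs zs))
            (proj₁ (reverse-f xs zs)) refl) ,
      trans (cong (λ i → i * W pending pending zs xs + Q z x * W free pending zs xs) (≟-flip x z))
        (trans (reverse-step ⟦ z ≟ x ⟧ (ρ k) (ε * ρ k) (reverse x z) (proj₁ (reverse-p xs zs))
            (proj₂ (reverse-f xs zs)) (ε² (ρ k)))
          (cong (_* W free pending (x ∷ xs) (z ∷ zs)) (ε² (ρ k))))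
    reverse-p [] [] = refl , sym (ℤ.*-zeroʳ (ε * 1ℤ))
    reverse-p {suc k} (x ∷ xs) (z ∷ zs) =
      proj₂ (reverse-f xs zs) , trans (proj₁ (reverse-f xs zs)) (cong (_* W free free xs zs) (ε² (ρ k)))

    power-reverse : ∀ (xs ys : Vec X k) → power ys xs ≡ ρ k * power xs ys
    power-reverse {k} xs ys = trans (cong₂ (λ a b → a + - sg k * b) (proj₁ (reverse-f xs ys))
        (proj₁ (reverse-p xs ys))) (lem (ρ k) (sg k) _ _)
      where
      lem : ∀ r s a b → r * a + - s * (r * b) ≡ r * (a + - s * b)
      lem = solve-∀

    turyn : ∀ k → Conference (Vec X k)
    turyn k = record
      { _≟_        = Vec.≡-dec _≟_
      ; elems      = vecs k
      ; unique     = vecs-unique k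
      ; complete   = vecs-complete
      ; Q          = power
      ; diagonal   = power-diagonal
      ; unit       = power-unit
      ; balanced   = power-balanced
      ; orthogonal = power-orthogonal
      ; ε          = ρ k
      ; ε-unit     = ρ-unit k
      ; reverse    = power-reverse
      }

  -- Counting sign patterns in a conference matrix.

  Discord : ℤ → ℤ → ℤ → Set
  Discord γ sa sb = sa ≡ - γ × sb ≡ γ

  -- With γ the list color of the earlier of two small-side vertices, a discord is the pattern that
  -- an orderable copy forbids. The indicator, scaled by 4, is a polynomial of degree one in each
  -- sign and so can be summed by `balanced` and `orthogonal`.
  discord-values : ∀ {γ a b} → ±1 γ → ±1 a → ±1 b →
    (Discord γ a b × (1ℤ - γ * a) * (1ℤ + γ * b) ≡ + 4) ⊎
        (¬ Discord γ a b × (1ℤ - γ * a) * (1ℤ + γ * b) ≡ 0ℤ)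
  discord-values (inj₁ refl) (inj₁ refl) (inj₁ refl) = inj₂ ((λ ()) , refl)
  discord-values (inj₁ refl) (inj₁ refl) (inj₂ refl) = inj₂ ((λ ()) , refl)
  discord-values (inj₁ refl) (inj₂ refl) (inj₁ refl) = inj₁ ((refl , refl) , refl)
  discord-values (inj₁ refl) (inj₂ refl) (inj₂ refl) = inj₂ ((λ ()) , refl)
  discord-values (inj₂ refl) (inj₁ refl) (inj₁ refl) = inj₂ ((λ ()) , refl)
  discord-values (inj₂ refl) (inj₁ refl) (inj₂ refl) = inj₁ ((refl , refl) , refl)
  discord-values (inj₂ refl) (inj₂ refl) (inj₁ refl) = inj₂ ((λ ()) , refl)
  discord-values (inj₂ refl) (inj₂ refl) (inj₂ refl) = inj₂ ((λ ()) , refl)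

  4∤±2 : ∀ {q} → ±1 q → ¬ + 4 ∣ + 2 * q
  4∤±2 (inj₁ refl) h = ℕ.>⇒∤ (ℕ.s≤s (ℕ.s≤s (ℕ.s≤s ℕ.z≤n))) (∣⇒∣ᵤ h)
  4∤±2 (inj₂ refl) h = ℕ.>⇒∤ (ℕ.s≤s (ℕ.s≤s (ℕ.s≤s ℕ.z≤n))) (∣⇒∣ᵤ h)

  module Counting {Y : Set} (C : Conference Y) where
    open Conference C

    injection-bound : ∀ {t} (ψ : Fin t → Y) → Injective _≡_ _≡_ ψ → (w : Y → ℤ) → (∀ x → 0ℤ ≤ w x) →
      (∀ i → + 4 ≤ w (ψ i)) → + t * + 4 ≤ ∑ elems w
    injection-bound {t} ψ inj w w≥0 w≥4 = begin
      + t * + 4                  ≡⟨ cong (λ n → + n * + 4) (sym (length-tabulate {n = t} id)) ⟩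
      + length (allFin t) * + 4  ≡⟨ sym (∑-const (allFin t) (+ 4)) ⟩
      ∑ (allFin t) (λ _ → + 4)   ≤⟨ ∑-mono (allFin t) (λ {i} _ → w≥4 i) ⟩
      ∑ (allFin t) (w ∘ ψ)       ≡⟨ sym (∑-map ψ (allFin t) w) ⟩
      ∑ (map ψ (allFin t)) w     ≤⟨ ∑-⊆ _≟_ (map⁺ inj (allFin⁺ t)) unique (λ {x} _ → complete x) w≥0 ⟩
      ∑ elems w                  ∎
      where open ℤ.≤-Reasoning

    ∑-discord : ∀ {x y} α β → x ≢ y → α * β ≡ 1ℤ →
        ∑[ z ∈ elems ] ((1ℤ - α * Q x z) * (1ℤ + β * Q y z)) ≡ order + 1ℤ
    ∑-discord {x} {y} α β x≢y αβ = trans (∑-cong elems (λ z → expand α β (Q x z) (Q y z)))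
      (trans (∑-+ elems _ _) (trans (cong₂ _+_ (trans (∑-+ elems _ _) (cong₂ _+_ (trans (∑-+ elems _ _)
          (cong₂ _+_ (∑-length elems) (trans (∑-*ˡ elems (- α) (Q x)) (cong (- α *_) (balanced x)))))
          (trans (∑-*ˡ elems β (Q y)) (cong (β *_) (balanced y)))))
          (trans (∑-*ˡ elems (- (α * β)) _) (cong₂ _*_ (cong -_ αβ) (orthogonal x≢y))))
              (collect order α β)))
      where
      expand : ∀ α β a b → (1ℤ - α * a) * (1ℤ + β * b) ≡ 1ℤ + - α * a + β * b + - (α * β) * (a * b)
      expand = solve-∀
      collect : ∀ n α β → n + - α * 0ℤ + β * 0ℤ + - 1ℤ * -1ℤ ≡ n + 1ℤ
      collect = solve-∀

    ∑-mark : ∀ x c → ∑[ z ∈ elems ] (⟦ z ≟ x ⟧ * c) ≡ c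
    ∑-mark x c = ∑-δ _≟_ (λ _ → c) unique (complete x)

    -- Off x and y the summands of ∑-discord are multiples of 4; the values at x
    -- and y then force Q x y − Q y x to be one as well.
    symmetric : ∀ m → order ≡ + 4 * m + 1ℤ → ∀ x y → Q y x ≡ Q x y
    symmetric m order≡ x y with x ≟ y
    ... | yes refl = refl
    ... | no x≢y with ε-unit
    ...   | inj₁ ε≡1 = trans (reverse x y) (trans (cong (_* Q x y) ε≡1) (ℤ.*-identityˡ _))
    ...   | inj₂ ε≡-1 = ⊥-elim (4∤±2 (unit x≢y) 4∣2q)
      where
      Qyx : Q y x ≡ - Q x y
      Qyx = trans (reverse x y) (trans (cong (_* Q x y) ε≡-1) (ℤ.-1*i≡-i _))
      q = Q x y
      f : Y → ℤ
      f z = (1ℤ - 1ℤ * Q x z) * (1ℤ + 1ℤ * Q y z) + - (⟦ z ≟ x ⟧ * (1ℤ - q)) + - (⟦ z ≟ y ⟧ * (1ℤ - q))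
      4∣unit : ∀ {a b} → ±1 a → ±1 b → + 4 ∣ (1ℤ - 1ℤ * a) * (1ℤ + 1ℤ * b) + - (0ℤ * (1ℤ - q)) + -
          (0ℤ * (1ℤ - q))
      4∣unit {a} {b} u v = subst (+ 4 ∣_) (sym (drop q _)) (cases u v)
        where
        drop : ∀ q s → s + - (0ℤ * (1ℤ - q)) + - (0ℤ * (1ℤ - q)) ≡ s
        drop = solve-∀
        cases : ∀ {a b} → ±1 a → ±1 b → + 4 ∣ (1ℤ - 1ℤ * a) * (1ℤ + 1ℤ * b)
        cases (inj₁ refl) (inj₁ refl) = divides 0ℤ refl
        cases (inj₁ refl) (inj₂ refl) = divides 0ℤ refl
        cases (inj₂ refl) (inj₁ refl) = divides 1ℤ refl
        cases (inj₂ refl) (inj₂ refl) = divides 0ℤ refl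
      4∣f : ∀ z → + 4 ∣ f z
      4∣f z with z ≟ x | z ≟ y
      ... | yes refl | yes refl = ⊥-elim (x≢y refl)
      ... | yes refl | no _ = divides 0ℤ (trans (cong₂
          (λ a b → (1ℤ - 1ℤ * a) * (1ℤ + 1ℤ * b) + - (1ℤ * (1ℤ - q)) + - (0ℤ * (1ℤ - q)))
          (diagonal x) Qyx) (lem q))
        where
        lem : ∀ q → (1ℤ - 1ℤ * 0ℤ) * (1ℤ + 1ℤ * - q) + - (1ℤ * (1ℤ - q)) + - (0ℤ * (1ℤ - q)) ≡ 0ℤ
        lem = solve-∀
      ... | no _ | yes refl = divides 0ℤ (trans (cong
          (λ b → (1ℤ - 1ℤ * q) * (1ℤ + 1ℤ * b) + - (0ℤ * (1ℤ - q)) + - (1ℤ * (1ℤ - q))) (diagonal y))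
          (lem q))
        where
        lem : ∀ q → (1ℤ - 1ℤ * q) * (1ℤ + 1ℤ * 0ℤ) + - (0ℤ * (1ℤ - q)) + - (1ℤ * (1ℤ - q)) ≡ 0ℤ
        lem = solve-∀
      ... | no z≢x | no z≢y = 4∣unit (unit (z≢x ∘ sym)) (unit (z≢y ∘ sym))
      neg-mark : ∀ x → ∑[ z ∈ elems ] (- (⟦ z ≟ x ⟧ * (1ℤ - q))) ≡ - (1ℤ - q)
      neg-mark x = trans (∑-cong elems (λ z → ℤ.neg-distribʳ-* ⟦ z ≟ x ⟧ (1ℤ - q))) (∑-mark x (- (1ℤ - q)))
      total : ∑ elems f ≡ m * + 4 + + 2 * q
      total = trans (∑-+ elems _ _) (trans (cong₂ _+_
          (trans (∑-+ elems _ _) (cong₂ _+_ (trans (∑-discord 1ℤ 1ℤ x≢y refl) (cong (_+ 1ℤ) order≡))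
          (neg-mark x))) (neg-mark y)) (lem m q))
        where
        lem : ∀ m q → + 4 * m + 1ℤ + 1ℤ + - (1ℤ - q) + - (1ℤ - q) ≡ m * + 4 + + 2 * q
        lem = solve-∀
      4∣2q : + 4 ∣ + 2 * q
      4∣2q = subst (+ 4 ∣_) (trans (cong (_+ - m * + 4) total) (lem m q))
          (∣m∣n⇒∣m+n (∑-∣ elems 4∣f) (divides (- m) refl))
        where
        lem : ∀ m q → m * + 4 + + 2 * q + - m * + 4 ≡ + 2 * q
        lem = solve-∀

    module _ (symm : ∀ x y → Q y x ≡ Q x y) where

      -- Discords of a and b number about a quarter of the order, which leaves about three quarters
      -- for the large side.
      pair-bound : ∀ {t} (ψ : Fin t → Y) → Injective _≡_ _≡_ ψ → ∀ {a b γ} → a ≢ b → ±1 γ →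
        (∀ i → ψ i ≢ a × ψ i ≢ b × ¬ Discord γ (Q a (ψ i)) (Q b (ψ i))) →
        + t * + 4 ≤ + 3 * order - + 7
      pair-bound {t} ψ inj {a} {b} {γ} a≢b γ± good =
          subst (+ t * + 4 ≤_) total (injection-bound ψ inj w w≥0 w≥4)
        where
        q = Q a b
        p = λ x → (1ℤ - γ * Q a x) * (1ℤ + γ * Q b x)
        w : Y → ℤ
        -- The product is 1 + γq at a and 1 - γq at b; the corrections make the weight 0 at both.
        -- The total is 4n - (n + 1) - 6.
        w x = + 4 + -1ℤ * p x + ⟦ x ≟ a ⟧ * (γ * q - + 3) + ⟦ x ≟ b ⟧ * (- (γ * q) - + 3)
        total : ∑ elems w ≡ + 3 * order - + 7
        total = trans (∑-+ elems _ _) (trans (cong₂ _+_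
            (trans (∑-+ elems _ _) (cong₂ _+_ (trans (∑-+ elems _ _) (cong₂ _+_ (∑-const elems (+ 4))
            (trans (∑-*ˡ elems -1ℤ p) (cong (-1ℤ *_) (∑-discord γ γ a≢b (±1-square γ±)))))) (∑-mark a _)))
                (∑-mark b _)) (lem order (γ * q)))
          where
          lem : ∀ n s → n * + 4 + -1ℤ * (n + 1ℤ) + (s - + 3) + (- s - + 3) ≡ + 3 * n - + 7
          lem = solve-∀
        generic : ∀ s → + 4 + -1ℤ * s + 0ℤ * (γ * q - + 3) + 0ℤ * (- (γ * q) - + 3) ≡ + 4 - s
        generic s = lem s (γ * q)
          where
          lem : ∀ s r → + 4 + -1ℤ * s + 0ℤ * (r - + 3) + 0ℤ * (- r - + 3) ≡ + 4 - s
          lem = solve-∀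
        w≥0 : ∀ x → 0ℤ ≤ w x
        w≥0 x with x ≟ a | x ≟ b
        ... | yes refl | yes refl = ⊥-elim (a≢b refl)
        ... | yes refl | no _ = ℤ.≤-reflexive (sym
            (trans (cong₂ (λ s r → + 4 + -1ℤ * ((1ℤ - γ * s) * (1ℤ + γ * r)) + 1ℤ * (γ * q - + 3) + 0ℤ *
            (- (γ * q) - + 3)) (diagonal x) (symm a b)) (lem γ q)))
          where
          lem : ∀ γ q → + 4 + -1ℤ * ((1ℤ - γ * 0ℤ) * (1ℤ + γ * q)) + 1ℤ * (γ * q - + 3) + 0ℤ *
              (- (γ * q) - + 3) ≡ 0ℤ
          lem = solve-∀
        ... | no _ | yes refl = ℤ.≤-reflexive (sym
            (trans (cong (λ s → + 4 + -1ℤ * ((1ℤ - γ * q) * (1ℤ + γ * s)) + 0ℤ * (γ * q - + 3) + 1ℤ *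
            (- (γ * q) - + 3)) (diagonal x)) (lem γ q)))
          where
          lem : ∀ γ q → + 4 + -1ℤ * ((1ℤ - γ * q) * (1ℤ + γ * 0ℤ)) + 0ℤ * (γ * q - + 3) + 1ℤ *
              (- (γ * q) - + 3) ≡ 0ℤ
          lem = solve-∀
        ... | no x≢a | no x≢b with discord-values γ± (unit (x≢a ∘ sym)) (unit (x≢b ∘ sym))
        ...   | inj₁ (_ , e) = subst (0ℤ ≤_) (sym (trans (generic (p x)) (cong (λ s → + 4 - s) e)))
            (+≤+ ℕ.z≤n)
        ...   | inj₂ (_ , e) = subst (0ℤ ≤_) (sym (trans (generic (p x)) (cong (λ s → + 4 - s) e)))
            (+≤+ ℕ.z≤n)
        w≥4 : ∀ i → + 4 ≤ w (ψ i)
        w≥4 i with good i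
        ... | x≢a , x≢b , ¬bad with ψ i ≟ a | ψ i ≟ b
        ... | yes h | _     = ⊥-elim (x≢a h)
        ... | no _  | yes h = ⊥-elim (x≢b h)
        ... | no _  | no _ with discord-values γ± (unit (x≢a ∘ sym)) (unit (x≢b ∘ sym))
        ...   | inj₁ (bad , _) = ⊥-elim (¬bad bad)
        ...   | inj₂ (_ , e) = subst (+ 4 ≤_) (sym (trans (generic (p (ψ i))) (cong (λ s → + 4 - s) e)))
            ℤ.≤-refl

      -- The two discords ask for opposite signs at b, so they exclude each other and 4 - p - p′ is
      -- still 0 or 4 off a, b and c. Each takes about a quarter of the order.
      triple-bound : ∀ {t} (ψ : Fin t → Y) → Injective _≡_ _≡_ ψ → ∀ {a b c α} → a ≢ b → b ≢ c → a ≢ c →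
          ±1 α →
        (∀ i → ψ i ≢ a × ψ i ≢ b × ψ i ≢ c × ¬ Discord α (Q a (ψ i)) (Q b (ψ i)) × ¬ Discord α (Q b (ψ i))
            (Q c (ψ i))) →
        + t * + 4 ≤ + 2 * order - + 6
      triple-bound {t} ψ inj {a} {b} {c} {α} a≢b b≢c a≢c α± good =
        ℤ.≤-trans (injection-bound ψ inj w w≥0 w≥4)
            (subst (_≤ + 2 * order - + 6) (sym total) (bound α± (unit a≢b) (unit b≢c) (unit a≢c)))
        where
        u = Q a b
        v = Q b c
        r = Q a c
        p = λ x → (1ℤ - α * Q a x) * (1ℤ + α * Q b x)
        p′ = λ x → (1ℤ - α * Q b x) * (1ℤ + α * Q c x)
        va = α * r - u * r - + 2
        vb = α * v - α * u - + 2
        vc = - (α * r) - r * v - + 2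
        w : Y → ℤ
        w x = + 4 + -1ℤ * p x + -1ℤ * p′ x + ⟦ x ≟ a ⟧ * va + ⟦ x ≟ b ⟧ * vb + ⟦ x ≟ c ⟧ * vc
        total : ∑ elems w ≡ + 2 * order - + 8 - (α * u - α * v + u * r + r * v)
        total = trans (∑-+ elems _ _) (trans (cong₂ _+_
            (trans (∑-+ elems _ _) (cong₂ _+_ (trans (∑-+ elems _ _) (cong₂ _+_
            (trans (∑-+ elems _ _) (cong₂ _+_ (trans (∑-+ elems _ _) (cong₂ _+_ (∑-const elems (+ 4))
            (trans (∑-*ˡ elems -1ℤ p) (cong (-1ℤ *_) (∑-discord α α a≢b (±1-square α±))))))
            (trans (∑-*ˡ elems -1ℤ p′) (cong (-1ℤ *_) (∑-discord α α b≢c (±1-square α±))))))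
            (∑-mark a va))) (∑-mark b vb))) (∑-mark c vc)) (lem order α u v r))
          where
          lem : ∀ n α u v r → n * + 4 + -1ℤ * (n + 1ℤ) + -1ℤ * (n + 1ℤ) + (α * r - u * r - + 2) +
              (α * v - α * u - + 2) + (- (α * r) - r * v - + 2)
                ≡ + 2 * n - + 8 - (α * u - α * v + u * r + r * v)
          lem = solve-∀
        -- The expression αu - αv + ur + rv is always 2 or -2: according to u and v it is ±2r or
        -- ±2α. The worst case turns -8 into -6.
        bound : ∀ {α u v r} → ±1 α → ±1 u → ±1 v → ±1 r →
            + 2 * order - + 8 - (α * u - α * v + u * r + r * v) ≤ + 2 * order - + 6
        bound {α} {u} {v} {r} α± u± v± r± = subst (_≤ + 2 * order - + 6)
            (sym (lem order (α * u - α * v + u * r + r * v)))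
            (ℤ.i≤j⇒i-k≤j (+ 2 + (α * u - α * v + u * r + r * v)) {{ℤ.nonNegative (cases α± u± v± r±)}}
                ℤ.≤-refl)
          where
          lem : ∀ n e → + 2 * n - + 8 - e ≡ + 2 * n - + 6 - (+ 2 + e)
          lem = solve-∀
          2+2s : ∀ {s} → ±1 s → 0ℤ ≤ + 2 + + 2 * s
          2+2s (inj₁ refl) = +≤+ ℕ.z≤n
          2+2s (inj₂ refl) = +≤+ ℕ.z≤n
          cases : ∀ {α u v r} → ±1 α → ±1 u → ±1 v → ±1 r → 0ℤ ≤ + 2 + (α * u - α * v + u * r + r * v)
          cases {α} {r = r} α± (inj₁ refl) (inj₁ refl) r± = subst (0ℤ ≤_) (e α r) (2+2s r±)
            where
            e : ∀ α r → + 2 + + 2 * r ≡ + 2 + (α * 1ℤ - α * 1ℤ + 1ℤ * r + r * 1ℤ)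
            e = solve-∀
          cases {α} {r = r} α± (inj₁ refl) (inj₂ refl) r± = subst (0ℤ ≤_) (e α r) (2+2s α±)
            where
            e : ∀ α r → + 2 + + 2 * α ≡ + 2 + (α * 1ℤ - α * -1ℤ + 1ℤ * r + r * -1ℤ)
            e = solve-∀
          cases {α} {r = r} α± (inj₂ refl) (inj₁ refl) r± =
              subst (0ℤ ≤_) (e α r) (2+2s (±1-* (inj₂ refl) α±))
            where
            e : ∀ α r → + 2 + + 2 * (-1ℤ * α) ≡ + 2 + (α * -1ℤ - α * 1ℤ + -1ℤ * r + r * 1ℤ)
            e = solve-∀
          cases {α} {r = r} α± (inj₂ refl) (inj₂ refl) r± =
              subst (0ℤ ≤_) (e α r) (2+2s (±1-* (inj₂ refl) r±))
            where
            e : ∀ α r → + 2 + + 2 * (-1ℤ * r) ≡ + 2 + (α * -1ℤ - α * -1ℤ + -1ℤ * r + r * -1ℤ)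
            e = solve-∀
        E : ℤ → ℤ → ℤ → ℤ → ℤ → ℤ
        E s s′ i j k = + 4 + -1ℤ * s + -1ℤ * s′ + i * va + j * vb + k * vc
        generic : ∀ s s′ → E s s′ 0ℤ 0ℤ 0ℤ ≡ + 4 - s - s′
        generic s s′ = lem s s′ va vb vc
          where
          lem : ∀ s s′ va vb vc → + 4 + -1ℤ * s + -1ℤ * s′ + 0ℤ * va + 0ℤ * vb + 0ℤ * vc ≡ + 4 - s - s′
          lem = solve-∀
        prod : ℤ → ℤ → ℤ
        prod s s′ = (1ℤ - α * s) * (1ℤ + α * s′)
        value : ∀ i j k sa sb sc {sa′ sb′ sc′} → sa ≡ sa′ → sb ≡ sb′ → sc ≡ sc′ →
            E (prod sa′ sb′) (prod sb′ sc′) i j k ≡ 0ℤ → 0ℤ ≤ E (prod sa sb) (prod sb sc) i j k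
        value i j k sa sb sc refl refl refl e = ℤ.≤-reflexive (sym e)
        vanish : ∀ s → s * (α * α - 1ℤ) ≡ 0ℤ
        vanish s = trans (cong (λ e → s * (e - 1ℤ)) (±1-square α±)) (ℤ.*-zeroʳ s)
        w≥0 : ∀ x → 0ℤ ≤ w x
        w≥0 x with x ≟ a | x ≟ b | x ≟ c
        ... | yes refl | yes refl | _ = ⊥-elim (a≢b refl)
        ... | yes refl | _ | yes refl = ⊥-elim (a≢c refl)
        ... | _ | yes refl | yes refl = ⊥-elim (b≢c refl)
        ... | yes refl | no _ | no _ = value 1ℤ 0ℤ 0ℤ (Q a a) (Q b a) (Q c a) (diagonal a) (symm a b)
            (symm a c) (trans (lem α u v r) (vanish (u * r)))
          where
          lem : ∀ α u v r → + 4 + -1ℤ * ((1ℤ - α * 0ℤ) * (1ℤ + α * u)) + -1ℤ * ((1ℤ - α * u) * (1ℤ + α * r))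
                + 1ℤ * (α * r - u * r - + 2) + 0ℤ * (α * v - α * u - + 2) + 0ℤ *
                    (- (α * r) - r * v - + 2) ≡ u * r * (α * α - 1ℤ)
          lem = solve-∀
        ... | no _ | yes refl | no _ = value 0ℤ 1ℤ 0ℤ u (Q b b) (Q c b) refl (diagonal b) (symm b c)
            (lem α u v r)
          where
          lem : ∀ α u v r → + 4 + -1ℤ * ((1ℤ - α * u) * (1ℤ + α * 0ℤ)) + -1ℤ *
              ((1ℤ - α * 0ℤ) * (1ℤ + α * v))
                + 0ℤ * (α * r - u * r - + 2) + 1ℤ * (α * v - α * u - + 2) + 0ℤ *
                    (- (α * r) - r * v - + 2) ≡ 0ℤ
          lem = solve-∀
        ... | no _ | no _ | yes refl = value 0ℤ 0ℤ 1ℤ r v (Q c c) refl refl (diagonal c)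
            (trans (lem α u v r) (vanish (r * v)))
          where
          lem : ∀ α u v r → + 4 + -1ℤ * ((1ℤ - α * r) * (1ℤ + α * v)) + -1ℤ * ((1ℤ - α * v) * (1ℤ + α * 0ℤ))
                + 0ℤ * (α * r - u * r - + 2) + 0ℤ * (α * v - α * u - + 2) + 1ℤ *
                    (- (α * r) - r * v - + 2) ≡ r * v * (α * α - 1ℤ)
          lem = solve-∀
        ... | no x≢a | no x≢b | no x≢c with discord-values α± (unit (x≢a ∘ sym))
            (unit (x≢b ∘ sym)) | discord-values α± (unit (x≢b ∘ sym)) (unit (x≢c ∘ sym))
        ...   | inj₁ ((_ , e₁) , _) | inj₁ ((e₂ , _) , _) = ⊥-elim (impossible α± (trans (sym e₁) e₂))
          where
          impossible : ∀ {α} → ±1 α → α ≢ - α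
          impossible (inj₁ refl) ()
          impossible (inj₂ refl) ()
        ...   | inj₁ (_ , e₁) | inj₂ (_ , e₂) = subst (0ℤ ≤_)
            (sym (trans (generic (p x) (p′ x)) (cong₂ (λ s s′ → + 4 - s - s′) e₁ e₂))) (+≤+ ℕ.z≤n)
        ...   | inj₂ (_ , e₁) | inj₁ (_ , e₂) = subst (0ℤ ≤_)
            (sym (trans (generic (p x) (p′ x)) (cong₂ (λ s s′ → + 4 - s - s′) e₁ e₂))) (+≤+ ℕ.z≤n)
        ...   | inj₂ (_ , e₁) | inj₂ (_ , e₂) = subst (0ℤ ≤_)
            (sym (trans (generic (p x) (p′ x)) (cong₂ (λ s s′ → + 4 - s - s′) e₁ e₂))) (+≤+ ℕ.z≤n)
        w≥4 : ∀ i → + 4 ≤ w (ψ i)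
        w≥4 i with good i
        ... | x≢a , x≢b , x≢c , ¬bad , ¬bad′ with ψ i ≟ a | ψ i ≟ b | ψ i ≟ c
        ... | yes h | _ | _ = ⊥-elim (x≢a h)
        ... | _ | yes h | _ = ⊥-elim (x≢b h)
        ... | _ | _ | yes h = ⊥-elim (x≢c h)
        ... | no _  | no _ | no _ with discord-values α± (unit (x≢a ∘ sym))
            (unit (x≢b ∘ sym)) | discord-values α± (unit (x≢b ∘ sym)) (unit (x≢c ∘ sym))
        ...   | inj₁ (bad , _) | _ = ⊥-elim (¬bad bad)
        ...   | _ | inj₁ (bad , _) = ⊥-elim (¬bad′ bad)
        ...   | inj₂ (_ , e₁) | inj₂ (_ , e₂) = subst (+ 4 ≤_)
            (sym (trans (generic (p (ψ i)) (p′ (ψ i))) (cong₂ (λ s s′ → + 4 - s - s′) e₁ e₂))) ℤ.≤-refl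

open ConferenceMatrices

-- Lower bounds: colorings by signs.

module PaleyColorings where

  open import Data.Integer.Base using (_+_; _*_; -_; _-_; _≤_; _<_)

  -- Orderability with positions and list colors attached to the vertices, which spares the index
  -- arithmetic of the color list.
  Sequential : ∀ {G C} → EdgeColoring G C → Set
  Sequential {G} {C} χ = Σ[ pos ∈ (V → ℕ) ] (Injective _≡_ _≡_ pos × Σ[ c ∈ (V → C) ]
    (∀ {u v} (e : u ~ v) → pos u ℕ.< pos v → color e ≡ c u))
    where
    open Graph G
    open EdgeColoring χ

  orderable⇒sequential : ∀ {G k} (χ : EdgeColoring G (Fin (suc k))) → Orderable χ → Sequential χ
  orderable⇒sequential {G} {k} χ (p , ordering , c , ordered) =
      toℕ ∘ position , position-injective , c′ , sequential
    where
    open Graph G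
    open EdgeColoring χ
    vertex : Fin p → V
    vertex = Bijection.to ordering
    position : V → Fin p
    position v = proj₁ (Bijection.strictlySurjective ordering v)
    vertex-position : ∀ v → vertex (position v) ≡ v
    vertex-position v = proj₂ (Bijection.strictlySurjective ordering v)
    position-injective : Injective _≡_ _≡_ (toℕ ∘ position)
    position-injective {u} {v} eq = trans (sym (vertex-position u))
        (trans (cong vertex (Fin.toℕ-injective eq)) (vertex-position v))
    list-color : ∀ {n} → Dec (n ℕ.< p ∸ 1) → Fin (suc k)
    list-color (yes h) = c (fromℕ< h)
    -- The last vertex has no list color and receives an arbitrary one; no edge leads from it to a
    -- later vertex.
    list-color (no _)  = zero
    c′ : V → Fin (suc k)
    c′ v = list-color (toℕ (position v) ℕ.<? p ∸ 1)
    moved : ∀ i {j u v} → vertex (inject≤ i (ℕ.m∸n≤m p 1)) ≡ u → vertex j ≡ v → toℕ i ℕ.< toℕ j →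
        (e : u ~ v) → color e ≡ c i
    moved i {j} refl refl i<j e = ordered i j i<j e
    sequential : ∀ {u v} (e : u ~ v) → toℕ (position u) ℕ.< toℕ (position v) → color e ≡ c′ u
    sequential {u} {v} e u<v with toℕ (position u) ℕ.<? p ∸ 1
    ... | yes h = moved (fromℕ< h) (trans (cong vertex
        (Fin.toℕ-injective (trans (Fin.toℕ-inject≤ _ _) (Fin.toℕ-fromℕ< h)))) (vertex-position u))
                    (vertex-position v) (subst (ℕ._< toℕ (position v)) (sym (Fin.toℕ-fromℕ< h)) u<v) e
    ... | no ¬h = ⊥-elim (¬h (below u<v (Fin.toℕ<n (position v))))
      where
      below : ∀ {i j p} → i ℕ.< j → j ℕ.< p → i ℕ.< p ∸ 1
      below i<j (ℕ.s≤s j≤p) = ℕ.<-≤-trans i<j j≤p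

  encode : ℤ → Fin 2
  encode s with s ℤ.≟ 1ℤ
  ... | yes _ = 0F
  ... | no _  = 1F

  decode : Fin 2 → ℤ
  decode 0F = 1ℤ
  decode 1F = -1ℤ

  decode-unit : ∀ c → ±1 (decode c)
  decode-unit 0F = inj₁ refl
  decode-unit 1F = inj₂ refl

  decode-encode : ∀ {s} → ±1 s → decode (encode s) ≡ s
  decode-encode (inj₁ refl) = refl
  decode-encode (inj₂ refl) = refl

  module Avoidance {Y : Set} (C : Conference Y) (symm : ∀ x y → Conference.Q C y x ≡ Conference.Q C x y)
                   {m : ℕ} (ι : Fin m → Y) (ι-injective : Injective _≡_ _≡_ ι) where
    open Conference C
    open Counting C

    coloring : EdgeColoring (K m) (Fin 2)
    coloring = record
      { color     = λ {u} {v} _ → encode (Q (ι u) (ι v))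
      ; unordered = λ {u} {v} _ _ → cong encode (sym (symm (ι u) (ι v)))
      }

    record Pattern (s t : ℕ) : Set where
      field
        left           : Fin s → Y
        right          : Fin t → Y
        left-injective  : Injective _≡_ _≡_ left
        right-injective : Injective _≡_ _≡_ right
        apart          : ∀ i j → right j ≢ left i
        posˡ           : Fin s → ℕ
        posʳ           : Fin t → ℕ
        posˡ-injective : Injective _≡_ _≡_ posˡ
        pos-apart      : ∀ i j → posˡ i ≢ posʳ j
        cˡ             : Fin s → ℤ
        cʳ             : Fin t → ℤ
        cˡ-unit        : ∀ i → ±1 (cˡ i)
        left-first     : ∀ i j → posˡ i ℕ.< posʳ j → Q (left i) (right j) ≡ cˡ i
        right-first    : ∀ i j → posʳ j ℕ.< posˡ i → Q (left i) (right j) ≡ cʳ j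

    sorted-pattern : ∀ {s t} → ContainsOrderable (Kᵇ s t) coloring → Pattern s t
    sorted-pattern {s} {t} (φ , ord) with orderable⇒sequential (inherited φ coloring) ord
    ... | pos , pos-inj , c , sequential = record
      { left            = ι ∘ vertex ∘ inj₁
      ; right           = ι ∘ vertex ∘ inj₂
      ; left-injective  = inj₁-injective ∘ injective ∘ ι-injective
      ; right-injective = inj₂-injective ∘ injective ∘ ι-injective
      ; apart           = apart
      ; posˡ            = pos ∘ inj₁
      ; posʳ            = pos ∘ inj₂
      ; posˡ-injective  = inj₁-injective ∘ pos-inj
      ; pos-apart       = λ i j eq → inj₁≢inj₂ (pos-inj eq)
      ; cˡ              = decode ∘ c ∘ inj₁
      ; cʳ              = decode ∘ c ∘ inj₂
      ; cˡ-unit         = λ i → decode-unit (c (inj₁ i))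
      ; left-first      = λ i j i<j → trans (sym (decode-encode (unit (apart i j ∘ sym))))
          (cong decode (sequential left-right i<j))
      ; right-first     = λ i j j<i → trans (symm (ι (vertex (inj₂ j))) (ι (vertex (inj₁ i))))
          (trans (sym (decode-encode (unit (apart i j)))) (cong decode (sequential right-left j<i)))
      }
      where
      open Copy φ
      inj₁≢inj₂ : ∀ {i j} → _≢_ {A = Fin s ⊎ Fin t} (inj₁ i) (inj₂ j)
      inj₁≢inj₂ ()
      apart : ∀ i j → ι (vertex (inj₂ j)) ≢ ι (vertex (inj₁ i))
      apart i j eq = inj₁≢inj₂ (sym (injective (ι-injective eq)))

    private
      unit≢neg : ∀ {s} → ±1 s → s ≢ - s
      unit≢neg (inj₁ refl) ()
      unit≢neg (inj₂ refl) ()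

      opposite : ∀ {s r} → ±1 s → ±1 r → s ≡ r ⊎ s ≡ - r
      opposite (inj₁ refl) (inj₁ refl) = inj₁ refl
      opposite (inj₁ refl) (inj₂ refl) = inj₂ refl
      opposite (inj₂ refl) (inj₁ refl) = inj₂ refl
      opposite (inj₂ refl) (inj₂ refl) = inj₁ refl

    -- A right vertex either precedes both left vertices and sees them in one sign, or follows the
    -- earlier one and sees it in its list sign. Neither is a discord.
    pair-pattern : ∀ {t} → Pattern 2 t → + t * + 4 ≤ + 3 * order - + 7
    pair-pattern {t} P = go (ℕ.<-cmp (posˡ 0F) (posˡ 1F))
      where
      open Pattern P
      bound : ∀ a b → a ≢ b → posˡ a ℕ.< posˡ b → + t * + 4 ≤ + 3 * order - + 7
      bound a b a≢b a<b = pair-bound symm right right-injective {left a} {left b} {cˡ a}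
          (a≢b ∘ left-injective) (cˡ-unit a)
        (λ j → apart a j , apart b j , not-bad j (ℕ.<-cmp (posˡ a) (posʳ j)))
        where
        not-bad : ∀ j → _ → ¬ Discord (cˡ a) (Q (left a) (right j)) (Q (left b) (right j))
        not-bad j (tri< a<j _ _) (e , _) = unit≢neg (cˡ-unit a) (trans (sym (left-first a j a<j)) e)
        not-bad j (tri≈ _ a≡j _) _ = pos-apart a j a≡j
        not-bad j (tri> _ _ j<a) (e , e′) = unit≢neg (cˡ-unit a) (trans (sym e′)
          (trans (right-first b j (ℕ.<-trans j<a a<b)) (trans (sym (right-first a j j<a)) e)))
      go : _ → + t * + 4 ≤ + 3 * order - + 7
      go (tri< h _ _) = bound 0F 1F (λ ()) h
      go (tri> _ _ h) = bound 1F 0F (λ ()) h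
      go (tri≈ _ e _) with posˡ-injective e
      ... | ()

    triple-pattern : ∀ {t} → Pattern 3 t → + t * + 4 ≤ + 2 * order - + 6
    triple-pattern {t} P = sort (ℕ.<-cmp (posˡ 0F) (posˡ 1F)) (ℕ.<-cmp (posˡ 1F) (posˡ 2F))
        (ℕ.<-cmp (posˡ 0F) (posˡ 2F))
      where
      open Pattern P
      module _ {a b c} (a≢b : a ≢ b) (b≢c : b ≢ c) (a≢c : a ≢ c) (a<b : posˡ a ℕ.< posˡ b)
          (b<c : posˡ b ℕ.< posˡ c) where
        S : Fin 3 → Fin t → ℤ
        S i j = Q (left i) (right j)
        -- The cases are none, one, or at least two left vertices before the right vertex.
        data Good (j : Fin t) : Set where
          constant : S a j ≡ S b j → S b j ≡ S c j → Good j
          agreeing : S a j ≡ cˡ a → S b j ≡ S c j → Good j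
          listed   : S a j ≡ cˡ a → S b j ≡ cˡ b → Good j
        good : ∀ j → Good j
        good j with ℕ.<-cmp (posˡ a) (posʳ j) | ℕ.<-cmp (posˡ b) (posʳ j)
        ... | tri≈ _ e _   | _            = ⊥-elim (pos-apart a j e)
        ... | _            | tri≈ _ e _   = ⊥-elim (pos-apart b j e)
        ... | tri> _ _ j<a | _            = constant
          (trans (right-first a j j<a) (sym (right-first b j (ℕ.<-trans j<a a<b))))
          (trans (right-first b j (ℕ.<-trans j<a a<b))
              (sym (right-first c j (ℕ.<-trans j<a (ℕ.<-trans a<b b<c)))))
        ... | tri< a<j _ _ | tri< b<j _ _ = listed (left-first a j a<j) (left-first b j b<j)
        ... | tri< a<j _ _ | tri> _ _ j<b = agreeing (left-first a j a<j)
          (trans (right-first b j j<b) (sym (right-first c j (ℕ.<-trans j<b b<c))))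
        α = cˡ a
        α≢-α = unit≢neg (cˡ-unit a)

        -- If the list colors of a and b differ, the order a, c, b and the
        -- repeated color of a allow every right vertex that a, b, c allows.
        bound : + t * + 4 ≤ + 2 * order - + 6
        bound with opposite (cˡ-unit b) (cˡ-unit a)
        ... | inj₁ same = triple-bound symm right right-injective {left a} {left b} {left c} {α}
              (a≢b ∘ left-injective) (b≢c ∘ left-injective) (a≢c ∘ left-injective) (cˡ-unit a)
              (λ j → apart a j , apart b j , apart c j , bad-ab (good j) , bad-bc (good j))
          where
          bad-ab : ∀ {j} → Good j → ¬ Discord α (S a j) (S b j)
          bad-ab (constant e _) (h , h′) = α≢-α (trans (sym h′) (trans (sym e) h))
          bad-ab (agreeing e _) (h , _) = α≢-α (trans (sym e) h)
          bad-ab (listed e _) (h , _) = α≢-α (trans (sym e) h)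
          bad-bc : ∀ {j} → Good j → ¬ Discord α (S b j) (S c j)
          bad-bc (constant _ e) (h , h′) = α≢-α (trans (sym h′) (trans (sym e) h))
          bad-bc (agreeing _ e) (h , h′) = α≢-α (trans (sym h′) (trans (sym e) h))
          bad-bc (listed _ e) (h , _) = α≢-α (trans (sym same) (trans (sym e) h))
        ... | inj₂ diff = triple-bound symm right right-injective {left a} {left c} {left b} {α}
              (a≢c ∘ left-injective) (b≢c ∘ sym ∘ left-injective) (a≢b ∘ left-injective) (cˡ-unit a)
              (λ j → apart a j , apart c j , apart b j , bad-ac (good j) , bad-cb (good j))
          where
          bad-ac : ∀ {j} → Good j → ¬ Discord α (S a j) (S c j)
          bad-ac (constant e e′) (h , h′) = α≢-α (trans (sym h′) (trans (sym e′) (trans (sym e) h)))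
          bad-ac (agreeing e _) (h , _) = α≢-α (trans (sym e) h)
          bad-ac (listed e _) (h , _) = α≢-α (trans (sym e) h)
          bad-cb : ∀ {j} → Good j → ¬ Discord α (S c j) (S b j)
          bad-cb (constant _ e) (h , h′) = α≢-α (trans (sym h′) (trans e h))
          bad-cb (agreeing _ e) (h , h′) = α≢-α (trans (sym h′) (trans e h))
          bad-cb (listed _ e) (_ , h′) = α≢-α (trans (sym h′) (trans e diff))
      sort : _ → _ → _ → + t * + 4 ≤ + 2 * order - + 6
      sort (tri≈ _ e _) _ _ with posˡ-injective e
      ... | ()
      sort _ (tri≈ _ e _) _ with posˡ-injective e
      ... | ()
      sort _ _ (tri≈ _ e _) with posˡ-injective e
      ... | ()
      sort (tri< p _ _) (tri< q _ _) _            = bound (λ ()) (λ ()) (λ ()) p q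
      sort (tri< p _ _) (tri> _ _ q) (tri< r _ _) = bound (λ ()) (λ ()) (λ ()) r q
      sort (tri< p _ _) (tri> _ _ q) (tri> _ _ r) = bound (λ ()) (λ ()) (λ ()) r p
      sort (tri> _ _ p) (tri< q _ _) (tri< r _ _) = bound (λ ()) (λ ()) (λ ()) p r
      sort (tri> _ _ p) (tri< q _ _) (tri> _ _ r) = bound (λ ()) (λ ()) (λ ()) q r
      sort (tri> _ _ p) (tri> _ _ q) _            = bound (λ ()) (λ ()) (λ ()) q p

  prime-power-conference : ∀ {p} k → Prime p → p ≢ 2 →
      Σ[ Y ∈ Set ] Σ[ C ∈ Conference Y ] length (Conference.elems C) ≡ p ^ k
  prime-power-conference {p} k p-prime p≢2 = _ , T.turyn k , length-vecs k
    where
    module T = Turyn (Legendre.legendre p p-prime p≢2)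
    length-vecs : ∀ k → length (T.vecs k) ≡ p ^ k
    length-vecs zero    = refl
    length-vecs (suc k) = trans (length-cartesianProductWith Vec._∷_ (allFin p) (T.vecs k))
        (cong₂ ℕ._*_ (length-tabulate {n = p} id) (length-vecs k))

  conference-1mod4 : ∀ μ → PrimePower (4 ℕ.* μ ℕ.+ 1) →
      Σ[ Y ∈ Set ] Σ[ C ∈ Conference Y ] length (Conference.elems C) ≡ 4 ℕ.* μ ℕ.+ 1
  conference-1mod4 μ (p , k , p-prime , q≡) =
    let Y , C , len = prime-power-conference (suc k) p-prime p≢2 in Y , C , trans len (sym q≡)
    where
    p≢2 : p ≢ 2
    p≢2 refl = ℕ.even≢odd (2 ^ k) (2 ℕ.* μ) (trans (sym q≡)
        (trans (ℕ.+-comm (4 ℕ.* μ) 1) (cong suc (ℕ.*-assoc 2 2 μ))))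

  i-4<i : ∀ i → i - + 4 < i
  i-4<i i = subst (i - + 4 <_) (ℤ.+-identityʳ i) (ℤ.+-monoʳ-< i ℤ.-<+)

  module Lower (μ : ℕ) (prime-power : PrimePower (4 ℕ.* μ ℕ.+ 1)) where

    private
      q = 4 ℕ.* μ ℕ.+ 1

      conference = conference-1mod4 μ prime-power
      C = proj₁ (proj₂ conference)
      open Conference C
      elems-length = proj₂ (proj₂ conference)

      order≡ : order ≡ + 4 * + μ + 1ℤ
      order≡ = trans (cong +_ elems-length) (cong (_+ 1ℤ) (ℤ.pos-* 4 μ))

      symm = Counting.symmetric C (+ μ) order≡

    module _ {m : ℕ} (m≤q : m ℕ.≤ q) where

      private
        m≤ = subst (m ℕ.≤_) (sym elems-length) m≤q

      private
        ι : Fin m → proj₁ conference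
        ι i = lookup elems (inject≤ i m≤)
        ι-injective : Injective _≡_ _≡_ ι
        ι-injective = Fin.inject≤-injective m≤ m≤ _ _ ∘ lookup-injective unique
        module A = Avoidance C symm ι ι-injective
      open A public using (coloring)

      avoids-pair : ¬ ContainsOrderable (Kᵇ 2 (3 ℕ.* μ)) coloring
      avoids-pair copy = absurd (subst₂ (λ a n → a * + 4 ≤ + 3 * n - + 7) (ℤ.pos-* 3 μ) order≡
          (A.pair-pattern (A.sorted-pattern copy)))
        where
        -- The bound misses 4t by exactly 4, the weight of one right vertex.
        lem : ∀ m → + 3 * (+ 4 * m + 1ℤ) - + 7 ≡ + 3 * m * + 4 - + 4
        lem = solve-∀
        absurd : ¬ (+ 3 * + μ * + 4 ≤ + 3 * (+ 4 * + μ + 1ℤ) - + 7)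
        absurd h = ℤ.<-irrefl refl (ℤ.≤-<-trans h (subst (_< + 3 * + μ * + 4) (sym (lem (+ μ)))
            (i-4<i (+ 3 * + μ * + 4))))

      avoids-triple : ¬ ContainsOrderable (Kᵇ 3 (2 ℕ.* μ)) coloring
      avoids-triple copy = absurd (subst₂ (λ a n → a * + 4 ≤ + 2 * n - + 6) (ℤ.pos-* 2 μ) order≡
          (A.triple-pattern (A.sorted-pattern copy)))
        where
        lem : ∀ m → + 2 * (+ 4 * m + 1ℤ) - + 6 ≡ + 2 * m * + 4 - + 4
        lem = solve-∀
        absurd : ¬ (+ 2 * + μ * + 4 ≤ + 2 * (+ 4 * + μ + 1ℤ) - + 6)
        absurd h = ℤ.<-irrefl refl (ℤ.≤-<-trans h (subst (_< + 2 * + μ * + 4) (sym (lem (+ μ)))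
            (i-4<i (+ 2 * + μ * + 4))))

open PaleyColorings

-- Modules in colorings without rainbow triangle.

module GallaiColorings where

  open import Relation.Binary.Construct.Closure.ReflexiveTransitive using (Star; ε; _◅_; _◅◅_; reverse)

  -- Under a negated goal, finitely many instances of excluded middle are free. This allows a
  -- component to be formed with `filter` although reachability is not decided.
  ¬¬-decide-all : ∀ {n} (P : Fin n → Set) → ¬ ¬ (∀ i → Dec (P i))
  ¬¬-decide-all {zero}  P ¬d = ¬d λ ()
  ¬¬-decide-all {suc n} P ¬d = ¬¬-excluded-middle λ d₀ → ¬¬-decide-all (P ∘ suc) λ d →
      ¬d λ { zero → d₀ ; (suc i) → d i }

  module Gallai {n k : ℕ} (col : Fin n → Fin n → Fin k) (col-sym : ∀ u v → col u v ≡ col v u)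
    (gallai : ∀ {u v w} → u ≢ v → v ≢ w → u ≢ w → col u v ≡ col v w ⊎ col v w ≡ col u w ⊎ col u v ≡ col u
        w) where

    V : Set
    V = Fin n

    third : ∀ {u v w c} → u ≢ v → v ≢ w → u ≢ w → col u v ≡ c → col u w ≢ c → col v w ≢ c →
        col u w ≡ col v w
    third u≢v v≢w u≢w uv uw vw with gallai u≢v v≢w u≢w
    ... | inj₁ e        = ⊥-elim (vw (trans (sym e) uv))
    ... | inj₂ (inj₁ e) = sym e
    ... | inj₂ (inj₂ e) = ⊥-elim (uw (trans (sym e) uv))

    Step : Fin k → List V → V → V → Set
    Step c N u v = u ∈ N × v ∈ N × u ≢ v × col u v ≡ c

    Reach : Fin k → List V → V → V → Set
    Reach c N = Star (Step c N)

    Connected : Fin k → List V → Set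
    Connected c N = ∀ {u v} → u ∈ N → v ∈ N → ¬ ¬ Reach c N u v

    reach-sym : ∀ {c N u v} → Reach c N u v → Reach c N v u
    reach-sym = reverse (λ { {u} {v} (u∈ , v∈ , u≢v , e) → v∈ , u∈ , u≢v ∘ sym , trans (col-sym v u) e })

    apart : ∀ {c N u v} → ¬ Reach c N u v → u ≢ v
    apart ¬r refl = ¬r ε

    not-color : ∀ {c N u v} → u ∈ N → v ∈ N → ¬ Reach c N u v → col u v ≢ c
    not-color u∈ v∈ ¬r e = ¬r ((u∈ , v∈ , apart ¬r , e) ◅ ε)

    -- Moving along one c-edge of the component gives a triangle in which only that edge has color
    -- c, so its other two edges agree.
    homogeneous : ∀ {c N x x′ y} → Reach c N x x′ → y ∈ N → ¬ Reach c N x y → col y x ≡ col y x′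
    homogeneous ε y∈ ¬r = refl
    homogeneous {x = x} {y = y} (_◅_ {j = z} step@(x∈ , z∈ , x≢z , e) r) y∈ ¬r =
      trans (col-sym y x) (trans (third x≢z (apart ¬r′) (apart ¬r) e (not-color x∈ y∈ ¬r)
          (not-color z∈ y∈ ¬r′))
        (trans (col-sym z y) (homogeneous r y∈ ¬r′)))
      where
      ¬r′ : ¬ Reach _ _ z y
      ¬r′ r′ = ¬r (step ◅ r′)

    ∈-tail : ∀ {v x : V} {N} → x ∈ v ∷ N → x ≢ v → x ∈ N
    ∈-tail (here e)  x≢v = ⊥-elim (x≢v e)
    ∈-tail (there h) _   = h

    -- The path is cut at its first arrival at v; up to there it stays in `N`.
    last-exit : ∀ {c v N x} → x ∈ N → x ≢ v → Reach c (v ∷ N) x v →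
        ∃[ y ] (y ∈ N × Reach c N x y × col y v ≡ c)
    last-exit x∈ x≢v ε = ⊥-elim (x≢v refl)
    last-exit {v = v} {x = x} x∈ x≢v (_◅_ {j = z} (_ , z∈ , x≢z , e) r) with z Fin.≟ v
    ... | yes refl = x , x∈ , ε , e
    ... | no z≢v with last-exit (∈-tail z∈ z≢v) z≢v r
    ...   | y , y∈ , r′ , e′ = y , y∈ , (x∈ , ∈-tail z∈ z≢v , x≢z , e) ◅ r′ , e′

    neighbour : ∀ {c v w N} → w ≢ v → Reach c (v ∷ N) v w → ∃[ x ] (x ∈ N × col v x ≡ c)
    neighbour w≢v ε = ⊥-elim (w≢v refl)
    neighbour w≢v (_◅_ {j = z} (_ , z∈ , v≢z , e) r) = z , ∈-tail z∈ (v≢z ∘ sym) , e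

    -- Let c be disconnected on N but connected on v ∷ N.  Every c-component of N
    -- contains a c-neighbour of v, and is joined to each vertex outside it in one
    -- color; looking at the components of a c′- and a c″-neighbour of v, the
    -- color at a vertex outside would have to be both c′ and c″.
    no-cut : ∀ {v N c c′ c″ x′ x″} → v ∉ N → c′ ≢ c → c″ ≢ c → c′ ≢ c″ → Connected c (v ∷ N) →
      x′ ∈ N → col v x′ ≡ c′ → x″ ∈ N → col v x″ ≡ c″ → ¬ ¬ Connected c N
    no-cut {v} {N} {c} {c′} {c″} {x′} {x″} v∉ c′≢c c″≢c c′≢c″ conn x′∈ vx′ x″∈ vx″ ¬conn =
      ¬conn λ u∈ w∈ ¬uw → all-reached u∈ λ xu → all-reached w∈ λ xw → ¬uw (reach-sym xu ◅◅ xw)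
      where
      ≢v : ∀ {x} → x ∈ N → x ≢ v
      ≢v x∈ refl = v∉ x∈
      forced : ∀ {x y d} → d ≢ c → x ∈ N → col v x ≡ d → y ∈ N → col y v ≡ c → ¬ Reach c N x y → col y x ≡ d
      forced {x} {y} d≢c x∈ vx y∈ yv ¬xy = trans
        (third (≢v y∈) (≢v x∈ ∘ sym) (apart ¬xy ∘ sym) yv (not-color x∈ y∈ ¬xy ∘ trans (col-sym x y))
            (d≢c ∘ trans (sym vx))) vx
      exit : ∀ {x} → x ∈ N → ¬ ¬ (∃[ y ] (y ∈ N × Reach c N x y × col y v ≡ c))
      exit x∈ k = conn (there x∈) (here refl) (k ∘ last-exit x∈ (≢v x∈))
      same-component : ∀ {z} → z ∈ N → ¬ Reach c N x′ z → ¬ Reach c N x′ x″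
      same-component z∈ ¬xz xx = exit z∈ λ { (y , y∈ , zy , yv) →
        let ¬xy = λ xy → ¬xz (xy ◅◅ reach-sym zy) in
        c′≢c″ (trans (sym (forced c′≢c x′∈ vx′ y∈ yv ¬xy))
          (trans (homogeneous xx y∈ ¬xy) (forced c″≢c x″∈ vx″ y∈ yv (λ r → ¬xy (xx ◅◅ r))))) }
      all-reached : ∀ {z} → z ∈ N → ¬ ¬ Reach c N x′ z
      all-reached z∈ ¬xz = exit x′∈ λ { (y′ , y′∈ , xy′ , y′v) → exit x″∈ λ { (y″ , y″∈ , xy″ , y″v) →
        let ¬xx = same-component z∈ ¬xz
            ¬x′y″ = λ r → ¬xx (r ◅◅ reach-sym xy″)
            ¬x″y′ = λ r → ¬xx (xy′ ◅◅ reach-sym r) in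
        c′≢c″ (trans (sym (forced c′≢c x′∈ vx′ y″∈ y″v ¬x′y″))
          (trans (homogeneous xy′ y″∈ ¬x′y″) (trans (col-sym y″ y′)
          (trans (sym (homogeneous xy″ y′∈ ¬x″y′)) (forced c″≢c x″∈ vx″ y′∈ y′v ¬x″y′))))) } }

    -- Infinite descent: deleting v preserves all three connections, each by `no-cut` with v's
    -- neighbours in the other two colors. Neighbours of v in different colors are distinct, so two
    -- vertices always remain.
    three-connected : ∀ N → Unique N → ∀ {u w} → u ∈ N → w ∈ N → u ≢ w → ∀ {c₀ c₁ c₂} → c₀ ≢ c₁ →
        c₁ ≢ c₂ → c₀ ≢ c₂ →
      Connected c₀ N → Connected c₁ N → ¬ Connected c₂ N
    three-connected (v ∷ N) (v# ∷ unique) u∈ w∈ u≢w c₀≢c₁ c₁≢c₂ c₀≢c₂ conn₀ conn₁ conn₂ =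
        split (other u∈ w∈ u≢w)
      where
      v∉ : v ∉ N
      v∉ v∈ = All.lookup v# v∈ refl
      other : ∀ {u w} → u ∈ v ∷ N → w ∈ v ∷ N → u ≢ w → ∃[ z ] z ∈ N
      other (there u∈) _          _   = _ , u∈
      other (here _)   (there w∈) _   = _ , w∈
      other (here e)   (here e′)  u≢w = ⊥-elim (u≢w (trans e (sym e′)))
      split : ∃[ z ] z ∈ N → ⊥
      split (z , z∈) = conn₀ (here refl) (there z∈) λ r₀ → conn₁ (here refl) (there z∈) λ r₁ →
          conn₂ (here refl) (there z∈) λ r₂ →
        go (neighbour z≢v r₀) (neighbour z≢v r₁) (neighbour z≢v r₂)
        where
        z≢v : z ≢ v
        z≢v refl = v∉ z∈
        go : _ → _ → _ → ⊥
        go (x₀ , x₀∈ , e₀) (x₁ , x₁∈ , e₁) (x₂ , x₂∈ , e₂) =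
          no-cut v∉ (c₀≢c₁ ∘ sym) (c₀≢c₂ ∘ sym) c₁≢c₂ conn₀ x₁∈ e₁ x₂∈ e₂ λ h₀ →
          no-cut v∉ c₀≢c₁ (c₁≢c₂ ∘ sym) c₀≢c₂ conn₁ x₀∈ e₀ x₂∈ e₂ λ h₁ →
          no-cut v∉ c₀≢c₂ c₁≢c₂ c₀≢c₁ conn₂ x₀∈ e₀ x₁∈ e₁ λ h₂ →
          three-connected N unique x₀∈ x₁∈ (λ { refl → c₀≢c₁ (trans (sym e₀) e₁) }) c₀≢c₁ c₁≢c₂ c₀≢c₂ h₀
              h₁ h₂

    record Module (M : List V) : Set where
      field
        unique  : Unique M
        {a b}   : V
        a∈      : a ∈ M
        b∈      : b ∈ M
        a≢b     : a ≢ b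
        uniform : ∀ {x y z} → x ∉ M → y ∈ M → z ∈ M → col x y ≡ col x z

    TwoColored : List V → Set
    TwoColored M = ∃[ α ] ∃[ β ] (∀ {x y} → x ∈ M → y ∈ M → x ≢ y → col x y ≡ α ⊎ col x y ≡ β)

    _∈?_ : ∀ (x : V) (M : List V) → Dec (x ∈ M)
    x ∈? M = Any.any? (x Fin.≟_) M

    -- A component of a disconnected color is a smaller module.
    smaller-module : ∀ {M} → Module M → ∀ {p q c} → p ∈ M → q ∈ M → p ≢ q → col p q ≡ c → ¬ Connected c M →
      ¬ ¬ (Σ[ A ∈ List V ] (Module A × length A ℕ.< length M))
    smaller-module {M} mod {p} {q} {c} p∈ q∈ p≢q pq ¬conn k = ¬¬-decide-all (Reach c M p) λ reach? →
      ¬conn λ u∈ w∈ ¬uw → k (filter reach? M , record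
        { unique  = filter⁺ reach? unique
        ; a∈      = ∈-filter⁺ reach? p∈ ε
        ; b∈      = ∈-filter⁺ reach? q∈ ((p∈ , q∈ , p≢q , pq) ◅ ε)
        ; a≢b     = p≢q
        ; uniform = λ {x} x∉ y∈ z∈ → component-uniform reach? x∉ (∈-filter⁻ reach? y∈)
            (∈-filter⁻ reach? z∈) (x ∈? M)
        } , filter-notAll reach? M (missing reach? u∈ w∈ ¬uw))
      where
      open Module mod using (unique; uniform)
      component-uniform : ∀ (reach? : ∀ z → Dec (Reach c M p z)) {x y z} → x ∉ filter reach? M →
        y ∈ M × Reach c M p y → z ∈ M × Reach c M p z → Dec (x ∈ M) → col x y ≡ col x z
      component-uniform reach? x∉ (y∈ , _)  (z∈ , _)  (no x∉M) = uniform x∉M y∈ z∈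
      component-uniform reach? x∉ (y∈ , ry) (z∈ , rz) (yes x∈) =
        homogeneous (reach-sym ry ◅◅ rz) x∈ (λ r → x∉ (∈-filter⁺ reach? x∈ (ry ◅◅ r)))
      missing : ∀ (reach? : ∀ z → Dec (Reach c M p z)) {u w} → u ∈ M → w ∈ M → ¬ Reach c M u w →
          Any.Any (λ z → ¬ Reach c M p z) M
      missing reach? {u} {w} u∈ w∈ ¬uw with reach? u | reach? w
      ... | no ¬u | _      = lose u∈ ¬u
      ... | yes _ | no ¬w  = lose w∈ ¬w
      ... | yes ru | yes rw = ⊥-elim (¬uw (reach-sym ru ◅◅ rw))

    -- Descent on the length stands in for the choice of a minimal module: a disconnected color
    -- would continue the descent, so all colors that occur may be taken as connected.
    two-colored-module : ∀ {M} → Module M → ¬ ¬ (Σ[ A ∈ List V ] (Module A × TwoColored A))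
    two-colored-module {M} mod k = descend (suc (length M)) mod ℕ.≤-refl
      where
      descend : ∀ ℓ {M} → Module M → length M ℕ.< ℓ → ⊥
      descend (suc ℓ) {M} mod (ℕ.s≤s M≤ℓ) = k (M , mod , α , α , λ x∈ y∈ x≢y → inj₁ (first x∈ y∈ x≢y))
        where
        open Module mod
        α = col a b
        smaller : ∀ {p q} → p ∈ M → q ∈ M → p ≢ q → ¬ ¬ Connected (col p q) M
        smaller p∈ q∈ p≢q ¬conn = smaller-module mod p∈ q∈ p≢q refl ¬conn λ { (A , mod′ , lt) →
            descend ℓ mod′ (ℕ.<-≤-trans lt M≤ℓ) }
        -- The module is claimed to have the one color α. A pair refuting this supplies the second
        -- color, and a third would contradict `three-connected`.
        first : ∀ {x y} → x ∈ M → y ∈ M → x ≢ y → col x y ≡ α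
        first {x} {y} x∈ y∈ x≢y = decidable-stable (col x y Fin.≟ α) λ xy≢α →
          k (M , mod , α , col x y , λ {u} {w} u∈ w∈ u≢w →
            decidable-stable (col u w Fin.≟ α ⊎-dec col u w Fin.≟ col x y) λ neither →
            smaller a∈ b∈ a≢b λ conn₀ → smaller x∈ y∈ x≢y λ conn₁ → smaller u∈ w∈ u≢w λ conn₂ →
            three-connected M unique a∈ b∈ a≢b (xy≢α ∘ sym) (neither ∘ inj₂ ∘ sym)
                (neither ∘ inj₁ ∘ sym) conn₀ conn₁ conn₂)

open GallaiColorings

-- Averages over all small sides.

module GoodSides where

  open import Data.Integer.Base using (_+_; _*_; -_; _-_; _≤_; _<_)

  0≤* : ∀ {a b} → 0ℤ ≤ a → 0ℤ ≤ b → 0ℤ ≤ a * b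
  0≤* {a} {b} a≥0 b≥0 = ℤ.*-monoʳ-≤-nonNeg b {{ℤ.nonNegative b≥0}} a≥0

  0≤+ : ∀ {a b} → 0ℤ ≤ a → 0ℤ ≤ b → 0ℤ ≤ a + b
  0≤+ = ℤ.+-mono-≤

  0≤square : ∀ a → 0ℤ ≤ a * a
  0≤square (+ n)    = 0≤* {+ n} {+ n} (+≤+ ℕ.z≤n) (+≤+ ℕ.z≤n)
  0≤square -[1+ n ] = +≤+ ℕ.z≤n

  ≤⇒0≤- : ∀ {a b} → a ≤ b → 0ℤ ≤ b - a
  ≤⇒0≤- = ℤ.i≤j⇒0≤j-i

  0≤-⇒≤ : ∀ {a b} → 0ℤ ≤ b - a → a ≤ b
  0≤-⇒≤ = ℤ.0≤i-j⇒j≤i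

  ¬0≤negative : ∀ {a n} → 0ℤ ≤ a → 0ℤ ≤ -[1+ n ] - a → ⊥
  ¬0≤negative {a} {n} a≥0 h with ℤ.≤-trans a≥0 (0≤-⇒≤ {a} { -[1+ n ]} h)
  ... | ()

  module Average {A : Set} (_≟_ : DecidableEquality A) (M : List A) (unique : Unique M) (s : A → A → ℤ)
    (s-sym : ∀ a b → s a b ≡ s b a) (s-diagonal : ∀ a → s a a ≡ 0ℤ)
        (s-unit : ∀ {a b} → a ≢ b → ±1 (s a b)) where

    N : ℤ
    N = + length M

    deg : A → ℤ
    deg x = ∑[ y ∈ M ] s x y

    C : ℤ
    C = ∑[ x ∈ M ] (deg x * deg x)

    C≥0 : 0ℤ ≤ C
    C≥0 = ∑-nonneg M (λ x → 0≤square (deg x))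

    c : A → A → ℤ
    c a b = ∑[ x ∈ M ] (s x a * s x b)

    s-square : ∀ a b → s a b * s a b ≡ 1ℤ + -1ℤ * ⟦ b ≟ a ⟧
    s-square a b with b ≟ a
    ... | yes refl = cong₂ _*_ (s-diagonal b) (s-diagonal b)
    ... | no b≢a   = ±1-square (s-unit (b≢a ∘ sym))

    ∑-N : ∀ k → ∑[ x ∈ M ] k ≡ N * k
    ∑-N = ∑-const M

    c-diagonal : ∀ {a} → a ∈ M → c a a ≡ N - 1ℤ
    c-diagonal {a} a∈ = trans (∑-cong M (λ x → trans (cong₂ _*_ (s-sym x a) (s-sym x a)) (s-square a x)))
      (trans (∑-+ M _ _) (cong₂ _+_ (∑-length M) (trans (∑-*ˡ M -1ℤ _)
          (cong (-1ℤ *_) (∑-δ₁ _≟_ unique a∈)))))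

    c-sym : ∀ a b → c a b ≡ c b a
    c-sym a b = ∑-cong M (λ x → ℤ.*-comm (s x a) (s x b))

    -- Grouping pairs of signed edges by their common end x turns codegrees into squared degrees.
    ∑∑-c : ∑[ a ∈ M ] ∑[ b ∈ M ] c a b ≡ C
    ∑∑-c = trans (∑-cong M (λ a → ∑-swap M M (λ b x → s x a * s x b))) (trans (∑-swap M M _)
      (∑-cong M (λ x → sym (∑-product M M (s x) (s x)))))

    -- For distinct a, b and x this is 4 if x is joined to b but not to a by the
    -- sign of ab, and 0 otherwise.
    P : A → A → A → ℤ
    P a b x = (1ℤ - s a b * s x a) * (1ℤ + s a b * s x b)

    deg′ : ∀ a → ∑[ x ∈ M ] s x a ≡ deg a
    deg′ a = ∑-cong M (λ x → s-sym x a)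

    ∑-P : ∀ a b → ∑[ x ∈ M ] P a b x ≡ N + s a b * deg b + -1ℤ *
        (s a b * deg a) + -1ℤ * c a b + ⟦ b ≟ a ⟧ * c a b
    ∑-P a b = trans (∑-cong M (λ x → expand (s x a) (s x b) (s a b)))
      (trans (∑-+ M _ _) (trans (cong₂ _+_ (trans (∑-+ M _ _) (cong₂ _+_ (trans (∑-+ M _ _)
        (cong₂ _+_ (∑-length M) (trans (∑-*ˡ M (s a b) _) (cong (s a b *_) (deg′ b)))))
        (trans (∑-*ˡ M (-1ℤ * s a b) _) (cong (-1ℤ * s a b *_) (deg′ a)))))
        (trans (∑-*ˡ M (-1ℤ * (s a b * s a b)) _) (cong (λ q → -1ℤ * q * c a b) (s-square a b))))
        (collect N (s a b) (deg a) (deg b) (c a b) ⟦ b ≟ a ⟧)))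
      where
      expand : ∀ xa xb ab → (1ℤ - ab * xa) * (1ℤ + ab * xb) ≡ 1ℤ + ab * xb + -1ℤ * ab * xa + -1ℤ *
          (ab * ab) * (xa * xb)
      expand = solve-∀
      collect : ∀ n s d e c i → n + s * e + -1ℤ * s * d + -1ℤ * (1ℤ + -1ℤ * i) * c ≡ n + s * e + -1ℤ *
          (s * d) + -1ℤ * c + i * c
      collect = solve-∀

    -- The two degree terms give C and - C, and the codegrees a further - C. The last summand comes
    -- from b = a, where the factor s² is 0 instead of 1.
    ∑∑-P : ∑[ a ∈ M ] ∑[ b ∈ M ] ∑[ x ∈ M ] P a b x ≡ N * (N * N) - C + N * (N - 1ℤ)
    ∑∑-P = begin
      ∑[ a ∈ M ] ∑[ b ∈ M ] ∑[ x ∈ M ] P a b x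
        ≡⟨ ∑-cong M (λ a → ∑-cong M (λ b → ∑-P a b)) ⟩
      ∑[ a ∈ M ] ∑[ b ∈ M ] (N + s a b * deg b + -1ℤ * (s a b * deg a) + -1ℤ * c a b + ⟦ b ≟ a ⟧ * c a b)
        ≡⟨ ∑-cong-∈ M (λ {a} a∈ → trans (∑-+ M _ _)
            (cong₂ _+_ (trans (∑-+ M _ _) (cong₂ _+_ (trans (∑-+ M _ _) (cong₂ _+_ (trans (∑-+ M _ _)
             (cong₂ _+_ (∑-N N) refl)) (trans (∑-*ˡ M -1ℤ _) (cong (-1ℤ *_) (∑-*ʳ M (s a) (deg a))))))
                 (∑-*ˡ M -1ℤ (c a))))
             (trans (∑-δ _≟_ (c a) unique a∈) (c-diagonal a∈)))) ⟩
      ∑[ a ∈ M ] (N * N + (∑[ b ∈ M ] (s a b * deg b)) + -1ℤ * (deg a * deg a) + -1ℤ *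
          (∑[ b ∈ M ] c a b) + (N - 1ℤ))
        ≡⟨ trans (∑-+ M _ _) (cong₂ _+_ (trans (∑-+ M _ _)
            (cong₂ _+_ (trans (∑-+ M _ _) (cong₂ _+_ (trans (∑-+ M _ _)
             (cong₂ _+_ (∑-N (N * N)) cross)) (∑-*ˡ M -1ℤ _)))
                 (trans (∑-*ˡ M -1ℤ _) (cong (-1ℤ *_) ∑∑-c)))) (∑-N (N - 1ℤ))) ⟩
      N * (N * N) + C + -1ℤ * C + -1ℤ * C + N * (N - 1ℤ)
        ≡⟨ collect N C ⟩
      N * (N * N) - C + N * (N - 1ℤ) ∎
      where
      open ≡-Reasoning
      cross : ∑[ a ∈ M ] ∑[ b ∈ M ] (s a b * deg b) ≡ C
      cross = trans (∑-swap M M _) (∑-cong M (λ b → trans (∑-*ʳ M _ (deg b)) (cong (_* deg b) (deg′ b))))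
      collect : ∀ n c → n * (n * n) + c + -1ℤ * c + -1ℤ * c + n * (n - 1ℤ) ≡ n * (n * n) - c + n * (n - 1ℤ)
      collect = solve-∀

    -- The bound N + 2 on all distinct pairs would make N(1 - N) - C nonnegative, which fails for N
    -- ≥ 2 as C is a sum of squares.
    pair-average : 0ℤ ≤ N - + 2 → ¬ (∀ {a b} → a ∈ M → b ∈ M → a ≢ b → N + + 2 ≤ ∑[ x ∈ M ] P a b x)
    pair-average N≥2 h = ¬0≤negative {L * L + + 3 * L + C} {1}
        (0≤+ (0≤+ (0≤square L) (0≤* {+ 3} {L} (+≤+ ℕ.z≤n) N≥2)) C≥0)
        (subst (0ℤ ≤_) (rearrange N C) (≤⇒0≤- (subst₂ _≤_ lower ∑∑-P
            (∑-mono M (λ a∈ → ∑-mono M (λ b∈ → pointwise a∈ b∈))))))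
      where
      L = N - + 2
      -- For b = a the sign is 0 and every summand is 1, so the sum is N: hence the correction -2.
      pointwise : ∀ {a b} → a ∈ M → b ∈ M → N + + 2 + ⟦ b ≟ a ⟧ * -[1+ 1 ] ≤ ∑[ x ∈ M ] P a b x
      pointwise {a} {b} a∈ b∈ with b ≟ a
      ... | no b≢a = subst (_≤ ∑ M (P a b)) (sym (ℤ.+-identityʳ (N + + 2))) (h a∈ b∈ (b≢a ∘ sym))
      ... | yes refl = ℤ.≤-reflexive (trans (lem N)
          (sym (trans (∑-cong M (λ x → trans (cong (λ q → (1ℤ - q * s x b) * (1ℤ + q * s x b))
          (s-diagonal b)) (lem′ (s x b)))) (∑-length M))))
        where
        lem : ∀ n → n + + 2 + 1ℤ * -[1+ 1 ] ≡ n
        lem = solve-∀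
        lem′ : ∀ q → (1ℤ - 0ℤ * q) * (1ℤ + 0ℤ * q) ≡ 1ℤ
        lem′ = solve-∀
      lower : ∑[ a ∈ M ] ∑[ b ∈ M ] (N + + 2 + ⟦ b ≟ a ⟧ * -[1+ 1 ]) ≡ N * (N * (N + + 2) + -[1+ 1 ])
      lower = trans (∑-cong-∈ M (λ a∈ → trans (∑-+ M _ _)
          (cong₂ _+_ (∑-N (N + + 2)) (∑-δ _≟_ (λ _ → -[1+ 1 ]) unique a∈)))) (∑-N _)
      rearrange : ∀ n c → n * (n * n) - c + n * (n - 1ℤ) - n * (n * (n + + 2) + -[1+ 1 ]) ≡ -[1+ 1 ] -
          ((n - + 2) * (n - + 2) + + 3 * (n - + 2) + c)
      rearrange = solve-∀

    -- For distinct a, b and d, 4 (N − 3) − 2 g a b d counts four times the vertices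
    -- that are bad for a, b, d in either of the two signs (see ∑-w±).
    g : A → A → A → ℤ
    g a b d = c a b + c b d + -1ℤ * (s d a * s d b) + -1ℤ * (s a b * s a d)

    ∑³ : (A → A → A → ℤ) → ℤ
    ∑³ f = ∑[ a ∈ M ] ∑[ b ∈ M ] ∑[ d ∈ M ] f a b d

    ∑³-+ : ∀ f f′ → ∑³ (λ a b d → f a b d + f′ a b d) ≡ ∑³ f + ∑³ f′
    ∑³-+ f f′ = trans (∑-cong M (λ a → trans (∑-cong M (λ b → ∑-+ M (f a b) (f′ a b))) (∑-+ M _ _)))
        (∑-+ M _ _)

    ∑³-*ˡ : ∀ k f → ∑³ (λ a b d → k * f a b d) ≡ k * ∑³ f
    ∑³-*ˡ k f = trans (∑-cong M (λ a → trans (∑-cong M (λ b → ∑-*ˡ M k (f a b))) (∑-*ˡ M k _))) (∑-*ˡ M k _)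

    -- Each of the four terms sums to a multiple of C: twice N C and twice - C.
    ∑³-g : ∑³ g ≡ + 2 * (N - 1ℤ) * C
    ∑³-g = trans (∑³-+ _ _) (trans (cong₂ _+_ (trans (∑³-+ _ _) (cong₂ _+_ (trans (∑³-+ _ _) (cong₂ _+_
        (trans (∑-cong M (λ a → trans (∑-cong M (λ b → ∑-N (c a b))) (∑-*ˡ M N (c a))))
            (trans (∑-*ˡ M N _) (cong (N *_) ∑∑-c)))
        (trans (∑-N _) (cong (N *_) ∑∑-c))))
        (trans (∑³-*ˡ -1ℤ _) (cong (-1ℤ *_) ∑∑-c))))
        (trans (∑³-*ˡ -1ℤ _) (cong (-1ℤ *_) (∑-cong M (λ a → sym (∑-product M M (s a) (s a)))))))
      (collect N C))
      where
      collect : ∀ n c → n * c + n * c + -1ℤ * c + -1ℤ * c ≡ + 2 * (n - 1ℤ) * c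
      collect = solve-∀

    -- Inclusion and exclusion over coincidences among a, b and d; the last summand repairs the
    -- overlap when all three agree.
    h : A → A → A → ℤ
    h a b d = -[1+ 1 ] + ⟦ b ≟ a ⟧ * (N + c a d) + ⟦ d ≟ b ⟧ * (N + c a b) + ⟦ d ≟ a ⟧ * (+ 2 * c a b + + 2)
              + ⟦ b ≟ a ⟧ * (⟦ d ≟ a ⟧ * (+ 2 + -[1+ 3 ] * N))

    -- Subtracting `∑³-g` leaves -2(N - 3)C - 2N(N - 1). The coefficient of C is the reason for
    -- demanding N ≥ 3.
    ∑³-h : ∑³ h ≡ + 4 * C + -[1+ 1 ] * (N * N) + + 2 * N
    ∑³-h = trans (∑³-+ _ _) (trans (cong₂ _+_ (trans (∑³-+ _ _)
        (cong₂ _+_ (trans (∑³-+ _ _) (cong₂ _+_ (trans (∑³-+ _ _) (cong₂ _+_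
        (trans (∑-cong M (λ a → trans (∑-cong M (λ b → ∑-N -[1+ 1 ])) (∑-N _))) (∑-N _))
        (trans (∑-cong-∈ M (λ {a} a∈ → trans (∑-cong M (λ b → ∑-*ˡ M ⟦ b ≟ a ⟧ _))
            (∑-δ _≟_ (λ _ → ∑[ d ∈ M ] (N + c a d)) unique a∈))) ∑N+c)))
        (trans (∑-cong M (λ a → ∑-cong-∈ M (λ {b} b∈ → ∑-δ _≟_ (λ _ → N + c a b) unique b∈))) ∑N+c)))
        (trans (∑-cong-∈ M (λ {a} a∈ → ∑-cong M (λ b → ∑-δ _≟_ (λ _ → + 2 * c a b + + 2) unique a∈)))
               (trans (∑-cong M (λ a → trans (∑-+ M _ _) (cong₂ _+_ (∑-*ˡ M (+ 2) (c a)) (∑-N (+ 2)))))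
                   (trans (∑-+ M _ _) (cong₂ _+_ (trans (∑-*ˡ M (+ 2) _) (cong (+ 2 *_) ∑∑-c)) (∑-N _)))))))
        (trans (∑-cong-∈ M (λ {a} a∈ → trans (∑-cong M
            (λ b → trans (∑-*ˡ M ⟦ b ≟ a ⟧ _) (cong (⟦ b ≟ a ⟧ *_)
            (∑-δ _≟_ (λ _ → + 2 + -[1+ 3 ] * N) unique a∈))))
            (∑-δ _≟_ (λ _ → + 2 + -[1+ 3 ] * N) unique a∈))) (∑-N _)))
      (collect N C))
      where
      ∑N+c : ∑[ a ∈ M ] ∑[ d ∈ M ] (N + c a d) ≡ N * (N * N) + C
      ∑N+c = trans (∑-cong M (λ a → trans (∑-+ M _ _) (cong (_+ ∑ M (c a)) (∑-N N))))
          (trans (∑-+ M _ _) (cong₂ _+_ (∑-N (N * N)) ∑∑-c))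
      collect : ∀ n c → n * (n * (n * -[1+ 1 ])) + (n * (n * n) + c) + (n * (n * n) + c) +
          (+ 2 * c + n * (n * + 2)) + n * (+ 2 + -[1+ 3 ] * n)
                ≡ + 4 * c + -[1+ 1 ] * (n * n) + + 2 * n
      collect = solve-∀

    -- The bound −2 for distinct triples is corrected by h to an equality on the
    -- other ones.
    triple-average : 0ℤ ≤ N - + 3 → ¬ (∀ {a b d} → a ∈ M → b ∈ M → d ∈ M → a ≢ b → b ≢ d → a ≢ d →
        g a b d ≤ -[1+ 1 ])
    triple-average N≥3 bound = ¬0≤negative {+ 2 * (L * C) + + 2 * (L * L) + + 10 * L} {11}
        (0≤+ (0≤+ (0≤* {+ 2} {L * C} (+≤+ ℕ.z≤n) (0≤* N≥3 C≥0))
            (0≤* {+ 2} {L * L} (+≤+ ℕ.z≤n) (0≤square L))) (0≤* {+ 10} {L} (+≤+ ℕ.z≤n) N≥3))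
        (subst (0ℤ ≤_) (rearrange N C) (≤⇒0≤- (subst₂ _≤_ ∑³-g ∑³-h
            (∑-mono M (λ a∈ → ∑-mono M (λ b∈ → ∑-mono M (λ d∈ → pointwise a∈ b∈ d∈)))))))
      where
      L = N - + 3
      rearrange : ∀ n c → + 4 * c + -[1+ 1 ] * (n * n) + + 2 * n - + 2 * (n - 1ℤ) * c ≡ -[1+ 11 ] -
          (+ 2 * ((n - + 3) * c) + + 2 * ((n - + 3) * (n - + 3)) + + 10 * (n - + 3))
      rearrange = solve-∀
      pointwise : ∀ {a b d} → a ∈ M → b ∈ M → d ∈ M → g a b d ≤ h a b d
      pointwise {a} {b} {d} a∈ b∈ d∈ with b ≟ a | d ≟ b | d ≟ a
      ... | yes refl | yes refl | no d≢a = ⊥-elim (d≢a refl)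
      ... | yes refl | no d≢b | yes refl = ⊥-elim (d≢b refl)
      ... | no b≢a | yes refl | yes refl = ⊥-elim (b≢a refl)
      ... | no b≢a | no d≢b | no d≢a = subst (g a b d ≤_) (sym (lem N (c a d) (c a b)))
          (bound a∈ b∈ d∈ (b≢a ∘ sym) (d≢b ∘ sym) (d≢a ∘ sym))
        where
        lem : ∀ n p q → -[1+ 1 ] + 0ℤ * (n + p) + 0ℤ * (n + q) + 0ℤ * (+ 2 * q + + 2) + 0ℤ *
            (0ℤ * (+ 2 + -[1+ 3 ] * n)) ≡ -[1+ 1 ]
        lem = solve-∀
      ... | yes refl | no d≢b | no _ = ℤ.≤-reflexive
          (trans (cong₂ (λ x y → x + c b d + -1ℤ * y + -1ℤ * (s b b * s b d)) (c-diagonal a∈)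
          (±1-square (s-unit d≢b)))
          (trans (cong (λ y → N - 1ℤ + c b d + -1ℤ * 1ℤ + -1ℤ * (y * s b d)) (s-diagonal b))
              (lem N (c b d) (c b b) (s b d))))
        where
        lem : ∀ n p q r → n - 1ℤ + p + -1ℤ * 1ℤ + -1ℤ * (0ℤ * r) ≡
          -[1+ 1 ] + 1ℤ * (n + p) + 0ℤ * (n + q) + 0ℤ * (+ 2 * q + + 2) + 1ℤ * (0ℤ * (+ 2 + -[1+ 3 ] * n))
        lem = solve-∀
      ... | no b≢a | yes refl | no _ = ℤ.≤-reflexive
          (trans (cong₂ (λ x y → c a b + x + -1ℤ * (s b a * y) + -1ℤ * (s a b * s a b)) (c-diagonal b∈)
          (s-diagonal b))
          (trans (cong (λ y → c a b + (N - 1ℤ) + -1ℤ * (s b a * 0ℤ) + -1ℤ * y)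
              (±1-square (s-unit (b≢a ∘ sym)))) (lem N (c a b) (s b a))))
        where
        lem : ∀ n p r → p + (n - 1ℤ) + -1ℤ * (r * 0ℤ) + -1ℤ * 1ℤ ≡
          -[1+ 1 ] + 0ℤ * (n + p) + 1ℤ * (n + p) + 0ℤ * (+ 2 * p + + 2) + 0ℤ * (0ℤ * (+ 2 + -[1+ 3 ] * n))
        lem = solve-∀
      ... | no b≢a | no _ | yes refl = ℤ.≤-reflexive
          (trans (cong₂ (λ x y → c a b + x + -1ℤ * (y * s a b) + -1ℤ * (s a b * y)) (c-sym b a)
          (s-diagonal a)) (lem N (c a b) (c a a) (s a b)))
        where
        lem : ∀ n p q r → p + p + -1ℤ * (0ℤ * r) + -1ℤ * (r * 0ℤ) ≡
          -[1+ 1 ] + 0ℤ * (n + q) + 0ℤ * (n + p) + 1ℤ * (+ 2 * p + + 2) + 0ℤ * (1ℤ * (+ 2 + -[1+ 3 ] * n))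
        lem = solve-∀
      ... | yes refl | yes refl | yes _ = ℤ.≤-reflexive
          (trans (cong (λ y → c a a + c a a + -1ℤ * (y * y) + -1ℤ * (y * y)) (s-diagonal a))
          (trans (lem (c a a)) (trans (cong (λ x → x + x) (c-diagonal a∈))
              (trans (lem′ N) (cong (λ x → -[1+ 1 ] + 1ℤ * (N + x) + 1ℤ * (N + x) + 1ℤ *
              (+ 2 * x + + 2) + 1ℤ * (1ℤ * (+ 2 + -[1+ 3 ] * N))) (sym (c-diagonal a∈)))))))
        where
        lem : ∀ x → x + x + -1ℤ * (0ℤ * 0ℤ) + -1ℤ * (0ℤ * 0ℤ) ≡ x + x
        lem = solve-∀
        lem′ : ∀ n → n - 1ℤ + (n - 1ℤ) ≡ -[1+ 1 ] + 1ℤ * (n + (n - 1ℤ)) + 1ℤ * (n + (n - 1ℤ)) + 1ℤ *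
            (+ 2 * (n - 1ℤ) + + 2) + 1ℤ * (1ℤ * (+ 2 + -[1+ 3 ] * n))
        lem′ = solve-∀

  -- Building orderable and rainbow copies.

  lookup-AllPairs : ∀ {A : Set} {R : A → A → Set} {l : List A} → AllPairs R l → ∀ {i j} →
      toℕ i ℕ.< toℕ j → R (lookup l i) (lookup l j)
  lookup-AllPairs (r ∷ _)  {zero}  {suc j} _           = All.lookup r (∈-lookup j)
  lookup-AllPairs (_ ∷ rs) {suc i} {suc j} (ℕ.s≤s i<j) = lookup-AllPairs rs i<j

  module _ {G : Graph} {C : Set} (χ : EdgeColoring G C) where

    open Graph G
    open EdgeColoring χ

    -- Sorting by rank gives the ordering. Ties are broken arbitrarily, so the hypothesis on colors
    -- includes equal ranks.
    ranked⇒orderable : (l : List V) → Unique l → (∀ v → v ∈ l) → (rank : V → ℕ) (c : V → C) →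
      (∀ {u v} (e : u ~ v) → rank u ℕ.≤ rank v → color e ≡ c u) → Orderable χ
    ranked⇒orderable l unique complete rank c ordered =
      length l′ , mk⤖ (lookup-injective unique′ , λ v →
          index (complete′ v) , λ { refl → sym (lookup-index (complete′ v)) }) ,
      (λ i → c (lookup l′ (inject≤ i _))) ,
      λ i j i<j e → ordered e (lookup-AllPairs sorted (subst (ℕ._< toℕ j) (sym (Fin.toℕ-inject≤ i _)) i<j))
      where
      order = On.decTotalOrder ℕ.≤-decTotalOrder rank
      module Sort = Data.List.Sort order
      l′ = Sort.sort l
      sorted : AllPairs (λ u v → rank u ℕ.≤ rank v) l′
      sorted = Sorted⇒AllPairs (On.totalOrder ℕ.≤-totalOrder rank) (Sort.sort-↗ l)
      unique′ : Unique l′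
      unique′ = Permutationₛ.Unique-resp-↭ (setoid V) (↭⇒↭ₛ (↭-sym (Sort.sort-↭ l))) unique
      complete′ : ∀ v → v ∈ l′
      complete′ v = ∈-resp-↭ (↭-sym (Sort.sort-↭ l)) (complete v)

  sides : ∀ s t → List (Fin s ⊎ Fin t)
  sides s t = map inj₁ (allFin s) ++ map inj₂ (allFin t)

  sides-unique : ∀ s t → Unique (sides s t)
  sides-unique s t = ++⁺ (map⁺ inj₁-injective (allFin⁺ s)) (map⁺ inj₂-injective (allFin⁺ t)) disjoint
    where
    disjoint : ∀ {v} → ¬ (v ∈ map inj₁ (allFin s) × v ∈ map inj₂ (allFin t))
    disjoint (p , q) with ∈-map⁻ inj₁ p | ∈-map⁻ inj₂ q
    ... | _ , _ , refl | _ , _ , ()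

  sides-complete : ∀ s t v → v ∈ sides s t
  sides-complete s t (inj₁ i) = ∈-++⁺ˡ (∈-map⁺ inj₁ (∈-allFin i))
  sides-complete s t (inj₂ j) = ∈-++⁺ʳ (map inj₁ (allFin s)) (∈-map⁺ inj₂ (∈-allFin j))

  module Total {n k : ℕ} (χ : EdgeColoring (K n) (Fin k)) (default : Fin k) where
    open EdgeColoring χ

    col-dec : ∀ {u v : Fin n} → Dec (u ≡ v) → Fin k
    col-dec (yes _)  = default
    col-dec (no u≢v) = color u≢v

    -- The value on the diagonal is junk.
    col : Fin n → Fin n → Fin k
    col u v = col-dec (u Fin.≟ v)

    color-irrelevant : ∀ {u v} (e f : u ≢ v) → color e ≡ color f
    color-irrelevant e f = trans (unordered e (e ∘ sym)) (sym (unordered f (e ∘ sym)))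

    color-col : ∀ {u v} (e : u ≢ v) → color e ≡ col u v
    color-col {u} {v} e with u Fin.≟ v
    ... | yes u≡v = ⊥-elim (e u≡v)
    ... | no u≢v  = color-irrelevant e u≢v

    col-sym : ∀ u v → col u v ≡ col v u
    col-sym u v with u Fin.≟ v | v Fin.≟ u
    ... | yes _   | yes _   = refl
    ... | yes u≡v | no v≢u  = ⊥-elim (v≢u (sym u≡v))
    ... | no u≢v  | yes v≡u = ⊥-elim (u≢v (sym v≡u))
    ... | no u≢v  | no v≢u  = unordered u≢v v≢u

    -- The vertex x is to stand directly before the left vertex number `cut`: earlier left vertices
    -- impose their list colors, and `cʳ` is the list color of x.
    record Cut {s} (left : Fin s → Fin n) (cˡ : Fin s → Fin k) (x : Fin n) : Set where
      field
        cut   : ℕ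
        cʳ    : Fin k
        above : ∀ i → toℕ i ℕ.< cut → col (left i) x ≡ cˡ i
        below : ∀ i → cut ℕ.≤ toℕ i → col (left i) x ≡ cʳ

    orderable-copy : ∀ {s t} (left : Fin s → Fin n) (right : Fin t → Fin n) (cˡ : Fin s → Fin k) →
      Injective _≡_ _≡_ left → Injective _≡_ _≡_ right → (∀ i j → left i ≢ right j) →
      (∀ j → Cut left cˡ (right j)) → ContainsOrderable (Kᵇ s t) χ
    orderable-copy {s} {t} left right cˡ left-inj right-inj apart cuts =
      φ , ranked⇒orderable (inherited φ χ) (sides s t) (sides-unique s t)
          (sides-complete s t) rank c ordered
      where
      open Graph (Kᵇ s t) using (_~_)
      vertex : Fin s ⊎ Fin t → Fin n
      vertex = [ left , right ]′
      vertex-injective : Injective _≡_ _≡_ vertex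
      vertex-injective {inj₁ i} {inj₁ i′} e = cong inj₁ (left-inj e)
      vertex-injective {inj₁ i} {inj₂ j}  e = ⊥-elim (apart i j e)
      vertex-injective {inj₂ j} {inj₁ i}  e = ⊥-elim (apart i j (sym e))
      vertex-injective {inj₂ j} {inj₂ j′} e = cong inj₂ (right-inj e)
      φ : Copy (Kᵇ s t) (K n)
      φ = record
        { vertex    = vertex
        ; injective = vertex-injective
        ; edge      = λ { left-right → apart _ _ ; right-left → apart _ _ ∘ sym }
        }
      -- Left vertices take odd ranks and right ones even ranks, so ties occur only among right
      -- vertices, which are not adjacent.
      rank : Fin s ⊎ Fin t → ℕ
      rank (inj₁ i) = suc (2 ℕ.* toℕ i)
      rank (inj₂ j) = 2 ℕ.* Cut.cut (cuts j)
      c : Fin s ⊎ Fin t → Fin k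
      c (inj₁ i) = cˡ i
      c (inj₂ j) = Cut.cʳ (cuts j)
      ordered : ∀ {u v} (e : u ~ v) → rank u ℕ.≤ rank v → EdgeColoring.color (inherited φ χ) e ≡ c u
      ordered (left-right {i} {j}) h = trans (color-col _) (Cut.above (cuts j) i (ℕ.*-cancelˡ-< 2 _ _ h))
      ordered (right-left {i} {j}) h = trans (color-col _) (trans (col-sym (right j) (left i))
        (Cut.below (cuts j) i (ℕ.≤-pred (ℕ.*-cancelˡ-< 2 _ _
            (ℕ.<-≤-trans (ℕ.s≤s h) (ℕ.≤-reflexive (sym (ℕ.*-suc 2 (toℕ i)))))))))

    NoRainbow : Set
    NoRainbow = ∀ {u v w} → u ≢ v → v ≢ w → u ≢ w →
        col u v ≡ col v w ⊎ col v w ≡ col u w ⊎ col u v ≡ col u w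

    RainbowTriangle : Fin n → Fin n → Fin n → Set
    RainbowTriangle u v w = (u ≢ v × v ≢ w × u ≢ w) ×
        (col u v ≢ col v w × col v w ≢ col u w × col u v ≢ col u w)

    rainbow-copy : ∀ {u v w} → RainbowTriangle u v w → ContainsRainbow (K 3) χ
    rainbow-copy {u} {v} {w} ((u≢v , v≢w , u≢w) , (p , q , r)) = φ , rainbow
      where
      vertex : Fin 3 → Fin n
      vertex 0F = u
      vertex 1F = v
      vertex 2F = w
      vertex-injective : Injective _≡_ _≡_ vertex
      vertex-injective {0F} {0F} e = refl
      vertex-injective {0F} {1F} e = ⊥-elim (u≢v e)
      vertex-injective {0F} {2F} e = ⊥-elim (u≢w e)
      vertex-injective {1F} {0F} e = ⊥-elim (u≢v (sym e))
      vertex-injective {1F} {1F} e = refl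
      vertex-injective {1F} {2F} e = ⊥-elim (v≢w e)
      vertex-injective {2F} {0F} e = ⊥-elim (u≢w (sym e))
      vertex-injective {2F} {1F} e = ⊥-elim (v≢w (sym e))
      vertex-injective {2F} {2F} e = refl
      φ : Copy (K 3) (K n)
      φ = record { vertex = vertex ; injective = vertex-injective ; edge = λ i≢j e →
          i≢j (vertex-injective e) }
      -- An edge of the triangle is named by the vertex off it, so comparing edges becomes comparing
      -- elements of `Fin 3`. The diagonal values are junk.
      opposite : Fin 3 → Fin 3 → Fin 3
      opposite 0F 1F = 2F
      opposite 1F 0F = 2F
      opposite 0F 2F = 1F
      opposite 2F 0F = 1F
      opposite _  _  = 0F
      edge-color : Fin 3 → Fin k
      edge-color 0F = col v w
      edge-color 1F = col u w
      edge-color 2F = col u v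
      edge-color-injective : Injective _≡_ _≡_ edge-color
      edge-color-injective {0F} {0F} e = refl
      edge-color-injective {0F} {1F} e = ⊥-elim (q e)
      edge-color-injective {0F} {2F} e = ⊥-elim (p (sym e))
      edge-color-injective {1F} {0F} e = ⊥-elim (q (sym e))
      edge-color-injective {1F} {1F} e = refl
      edge-color-injective {1F} {2F} e = ⊥-elim (r (sym e))
      edge-color-injective {2F} {0F} e = ⊥-elim (p e)
      edge-color-injective {2F} {1F} e = ⊥-elim (r e)
      edge-color-injective {2F} {2F} e = refl
      color-opposite : ∀ i j → i ≢ j → col (vertex i) (vertex j) ≡ edge-color (opposite i j)
      color-opposite 0F 0F i≢j = ⊥-elim (i≢j refl)
      color-opposite 0F 1F _   = refl
      color-opposite 0F 2F _   = refl
      color-opposite 1F 0F _   = col-sym v u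
      color-opposite 1F 1F i≢j = ⊥-elim (i≢j refl)
      color-opposite 1F 2F _   = refl
      color-opposite 2F 0F _   = col-sym w u
      color-opposite 2F 1F _   = col-sym w v
      color-opposite 2F 2F i≢j = ⊥-elim (i≢j refl)
      opposite-injective : ∀ i j x y → i ≢ j → x ≢ y → opposite i j ≡ opposite x y →
          (i ≡ x × j ≡ y) ⊎ (i ≡ y × j ≡ x)
      opposite-injective = toWitness {a? = Fin.all? λ i → Fin.all? λ j → Fin.all? λ x → Fin.all? λ y →
        ¬? (i Fin.≟ j) →-dec (¬? (x Fin.≟ y) →-dec ((opposite i j Fin.≟ opposite x y) →-dec
        (((i Fin.≟ x) ×-dec (j Fin.≟ y)) ⊎-dec ((i Fin.≟ y) ×-dec (j Fin.≟ x)))))} _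
      rainbow : Rainbow (inherited φ χ)
      rainbow {i} {j} {x} {y} i≢j x≢y different same = different (opposite-injective i j x y i≢j x≢y
        (edge-color-injective (trans (sym (trans (color-col _) (color-opposite i j i≢j)))
            (trans same (trans (color-col _) (color-opposite x y x≢y))))))

    rainbow-or-gallai : ContainsRainbow (K 3) χ ⊎ NoRainbow
    rainbow-or-gallai with Fin.any? (λ u → Fin.any? λ v → Fin.any? λ w →
      (¬? (u Fin.≟ v) ×-dec ¬? (v Fin.≟ w) ×-dec ¬? (u Fin.≟ w)) ×-dec
      (¬? (col u v Fin.≟ col v w) ×-dec ¬? (col v w Fin.≟ col u w) ×-dec ¬? (col u v Fin.≟ col u w)))
    ... | yes (_ , _ , _ , triangle) = inj₁ (rainbow-copy triangle)
    ... | no none = inj₂ gallai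
      where
      gallai : NoRainbow
      gallai {u} {v} {w} u≢v v≢w u≢w with col u v Fin.≟ col v w | col v w Fin.≟ col u w | col u v Fin.≟
          col u w
      ... | yes e | _     | _     = inj₁ e
      ... | no _  | yes e | _     = inj₂ (inj₁ e)
      ... | no _  | no _  | yes e = inj₂ (inj₂ e)
      ... | no p  | no q  | no r  = ⊥-elim (none (u , v , w , (u≢v , v≢w , u≢w) , (p , q , r)))

  ¬rainbow₂ : ∀ {n} (χ : EdgeColoring (K n) (Fin 2)) → ¬ ContainsRainbow (K 3) χ
  ¬rainbow₂ χ (φ , rainbow) = pigeon _ _ _ (rainbow 01≢ 12≢ λ { (inj₁ (() , _)) ; (inj₂ (() , _)) })
    (rainbow 12≢ 02≢ λ { (inj₁ (() , _)) ; (inj₂ (() , _)) })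
        (rainbow 01≢ 02≢ λ { (inj₁ (_ , ())) ; (inj₂ (() , _)) })
    where
    01≢ : _≢_ {A = Fin 3} 0F 1F
    01≢ ()
    12≢ : _≢_ {A = Fin 3} 1F 2F
    12≢ ()
    02≢ : _≢_ {A = Fin 3} 0F 2F
    02≢ ()
    pigeon : ∀ (a b c : Fin 2) → a ≢ b → b ≢ c → a ≢ c → ⊥
    pigeon 0F 0F _  p _ _ = p refl
    pigeon 1F 1F _  p _ _ = p refl
    pigeon _  0F 0F _ q _ = q refl
    pigeon _  1F 1F _ q _ = q refl
    pigeon 0F _  0F _ _ r = r refl
    pigeon 1F _  1F _ _ r = r refl

  -- Upper bounds: small sides with few bad vertices.

  module Upper {n k : ℕ} (χ : EdgeColoring (K n) (Fin k)) (default : Fin k)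
      (gallai : Total.NoRainbow χ default) where

    open Total χ default
    open Gallai col col-sym gallai using (Module; TwoColored; two-colored-module; _∈?_)

    private
      V = Fin n
      vertices = allFin n

    ∑-vertices-1 : ∑[ x ∈ vertices ] 1ℤ ≡ + n
    ∑-vertices-1 = trans (∑-length vertices) (cong +_ (length-tabulate {n = n} id))

    ∑-vertices-δ : ∀ (v : V) → ∑[ x ∈ vertices ] ⟦ x Fin.≟ v ⟧ ≡ 1ℤ
    ∑-vertices-δ v = ∑-δ₁ Fin._≟_ (allFin⁺ n) (∈-allFin v)

    length≤n : ∀ {A : List V} → Unique A → + length A ≤ + n
    length≤n {A} u = subst₂ _≤_ (∑-length A) ∑-vertices-1
      (∑-⊆ Fin._≟_ u (allFin⁺ n) (λ {x} _ → ∈-allFin x) (λ _ → +≤+ ℕ.z≤n))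

    module Choice {s} (left : Fin s → V) {Good : Pred V 0ℓ} (good? : Decidable Good) where

      outside? : ∀ x → Dec (∀ i → left i ≢ x)
      outside? x = Fin.all? (λ i → ¬? (left i Fin.≟ x))

      Bad : V → Set
      Bad x = (∀ i → left i ≢ x) × ¬ Good x

      bad? : Decidable Bad
      bad? x = outside? x ×-dec ¬? (good? x)

      bads : List V
      bads = filter bad? vertices

      private
        usable? : Decidable (λ x → (∀ i → left i ≢ x) × Good x)
        usable? x = outside? x ×-dec good? x
        usables : List V
        usables = filter usable? vertices

      n≤ : + n ≤ + length usables + + length bads + + s
      n≤ = subst₂ _≤_ ∑-vertices-1 total (∑-mono vertices (λ {x} _ → pointwise x))
        where
        weight : V → ℤ
        weight x = ⟦ usable? x ⟧ + ⟦ bad? x ⟧ + (∑[ i ∈ allFin s ] ⟦ x Fin.≟ left i ⟧)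
        total : ∑ vertices weight ≡ + length usables + + length bads + + s
        total = trans (∑-+ vertices _ _) (cong₂ _+_ (trans (∑-+ vertices _ _)
          (cong₂ _+_ (sym (length-filter-∑ usable? vertices)) (sym (length-filter-∑ bad? vertices))))
          (trans (∑-swap vertices (allFin s) _) (trans (∑-cong (allFin s) (λ i → ∑-vertices-δ (left i)))
            (trans (∑-length (allFin s)) (cong +_ (length-tabulate {n = s} id))))))
        pointwise : ∀ x → 1ℤ ≤ weight x
        pointwise x with Fin.any? (λ i → left i Fin.≟ x)
        ... | yes (i , refl) = ℤ.+-mono-≤ (0≤+ (⟦⟧≥0 (usable? x)) (⟦⟧≥0 (bad? x)))
                (ℤ.≤-trans (ℤ.≤-reflexive (sym (∑-δ₁ Fin._≟_ (allFin⁺ s) (∈-allFin i))))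
                    (∑-mono (allFin s) (λ {j} _ → hit j)))
          where
          hit : ∀ j → ⟦ j Fin.≟ i ⟧ ≤ ⟦ left i Fin.≟ left j ⟧
          hit j with j Fin.≟ i
          ... | yes refl = ℤ.≤-reflexive (sym (⟦⟧-true (left i Fin.≟ left i) refl))
          ... | no _     = ⟦⟧≥0 (left i Fin.≟ left j)
        ... | no none = ℤ.+-mono-≤ one (∑-nonneg (allFin s) (λ i → ⟦⟧≥0 (x Fin.≟ left i)))
          where
          outside : ∀ i → left i ≢ x
          outside i e = none (i , e)
          one : 1ℤ ≤ ⟦ usable? x ⟧ + ⟦ bad? x ⟧
          one with good? x
          ... | yes g = ℤ.+-mono-≤ (ℤ.≤-reflexive (sym (⟦⟧-true (outside? x ×-dec yes g) (outside , g))))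
              (⟦⟧≥0 (outside? x ×-dec no (λ ¬g → ¬g g)))
          ... | no ¬g = ℤ.+-mono-≤ (⟦⟧≥0 (outside? x ×-dec no ¬g))
              (ℤ.≤-reflexive (sym (⟦⟧-true (outside? x ×-dec yes ¬g) (outside , ¬g))))

      copy : ∀ {t} (cˡ : Fin s → Fin k) → Injective _≡_ _≡_ left → (∀ {x} → Good x → Cut left cˡ x) →
        t ℕ.+ length bads ℕ.+ s ℕ.≤ n → ContainsOrderable (Kᵇ s t) χ
      copy {t} cˡ left-inj cuts t≤ = orderable-copy left right cˡ left-inj
          (Fin.inject≤-injective t≤usables t≤usables _ _ ∘ lookup-injective (filter⁺ usable? (allFin⁺ n)))
          (λ i j → proj₁ (usable j) i) (λ j → cuts (proj₂ (usable j)))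
        where
        t≤usables : t ℕ.≤ length usables
        t≤usables = ℕ.+-cancelʳ-≤ (length bads) _ _ (ℕ.+-cancelʳ-≤ s _ _ (ℕ.≤-trans t≤ (ℤ.drop‿+≤+ n≤)))
        right : Fin t → V
        right j = lookup usables (inject≤ j t≤usables)
        usable : ∀ j → (∀ i → left i ≢ right j) × Good (right j)
        usable j = proj₂ (∈-filter⁻ usable? {xs = vertices} (∈-lookup (inject≤ j t≤usables)))

      bads-bound : ∀ {A : List V} → Unique A → (∀ {x} → Bad x → x ∈ A) → (w : V → ℤ) → (∀ x → 0ℤ ≤ w x) →
        (∀ {x} → Bad x → + 4 ≤ w x) → + length bads * + 4 ≤ ∑ A w
      bads-bound {A} unique bad∈ w w≥0 w≥4 = subst (_≤ ∑ A w) (∑-const bads (+ 4)) (ℤ.≤-trans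
        (∑-mono bads (λ x∈ → w≥4 (isBad x∈))) (∑-⊆ Fin._≟_ (filter⁺ bad? (allFin⁺ n)) unique
            (bad∈ ∘ isBad) w≥0))
        where
        isBad : ∀ {x} → x ∈ bads → Bad x
        isBad x∈ = proj₂ (∈-filter⁻ bad? {xs = vertices} x∈)

    pair : V → V → Fin 2 → V
    pair a b 0F = a
    pair a b 1F = b

    triple : V → V → V → Fin 3 → V
    triple a b d 0F = a
    triple a b d 1F = b
    triple a b d 2F = d

    -- For the order a, b with list color γ at a: x goes before both or between them.
    Good₂ : V → V → Fin k → V → Set
    Good₂ a b γ x = col x a ≡ col x b ⊎ col x a ≡ γ

    good₂? : ∀ a b γ → Decidable (Good₂ a b γ)
    good₂? a b γ x = (col x a Fin.≟ col x b) ⊎-dec (col x a Fin.≟ γ)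

    -- For the order a, b, d with list colors γ and δ at a and b: the alternatives are the places
    -- before a, before b and before d.
    Good₃ : V → V → V → Fin k → Fin k → V → Set
    Good₃ a b d γ δ x = (col x a ≡ col x b × col x b ≡ col x d) ⊎
        (col x a ≡ γ × (col x b ≡ col x d ⊎ col x b ≡ δ))

    good₃? : ∀ a b d γ δ → Decidable (Good₃ a b d γ δ)
    good₃? a b d γ δ x = ((col x a Fin.≟ col x b) ×-dec (col x b Fin.≟ col x d)) ⊎-dec
                         ((col x a Fin.≟ γ) ×-dec ((col x b Fin.≟ col x d) ⊎-dec (col x b Fin.≟ δ)))

    module Pair a b γ = Choice (pair a b) (good₂? a b γ)
    module Triple a b d γ δ = Choice (triple a b d) (good₃? a b d γ δ)

    pair-copy : ∀ {a b γ t} → a ≢ b → t ℕ.+ length (Pair.bads a b γ) ℕ.+ 2 ℕ.≤ n →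
        ContainsOrderable (Kᵇ 2 t) χ
    pair-copy {a} {b} {γ} a≢b = Pair.copy a b γ (λ _ → γ) pair-injective cut
      where
      pair-injective : Injective _≡_ _≡_ (pair a b)
      pair-injective {0F} {0F} _ = refl
      pair-injective {0F} {1F} e = ⊥-elim (a≢b e)
      pair-injective {1F} {0F} e = ⊥-elim (a≢b (sym e))
      pair-injective {1F} {1F} _ = refl
      cut : ∀ {x} → Good₂ a b γ x → Cut (pair a b) (λ _ → γ) x
      cut {x} (inj₁ e) = record
        { cut = 0 ; cʳ = col x a ; above = λ _ () ; below =
            λ { 0F _ → col-sym a x ; 1F _ → trans (col-sym b x) (sym e) } }
      cut {x} (inj₂ e) = record
        { cut = 1 ; cʳ = col x b
        ; above = λ { 0F _ → trans (col-sym a x) e ; 1F (ℕ.s≤s ()) } ; below =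
            λ { 0F () ; 1F _ → col-sym b x } }

    triple-copy : ∀ {a b d γ δ t} → a ≢ b → b ≢ d → a ≢ d →
        t ℕ.+ length (Triple.bads a b d γ δ) ℕ.+ 3 ℕ.≤ n → ContainsOrderable (Kᵇ 3 t) χ
    triple-copy {a} {b} {d} {γ} {δ} a≢b b≢d a≢d = Triple.copy a b d γ δ c triple-injective cut
      where
      c : Fin 3 → Fin k
      c 0F = γ
      -- The value at the last left vertex is a filler, as no cut exceeds 2.
      c _  = δ
      triple-injective : Injective _≡_ _≡_ (triple a b d)
      triple-injective {0F} {0F} _ = refl
      triple-injective {0F} {1F} e = ⊥-elim (a≢b e)
      triple-injective {0F} {2F} e = ⊥-elim (a≢d e)
      triple-injective {1F} {0F} e = ⊥-elim (a≢b (sym e))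
      triple-injective {1F} {1F} _ = refl
      triple-injective {1F} {2F} e = ⊥-elim (b≢d e)
      triple-injective {2F} {0F} e = ⊥-elim (a≢d (sym e))
      triple-injective {2F} {1F} e = ⊥-elim (b≢d (sym e))
      triple-injective {2F} {2F} _ = refl
      cut : ∀ {x} → Good₃ a b d γ δ x → Cut (triple a b d) c x
      cut {x} (inj₁ (e , e′)) = record
        { cut = 0 ; cʳ = col x a ; above = λ _ ()
        ; below = λ { 0F _ → col-sym a x ; 1F _ → trans (col-sym b x) (sym e) ; 2F _ →
            trans (col-sym d x) (sym (trans e e′)) } }
      cut {x} (inj₂ (e , inj₁ e′)) = record
        { cut = 1 ; cʳ = col x b
        ; above = λ { 0F _ → trans (col-sym a x) e ; 1F (ℕ.s≤s ()) ; 2F (ℕ.s≤s ()) }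
        ; below = λ { 0F () ; 1F _ → col-sym b x ; 2F _ → trans (col-sym d x) (sym e′) } }
      cut {x} (inj₂ (e , inj₂ e′)) = record
        { cut = 2 ; cʳ = col x d
        ; above = λ { 0F _ → trans (col-sym a x) e ; 1F _ → trans (col-sym b x) e′ ; 2F (ℕ.s≤s (ℕ.s≤s ())) }
        ; below = λ { 0F () ; 1F (ℕ.s≤s ()) ; 2F _ → col-sym d x } }

    -- For n = 4μ + 2 at most μ vertices are bad, and 3μ + μ + 2 = n.
    Target₂ : Set
    Target₂ = ∃[ a ] ∃[ b ] ∃[ γ ] (a ≢ b × 4 ℕ.* length (Pair.bads a b γ) ℕ.< n)

    target₂? : Dec Target₂
    target₂? = Fin.any? λ a → Fin.any? λ b → Fin.any? λ γ →
        ¬? (a Fin.≟ b) ×-dec (4 ℕ.* length (Pair.bads a b γ) ℕ.<? n)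

    -- For n = 4μ + 2 at most 2μ - 1 vertices are bad, and 2μ + (2μ - 1) + 3 = n.
    Target₃ : Set
    Target₃ = ∃[ a ] ∃[ b ] ∃[ d ] ∃[ γ ] ∃[ δ ] ((a ≢ b × b ≢ d × a ≢ d) × 2 ℕ.* length
        (Triple.bads a b d γ δ) ℕ.+ 2 ℕ.< n)

    target₃? : Dec Target₃
    target₃? = Fin.any? λ a → Fin.any? λ b → Fin.any? λ d → Fin.any? λ γ → Fin.any? λ δ →
      (¬? (a Fin.≟ b) ×-dec ¬? (b Fin.≟ d) ×-dec ¬? (a Fin.≟ d)) ×-dec
          (2 ℕ.* length (Triple.bads a b d γ δ) ℕ.+ 2 ℕ.<? n)

    whole : ∀ {a b : V} → a ≢ b → Module vertices
    whole {a} {b} a≢b = record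
      { unique = allFin⁺ n ; a∈ = ∈-allFin a ; b∈ = ∈-allFin b ; a≢b = a≢b
      ; uniform = λ {x} x∉ → ⊥-elim (x∉ (∈-allFin x)) }

    module Signs {A : List V} (mod : Module A) (α β : Fin k)
      (two : ∀ {x y} → x ∈ A → y ∈ A → x ≢ y → col x y ≡ α ⊎ col x y ≡ β) where

      open Module mod using (unique; uniform)

      -- Every color other than α counts as -1. The sign therefore determines the color only inside
      -- the module, where β is the sole alternative.
      ζ : Fin k → ℤ
      ζ c with c Fin.≟ α
      ... | yes _ = 1ℤ
      ... | no _  = -1ℤ

      ζ-unit : ∀ c → ±1 (ζ c)
      ζ-unit c with c Fin.≟ α
      ... | yes _ = inj₁ refl
      ... | no _  = inj₂ refl

      κ : ℤ → Fin k
      κ σ with σ ℤ.≟ 1ℤ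
      ... | yes _ = α
      ... | no _  = β

      κ-ζ : ∀ {c} → c ≡ α ⊎ c ≡ β → c ≡ κ (ζ c)
      κ-ζ {c} h with c Fin.≟ α
      κ-ζ h          | yes e = e
      κ-ζ (inj₁ e)   | no ne = ⊥-elim (ne e)
      κ-ζ (inj₂ e)   | no _  = e

      sign-dec : ∀ {x y : V} → Dec (x ≡ y) → ℤ
      sign-dec         (yes _) = 0ℤ
      sign-dec {x} {y} (no _)  = ζ (col x y)

      s : V → V → ℤ
      s x y = sign-dec {x} {y} (x Fin.≟ y)

      s-ζ : ∀ {x y} → x ≢ y → s x y ≡ ζ (col x y)
      s-ζ {x} {y} x≢y = go (x Fin.≟ y)
        where
        go : ∀ d → sign-dec {x} {y} d ≡ ζ (col x y)
        go (yes e) = ⊥-elim (x≢y e)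
        go (no _)  = refl

      s-diagonal : ∀ x → s x x ≡ 0ℤ
      s-diagonal x with x Fin.≟ x
      ... | yes _ = refl
      ... | no ne = ⊥-elim (ne refl)

      s-unit : ∀ {x y} → x ≢ y → ±1 (s x y)
      s-unit {x} {y} x≢y = subst ±1 (sym (s-ζ x≢y)) (ζ-unit (col x y))

      s-sym : ∀ x y → s x y ≡ s y x
      s-sym x y = go (x Fin.≟ y)
        where
        go : Dec (x ≡ y) → s x y ≡ s y x
        go (yes refl) = refl
        go (no x≢y)   = trans (s-ζ x≢y) (trans (cong ζ (col-sym x y)) (sym (s-ζ (x≢y ∘ sym))))

      col-κ : ∀ {x y} → x ∈ A → y ∈ A → x ≢ y → col x y ≡ κ (s x y)
      col-κ x∈ y∈ x≢y = trans (κ-ζ (two x∈ y∈ x≢y)) (cong κ (sym (s-ζ x≢y)))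

      same : ∀ {x y u v} → x ∈ A → y ∈ A → x ≢ y → u ∈ A → v ∈ A → u ≢ v → s x y ≡ s u v → col x y ≡ col u v
      same x∈ y∈ x≢y u∈ v∈ u≢v e = trans (col-κ x∈ y∈ x≢y) (trans (cong κ e) (sym (col-κ u∈ v∈ u≢v)))

      open Average Fin._≟_ A unique s s-sym s-diagonal s-unit

      nonneg-discord : ∀ {γ p q} → ±1 γ → ±1 p → ±1 q → 0ℤ ≤ (1ℤ - γ * p) * (1ℤ + γ * q)
      nonneg-discord γ± p± q± with discord-values γ± p± q±
      ... | inj₁ (_ , e) = subst (0ℤ ≤_) (sym e) (+≤+ ℕ.z≤n)
      ... | inj₂ (_ , e) = subst (0ℤ ≤_) (sym e) (+≤+ ℕ.z≤n)

      discord-4 : ∀ {γ p q} → ±1 γ → ±1 p → ±1 q → Discord γ p q → + 4 ≤ (1ℤ - γ * p) * (1ℤ + γ * q)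
      discord-4 γ± p± q± bad with discord-values γ± p± q±
      ... | inj₁ (_ , e)    = ℤ.≤-reflexive (sym e)
      ... | inj₂ (¬bad , _) = ⊥-elim (¬bad bad)

      -- With γ the color of ab, bad vertices lie in the module and contribute 4 each to `P`, while
      -- a contributes 2. If every pair had at least n / 4 bad vertices, each sum of `P` would be at
      -- least N + 2, against `pair-average`.
      target₂ : ¬ ¬ Target₂
      target₂ ¬target = pair-average N≥2 λ a∈ b∈ a≢b → bound a∈ b∈ a≢b
        where
        open Module mod using (a∈; b∈; a≢b)
        N≥2 : 0ℤ ≤ N - + 2
        N≥2 = ≤⇒0≤- (subst (+ 2 ≤_) (∑-length A)
          (∑-⊆ Fin._≟_ {w = λ _ → 1ℤ} ((a≢b ∷ []) ∷ [] ∷ []) unique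
              (λ { (here refl) → a∈ ; (there (here refl)) → b∈ }) (λ _ → +≤+ ℕ.z≤n)))
        bound : ∀ {a b} → a ∈ A → b ∈ A → a ≢ b → N + + 2 ≤ ∑[ x ∈ A ] P a b x
        bound {a} {b} a∈ b∈ a≢b = subst (N + + 2 ≤_) (trans (cong (_+ + 2) total) (lem (∑ A (P a b))))
            (ℤ.+-monoˡ-≤ (+ 2) (ℤ.≤-trans (ℤ.≤-trans (length≤n unique)
                (subst (+ n ≤_) (trans (ℤ.pos-* 4 (length bads)) (ℤ.*-comm (+ 4) (+ length bads)))
                (+≤+ (ℕ.≮⇒≥ λ lt → ¬target (a , b , col a b , a≢b , lt)))))
              (bads-bound unique bad∈ w w≥0 w≥4)))
          where
          open Pair a b (col a b)
          w : V → ℤ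
          -- `P` is 2 at a and 0 at b, so only a needs a correction.
          w x = P a b x + ⟦ x Fin.≟ a ⟧ * -[1+ 1 ]
          total : ∑ A w ≡ ∑ A (P a b) + -[1+ 1 ]
          total = trans (∑-+ A _ _) (cong (_+_ (∑ A (P a b))) (∑-δ Fin._≟_ (λ _ → -[1+ 1 ]) unique a∈))
          lem : ∀ p → p + -[1+ 1 ] + + 2 ≡ p
          lem = solve-∀
          w≥0 : ∀ x → 0ℤ ≤ w x
          w≥0 x = go (x Fin.≟ a) (x Fin.≟ b)
            where
            at : ∀ {i} → ⟦ x Fin.≟ a ⟧ ≡ i → 0ℤ ≤ P a b x + i * -[1+ 1 ] → 0ℤ ≤ w x
            at refl h = h
            at-a : ∀ q → (1ℤ - q * 0ℤ) * (1ℤ + 1ℤ) + 1ℤ * -[1+ 1 ] ≡ 0ℤ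
            at-a = solve-∀
            at-b : ∀ q → (1ℤ - 1ℤ) * (1ℤ + q * 0ℤ) + 0ℤ * -[1+ 1 ] ≡ 0ℤ
            at-b = solve-∀
            go : Dec (x ≡ a) → Dec (x ≡ b) → 0ℤ ≤ w x
            go (yes refl) _ = at (⟦⟧-true (a Fin.≟ a) refl) (ℤ.≤-reflexive (sym
              (trans (cong₂ (λ p q → (1ℤ - s a b * p) * (1ℤ + q) + 1ℤ * -[1+ 1 ]) (s-diagonal a)
                  (±1-square (s-unit a≢b))) (at-a (s a b)))))
            go (no b≢a) (yes refl) = at (⟦⟧-false (b Fin.≟ a) b≢a) (ℤ.≤-reflexive (sym
              (trans (cong₂ (λ p q → (1ℤ - p) * (1ℤ + s a b * q) + 0ℤ * -[1+ 1 ])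
                  (trans (cong (s a b *_) (s-sym b a)) (±1-square (s-unit a≢b))) (s-diagonal b))
                  (at-b (s a b)))))
            go (no x≢a) (no x≢b) = at (⟦⟧-false (x Fin.≟ a) x≢a)
                (subst (0ℤ ≤_) (sym (ℤ.+-identityʳ _))
                (nonneg-discord (s-unit a≢b) (s-unit x≢a) (s-unit x≢b)))
          bad∈ : ∀ {x} → Bad x → x ∈ A
          bad∈ {x} (_ , ¬good) with x ∈? A
          ... | yes x∈ = x∈
          ... | no x∉  = ⊥-elim (¬good (inj₁ (uniform x∉ a∈ b∈)))
          w≥4 : ∀ {x} → Bad x → + 4 ≤ w x
          w≥4 {x} bad@(out , ¬good) = subst (+ 4 ≤_)
              (sym (trans (cong (λ i → P a b x + i * -[1+ 1 ]) (⟦⟧-false (x Fin.≟ a) x≢a))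
              (ℤ.+-identityʳ (P a b x))))
              (discord-4 (s-unit a≢b) (s-unit x≢a) (s-unit x≢b)
                  (xa , trans (±1-≢ (s-unit x≢b) (s-unit x≢a) (xa≢xb ∘ sym))
                  (trans (cong -_ xa) (ℤ.neg-involutive _))))
            where
            x≢a = out 0F ∘ sym
            x≢b = out 1F ∘ sym
            xa : s x a ≡ - s a b
            xa = ±1-≢ (s-unit x≢a) (s-unit a≢b) (λ e → ¬good (inj₂ (same (bad∈ bad) a∈ x≢a a∈ b∈ a≢b e)))
            xa≢xb : s x a ≢ s x b
            xa≢xb e = ¬good (inj₁ (same (bad∈ bad) a∈ x≢a (bad∈ bad) b∈ x≢b e))

      module _ {a b d} (a∈ : a ∈ A) (b∈ : b ∈ A) (d∈ : d ∈ A) (a≢b : a ≢ b) (b≢d : b ≢ d)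
          (a≢d : a ≢ d) where

        p : ℤ → V → ℤ
        p σ x = (1ℤ - σ * s x a) * (1ℤ + σ * s x b) + (1ℤ - σ * s x b) * (1ℤ + σ * s x d)

        w : ℤ → V → ℤ
        w σ x = p σ x + ⟦ x Fin.≟ a ⟧ * - p σ a + ⟦ x Fin.≟ b ⟧ * - p σ b + ⟦ x Fin.≟ d ⟧ * - p σ d

        ∑-w : ∀ σ → ∑ A (w σ) ≡ ∑ A (p σ) + - p σ a + - p σ b + - p σ d
        ∑-w σ = trans (∑-+ A _ _) (cong₂ _+_ (trans (∑-+ A _ _)
            (cong₂ _+_ (trans (∑-+ A _ _) (cong (_+_ (∑ A (p σ)))
          (∑-δ Fin._≟_ (λ _ → - p σ a) unique a∈))) (∑-δ Fin._≟_ (λ _ → - p σ b) unique b∈)))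
              (∑-δ Fin._≟_ (λ _ → - p σ d) unique d∈))

        w-outside : ∀ σ {x} → x ≢ a → x ≢ b → x ≢ d → w σ x ≡ p σ x
        w-outside σ {x} x≢a x≢b x≢d rewrite ⟦⟧-false (x Fin.≟ a) x≢a | ⟦⟧-false (x Fin.≟ b) x≢b | ⟦⟧-false
            (x Fin.≟ d) x≢d = lem (p σ x) (- p σ a) (- p σ b) (- p σ d)
          where
          lem : ∀ e f g h → e + 0ℤ * f + 0ℤ * g + 0ℤ * h ≡ e
          lem = solve-∀

        w≥0 : ∀ {σ} → ±1 σ → ∀ x → 0ℤ ≤ w σ x
        w≥0 {σ} σ± x = go (x Fin.≟ a) (x Fin.≟ b) (x Fin.≟ d)
          where
          lem₁ : ∀ e f g → e + 1ℤ * - e + 0ℤ * f + 0ℤ * g ≡ 0ℤ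
          lem₁ = solve-∀
          lem₂ : ∀ e f g → e + 0ℤ * f + 1ℤ * - e + 0ℤ * g ≡ 0ℤ
          lem₂ = solve-∀
          lem₃ : ∀ e f g → e + 0ℤ * f + 0ℤ * g + 1ℤ * - e ≡ 0ℤ
          lem₃ = solve-∀
          at : ∀ {i j l} → ⟦ x Fin.≟ a ⟧ ≡ i → ⟦ x Fin.≟ b ⟧ ≡ j → ⟦ x Fin.≟ d ⟧ ≡ l →
            p σ x + i * - p σ a + j * - p σ b + l * - p σ d ≡ 0ℤ → 0ℤ ≤ w σ x
          at refl refl refl e = ℤ.≤-reflexive (sym e)
          go : Dec (x ≡ a) → Dec (x ≡ b) → Dec (x ≡ d) → 0ℤ ≤ w σ x
          go (yes refl) _ _ = at (⟦⟧-true (a Fin.≟ a) refl) (⟦⟧-false (a Fin.≟ b) a≢b)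
              (⟦⟧-false (a Fin.≟ d) a≢d) (lem₁ (p σ a) (- p σ b) (- p σ d))
          go _ (yes refl) _ = at (⟦⟧-false (b Fin.≟ a) (a≢b ∘ sym)) (⟦⟧-true (b Fin.≟ b) refl)
              (⟦⟧-false (b Fin.≟ d) b≢d) (lem₂ (p σ b) (- p σ a) (- p σ d))
          go _ _ (yes refl) = at (⟦⟧-false (d Fin.≟ a) (a≢d ∘ sym)) (⟦⟧-false (d Fin.≟ b) (b≢d ∘ sym))
              (⟦⟧-true (d Fin.≟ d) refl) (lem₃ (p σ d) (- p σ a) (- p σ b))
          go (no x≢a) (no x≢b) (no x≢d) = subst (0ℤ ≤_) (sym (w-outside σ x≢a x≢b x≢d))
            (0≤+ (nonneg-discord σ± (s-unit x≢a) (s-unit x≢b))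
                (nonneg-discord σ± (s-unit x≢b) (s-unit x≢d)))

        -- A vertex is bad only if its signs to a, b, d, read in this order, change from - σ to σ
        -- somewhere; each such change contributes 4. Without one, the signs fit a cut with both
        -- list colors `κ σ`.
        bads-w : ∀ {σ} → ±1 σ → + length (Triple.bads a b d (κ σ) (κ σ)) * + 4 ≤ ∑ A (w σ)
        bads-w {σ} σ± = bads-bound unique bad∈ (w σ) (w≥0 σ±) w≥4
          where
          open Triple a b d (κ σ) (κ σ)
          bad∈ : ∀ {x} → Bad x → x ∈ A
          bad∈ {x} (_ , ¬good) with x ∈? A
          ... | yes x∈ = x∈
          ... | no x∉  = ⊥-elim (¬good (inj₁ (uniform x∉ a∈ b∈ , uniform x∉ b∈ d∈)))
          w≥4 : ∀ {x} → Bad x → + 4 ≤ w σ x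
          w≥4 {x} bad@(out , ¬good) = subst (+ 4 ≤_) (sym (w-outside σ x≢a x≢b x≢d))
              (go (s x a ℤ.≟ σ) (s x b ℤ.≟ σ) (s x d ℤ.≟ σ))
            where
            x∈ = bad∈ bad
            x≢a = out 0F ∘ sym
            x≢b = out 1F ∘ sym
            x≢d = out 2F ∘ sym
            listed : ∀ {y} → y ∈ A → x ≢ y → s x y ≡ σ → col x y ≡ κ σ
            listed y∈ x≢y e = trans (col-κ x∈ y∈ x≢y) (cong κ e)
            other : ∀ {y} → x ≢ y → s x y ≢ σ → s x y ≡ - σ
            other x≢y = ±1-≢ (s-unit x≢y) σ±
            equal : ∀ {y z} → y ∈ A → z ∈ A → x ≢ y → x ≢ z → s x y ≢ σ → s x z ≢ σ → col x y ≡ col x z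
            equal y∈ z∈ x≢y x≢z y≢σ z≢σ = same x∈ y∈ x≢y x∈ z∈ x≢z
                (trans (other x≢y y≢σ) (sym (other x≢z z≢σ)))
            go : Dec (s x a ≡ σ) → Dec (s x b ≡ σ) → Dec (s x d ≡ σ) → + 4 ≤ p σ x
            go (yes xa) (yes xb) _ = ⊥-elim (¬good (inj₂ (listed a∈ x≢a xa , inj₂ (listed b∈ x≢b xb))))
            go (no xa) (yes xb) _ = subst (_≤ p σ x) (ℤ.+-identityʳ (+ 4)) (ℤ.+-mono-≤
              (discord-4 σ± (s-unit x≢a) (s-unit x≢b) (other x≢a xa , xb))
                  (nonneg-discord σ± (s-unit x≢b) (s-unit x≢d)))
            go _ (no xb) (yes xd) = subst (_≤ p σ x) (ℤ.+-identityˡ (+ 4)) (ℤ.+-mono-≤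
              (nonneg-discord σ± (s-unit x≢a) (s-unit x≢b))
                  (discord-4 σ± (s-unit x≢b) (s-unit x≢d) (other x≢b xb , xd)))
            go (yes xa) (no xb) (no xd) = ⊥-elim (¬good
                (inj₂ (listed a∈ x≢a xa , inj₁ (equal b∈ d∈ x≢b x≢d xb xd))))
            go (no xa) (no xb) (no xd) = ⊥-elim (¬good
                (inj₁ (equal a∈ b∈ x≢a x≢b xa xb , equal b∈ d∈ x≢b x≢d xb xd)))

        -- Adding the two choices of σ cancels the terms linear in the signs, so no degrees survive,
        -- only codegrees and the values at a, b and d.
        ∑-w± : ∑ A (w 1ℤ) + ∑ A (w -1ℤ) ≡ + 4 * N - + 12 - + 2 * g a b d
        ∑-w± = trans (cong₂ _+_ (∑-w 1ℤ) (∑-w -1ℤ))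
            (trans (regroup (∑ A (p 1ℤ)) (∑ A (p -1ℤ)) (p 1ℤ a) (p 1ℤ b) (p 1ℤ d) (p -1ℤ a) (p -1ℤ b)
            (p -1ℤ d))
          (trans (cong₂ _-_ (trans (sym (∑-+ A _ _))
              (trans (∑-cong A p±) (trans (∑-+ A _ _)
              (cong₂ _+_ (trans (∑-+ A _ _) (cong₂ _+_ (∑-N (+ 4)) (∑-*ˡ A -[1+ 1 ] _)))
              (∑-*ˡ A -[1+ 1 ] _)))))
            (trans (cong₂ _+_ (cong₂ _+_ (p± a) (p± b)) (p± d)) points))
            (collect N (c a b) (c b d) (s d a * s d b) (s a b * s a d))))
          where
          regroup : ∀ S T a b d a′ b′ d′ → S + - a + - b + - d + (T + - a′ + - b′ + - d′) ≡ S + T -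
              ((a + a′) + (b + b′) + (d + d′))
          regroup = solve-∀
          expand : ∀ u v r → (1ℤ - 1ℤ * u) * (1ℤ + 1ℤ * v) + (1ℤ - 1ℤ * v) * (1ℤ + 1ℤ * r) +
              ((1ℤ - -1ℤ * u) * (1ℤ + -1ℤ * v) + (1ℤ - -1ℤ * v) * (1ℤ + -1ℤ * r))
                   ≡ + 4 + -[1+ 1 ] * (u * v) + -[1+ 1 ] * (v * r)
          expand = solve-∀
          p± : ∀ x → p 1ℤ x + p -1ℤ x ≡ + 4 + -[1+ 1 ] * (s x a * s x b) + -[1+ 1 ] * (s x b * s x d)
          p± x = expand (s x a) (s x b) (s x d)
          lem : ∀ ab ad ba bd da db → (+ 4 + -[1+ 1 ] * (0ℤ * ab) + -[1+ 1 ] * (ab * ad)) +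
              (+ 4 + -[1+ 1 ] * (ba * 0ℤ) + -[1+ 1 ] * (0ℤ * bd)) +
              (+ 4 + -[1+ 1 ] * (da * db) + -[1+ 1 ] * (db * 0ℤ))
                ≡ + 12 + -[1+ 1 ] * (da * db) + -[1+ 1 ] * (ab * ad)
          lem = solve-∀
          points : (+ 4 + -[1+ 1 ] * (s a a * s a b) + -[1+ 1 ] * (s a b * s a d)) +
              (+ 4 + -[1+ 1 ] * (s b a * s b b) + -[1+ 1 ] * (s b b * s b d)) +
              (+ 4 + -[1+ 1 ] * (s d a * s d b) + -[1+ 1 ] * (s d b * s d d))
                ≡ + 12 + -[1+ 1 ] * (s d a * s d b) + -[1+ 1 ] * (s a b * s a d)
          points rewrite s-diagonal a | s-diagonal b | s-diagonal d =
              lem (s a b) (s a d) (s b a) (s b d) (s d a) (s d b)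
          collect : ∀ n c c′ u v → n * + 4 + -[1+ 1 ] * c + -[1+ 1 ] * c′ -
              (+ 12 + -[1+ 1 ] * u + -[1+ 1 ] * v) ≡ + 4 * n - + 12 - + 2 * (c + c′ + -1ℤ * u + -1ℤ * v)
          collect = solve-∀

        -- Without a target, 4 times the bad vertices is at least 2N - 4 for either sign; together
        -- 4N - 8 ≤ 4N - 12 - 2g.
        g≤-2 : ¬ Target₃ → g a b d ≤ -[1+ 1 ]
        g≤-2 ¬target = ℤ.*-cancelˡ-≤-pos (g a b d) -[1+ 1 ] (+ 2) (0≤-⇒≤ (subst (0ℤ ≤_) (lem N (g a b d))
            (≤⇒0≤- (ℤ.≤-trans (ℤ.+-mono-≤ (many 1ℤ) (many -1ℤ))
                (ℤ.≤-trans (ℤ.+-mono-≤ (bads-w (inj₁ refl)) (bads-w (inj₂ refl))) (ℤ.≤-reflexive ∑-w±))))))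
          where
          lem : ∀ n g → + 4 * n - + 12 - + 2 * g -
              ((+ 2 * n - + 4) + (+ 2 * n - + 4)) ≡ + 2 * -[1+ 1 ] - + 2 * g
          lem = solve-∀
          many : ∀ σ → + 2 * N - + 4 ≤ + length (Triple.bads a b d (κ σ) (κ σ)) * + 4
          many σ = 0≤-⇒≤ (subst (0ℤ ≤_) (lem′ N (+ L)) (0≤* {+ 2} (+≤+ ℕ.z≤n) (≤⇒0≤- N≤)))
            where
            L = length (Triple.bads a b d (κ σ) (κ σ))
            lem′ : ∀ n l → + 2 * (+ 2 * l + + 2 - n) ≡ l * + 4 - (+ 2 * n - + 4)
            lem′ = solve-∀
            N≤ : N ≤ + 2 * + L + + 2
            N≤ = ℤ.≤-trans (length≤n unique) (subst (+ n ≤_) (cong (_+ + 2) (ℤ.pos-* 2 L))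
                (+≤+ (ℕ.≮⇒≥ λ lt → ¬target (a , b , d , κ σ , κ σ , (a≢b , b≢d , a≢d) , lt))))

      target₃-large : 0ℤ ≤ N - + 3 → ¬ ¬ Target₃
      target₃-large N≥3 ¬target = triple-average N≥3 λ a∈ b∈ d∈ a≢b b≢d a≢d →
          g≤-2 a∈ b∈ d∈ a≢b b≢d a≢d ¬target

    -- Twins a and b are followed or preceded by an arbitrary third vertex d, with
    -- the color δ of d a in the list; no vertex is bad for both orders.
    module _ {a b d : V} (a≢b : a ≢ b) (b≢d : b ≢ d) (a≢d : a ≢ d)
        (twins : ∀ {x} → x ≢ a → x ≢ b → col x a ≡ col x b) where

      private
        δ = col d a
        module D = Triple d a b δ δ
        module E = Triple a b d δ δ

      bads-disjoint : + length D.bads + + length E.bads + + 3 ≤ + n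
      bads-disjoint = subst₂ _≤_ total ∑-vertices-1 (∑-mono vertices (λ {x} _ → pointwise x))
        where
        total : ∑[ x ∈ vertices ] (⟦ D.bad? x ⟧ + ⟦ E.bad? x ⟧ +
            (⟦ x Fin.≟ a ⟧ + ⟦ x Fin.≟ b ⟧ + ⟦ x Fin.≟ d ⟧)) ≡ + length D.bads + + length E.bads + + 3
        total = trans (∑-+ vertices _ _) (cong₂ _+_
            (trans (∑-+ vertices _ _) (cong₂ _+_ (sym (length-filter-∑ D.bad? vertices))
            (sym (length-filter-∑ E.bad? vertices))))
          (trans (∑-+ vertices _ _) (cong₂ _+_ (trans (∑-+ vertices _ _)
              (cong₂ _+_ (∑-vertices-δ a) (∑-vertices-δ b))) (∑-vertices-δ d))))
        weight : ℤ → ℤ → ℤ → ℤ → ℤ → Set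
        weight i j a b d = i + j + (a + b + d) ≤ 1ℤ
        pointwise : ∀ x → weight ⟦ D.bad? x ⟧ ⟦ E.bad? x ⟧ ⟦ x Fin.≟ a ⟧ ⟦ x Fin.≟ b ⟧ ⟦ x Fin.≟ d ⟧
        pointwise x = go (x Fin.≟ a) (x Fin.≟ b) (x Fin.≟ d)
          where
          at : ∀ {i j l m n} → ⟦ D.bad? x ⟧ ≡ i → ⟦ E.bad? x ⟧ ≡ j → ⟦ x Fin.≟ a ⟧ ≡ l →
              ⟦ x Fin.≟ b ⟧ ≡ m → ⟦ x Fin.≟ d ⟧ ≡ n →
            weight i j l m n → weight ⟦ D.bad? x ⟧ ⟦ E.bad? x ⟧ ⟦ x Fin.≟ a ⟧ ⟦ x Fin.≟ b ⟧ ⟦ x Fin.≟ d ⟧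
          at refl refl refl refl refl h = h
          go : Dec (x ≡ a) → Dec (x ≡ b) → Dec (x ≡ d) → _
          go (yes refl) _ _ = at (⟦⟧-false (D.bad? x) (λ h → proj₁ h 1F refl))
              (⟦⟧-false (E.bad? x) (λ h → proj₁ h 0F refl))
            (⟦⟧-true (x Fin.≟ x) refl) (⟦⟧-false (x Fin.≟ b) a≢b) (⟦⟧-false (x Fin.≟ d) a≢d) ℤ.≤-refl
          go _ (yes refl) _ = at (⟦⟧-false (D.bad? x) (λ h → proj₁ h 2F refl))
              (⟦⟧-false (E.bad? x) (λ h → proj₁ h 1F refl))
            (⟦⟧-false (x Fin.≟ a) (a≢b ∘ sym)) (⟦⟧-true (x Fin.≟ x) refl)
                (⟦⟧-false (x Fin.≟ d) b≢d) ℤ.≤-refl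
          go _ _ (yes refl) = at (⟦⟧-false (D.bad? x) (λ h → proj₁ h 0F refl))
              (⟦⟧-false (E.bad? x) (λ h → proj₁ h 2F refl))
            (⟦⟧-false (x Fin.≟ a) (a≢d ∘ sym)) (⟦⟧-false (x Fin.≟ b) (b≢d ∘ sym))
                (⟦⟧-true (x Fin.≟ x) refl) ℤ.≤-refl
          go (no x≢a) (no x≢b) (no x≢d) = split (gallai x≢d (a≢d ∘ sym) x≢a)
            where
            xa≡xb = twins x≢a x≢b
            f₁ = ⟦⟧-false (x Fin.≟ a) x≢a
            f₂ = ⟦⟧-false (x Fin.≟ b) x≢b
            f₃ = ⟦⟧-false (x Fin.≟ d) x≢d
            bound : ∀ {P : Set} (h : Dec P) → ⟦ h ⟧ ≤ 1ℤ
            bound (yes _) = ℤ.≤-refl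
            bound (no _)  = +≤+ ℕ.z≤n
            D-good : ¬ D.Bad x → _
            D-good ¬bad = at (⟦⟧-false (D.bad? x) ¬bad) refl f₁ f₂ f₃
                (subst (_≤ 1ℤ) (lem ⟦ E.bad? x ⟧) (bound (E.bad? x)))
              where
              lem : ∀ i → i ≡ 0ℤ + i + (0ℤ + 0ℤ + 0ℤ)
              lem = solve-∀
            E-good : ¬ E.Bad x → _
            E-good ¬bad = at refl (⟦⟧-false (E.bad? x) ¬bad) f₁ f₂ f₃
                (subst (_≤ 1ℤ) (lem ⟦ D.bad? x ⟧) (bound (D.bad? x)))
              where
              lem : ∀ i → i ≡ i + 0ℤ + (0ℤ + 0ℤ + 0ℤ)
              lem = solve-∀
            -- The triangle x, d, a repeats a color. If xd = da or xd = xa, then x fits the order d,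
            -- a, b; if da = xa, then x sees both twins in δ and fits a, b, d.
            split : col x d ≡ col d a ⊎ col d a ≡ col x a ⊎ col x d ≡ col x a → _
            split (inj₁ e)        = D-good (λ h → proj₂ h (inj₂ (e , inj₁ xa≡xb)))
            split (inj₂ (inj₁ e)) = E-good (λ h → proj₂ h (inj₂ (sym e , inj₂ (trans (sym xa≡xb) (sym e)))))
            split (inj₂ (inj₂ e)) = D-good (λ h → proj₂ h (inj₁ (e , xa≡xb)))

      -- If both orders failed, adding n ≤ 2D + 2 and n ≤ 2E + 2 to D + E + 3 ≤ n, for the numbers D
      -- and E of bad vertices, would give 2n ≤ 2n - 2.
      target₃-twins : ¬ ¬ Target₃
      target₃-twins ¬target = ¬0≤negative {0ℤ} {1} ℤ.≤-refl
          (subst (0ℤ ≤_) (lem (+ n) (+ length D.bads) (+ length E.bads))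
        (0≤+ (0≤+ (≤⇒0≤- n≤D) (≤⇒0≤- n≤E)) (0≤* {+ 2} (+≤+ ℕ.z≤n) (≤⇒0≤- bads-disjoint))))
        where
        lem : ∀ n l m → + 2 * l + + 2 - n + (+ 2 * m + + 2 - n) + + 2 * (n - (l + m + + 3)) ≡ -[1+ 1 ] - 0ℤ
        lem = solve-∀
        n≤D : + n ≤ + 2 * + length D.bads + + 2
        n≤D = subst (+ n ≤_) (cong (_+ + 2) (ℤ.pos-* 2 (length D.bads)))
            (+≤+ (ℕ.≮⇒≥ λ lt → ¬target (d , a , b , δ , δ , ((a≢d ∘ sym) , a≢b , (b≢d ∘ sym)) , lt)))
        n≤E : + n ≤ + 2 * + length E.bads + + 2
        n≤E = subst (+ n ≤_) (cong (_+ + 2) (ℤ.pos-* 2 (length E.bads)))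
            (+≤+ (ℕ.≮⇒≥ λ lt → ¬target (a , b , d , δ , δ , (a≢b , b≢d , a≢d) , lt)))

    target₂ : {a b : V} → a ≢ b → Target₂
    target₂ a≢b = decidable-stable target₂? λ ¬target → two-colored-module (whole a≢b)
      λ { (A , mod , α , β , two) → Signs.target₂ mod α β two ¬target }

    target₃ : {a b d : V} → a ≢ b → b ≢ d → a ≢ d → Target₃
    target₃ {a₀} {b₀} {d₀} a₀≢b₀ b₀≢d₀ a₀≢d₀ = decidable-stable target₃? λ ¬target →
        two-colored-module (whole a₀≢b₀) λ { (A , mod , α , β , two) → split ¬target mod α β two }
      where
      third : ∀ {a b : V} → a ≢ b → ∃[ d ] (b ≢ d × a ≢ d)
      third {a} {b} a≢b with Fin.any? (λ d → ¬? (b Fin.≟ d) ×-dec ¬? (a Fin.≟ d))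
      ... | yes h = h
      ... | no none = ⊥-elim (pigeon (either a₀) (either b₀) (either d₀))
        where
        either : ∀ x → b ≡ x ⊎ a ≡ x
        either x = decidable-stable ((b Fin.≟ x) ⊎-dec (a Fin.≟ x)) λ h → none (x , h ∘ inj₁ , h ∘ inj₂)
        pigeon : b ≡ a₀ ⊎ a ≡ a₀ → b ≡ b₀ ⊎ a ≡ b₀ → b ≡ d₀ ⊎ a ≡ d₀ → ⊥
        pigeon (inj₁ e) (inj₁ f) _        = a₀≢b₀ (trans (sym e) f)
        pigeon (inj₂ e) (inj₂ f) _        = a₀≢b₀ (trans (sym e) f)
        pigeon (inj₁ e) _        (inj₁ f) = a₀≢d₀ (trans (sym e) f)
        pigeon (inj₂ e) _        (inj₂ f) = a₀≢d₀ (trans (sym e) f)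
        pigeon _        (inj₁ e) (inj₁ f) = b₀≢d₀ (trans (sym e) f)
        pigeon _        (inj₂ e) (inj₂ f) = b₀≢d₀ (trans (sym e) f)
      split : ¬ Target₃ → ∀ {A} (mod : Module A) α β →
          (∀ {x y} → x ∈ A → y ∈ A → x ≢ y → col x y ≡ α ⊎ col x y ≡ β) → ⊥
      split ¬target {A} mod α β two = let d , b≢d , a≢d = third a≢b in target₃-twins a≢b b≢d a≢d twins ¬target
        where
        open Module mod
        -- A third vertex in the module makes it large enough for the average; otherwise a and b are
        -- all of it and hence twins.
        twins : ∀ {x} → x ≢ a → x ≢ b → col x a ≡ col x b
        twins {x} x≢a x≢b with x ∈? A
        ... | no x∉  = uniform x∉ a∈ b∈
        ... | yes x∈ = ⊥-elim (Signs.target₃-large mod α β two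
            (≤⇒0≤- {+ 3} {+ length A} (subst (+ 3 ≤_) (∑-length A)
          (∑-⊆ Fin._≟_ {w = λ _ → 1ℤ} ((x≢a ∷ x≢b ∷ []) ∷ (a≢b ∷ []) ∷ [] ∷ []) unique
              (λ { (here refl) → x∈ ; (there (here refl)) → a∈ ; (there (there (here refl))) → b∈ })
              (λ _ → +≤+ ℕ.z≤n)))) ¬target)

    contains-pair : ∀ {a b t} → a ≢ b → (∀ l → 4 ℕ.* l ℕ.< n → t ℕ.+ l ℕ.+ 2 ℕ.≤ n) →
        ContainsOrderable (Kᵇ 2 t) χ
    contains-pair a≢b enough = let _ , _ , _ , a′≢b′ , few = target₂ a≢b in pair-copy a′≢b′ (enough _ few)

    contains-triple : ∀ {a b d t} → a ≢ b → b ≢ d → a ≢ d →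
        (∀ l → 2 ℕ.* l ℕ.+ 2 ℕ.< n → t ℕ.+ l ℕ.+ 3 ℕ.≤ n) →
      ContainsOrderable (Kᵇ 3 t) χ
    contains-triple a≢b b≢d a≢d enough =
      let _ , _ , _ , _ , _ , (a′≢b′ , b′≢d′ , a′≢d′) , few = target₃ a≢b b≢d a≢d in triple-copy a′≢b′ b′≢d′ a′≢d′ (enough _ few)

open GoodSides

-- The values of both numbers.

open import Data.Nat using (ℕ; _+_; _*_; _/_; NonZero)
open import Data.Nat.Divisibility using (_∣_; divides)
open import Data.Product using (_×_)

orderable-or-rainbow₂ : ∀ {n} μ → n ≡ 4 * μ + 2 → ∀ k (χ : EdgeColoring (K n) (Fin k)) →
  ContainsOrderable (Kᵇ 2 (3 * μ)) χ ⊎ ContainsRainbow (K 3) χ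
orderable-or-rainbow₂ {0} μ eq = ⊥-elim (ℕ.0≢1+n (trans eq (ℕ.+-comm (4 * μ) 2)))
orderable-or-rainbow₂ {1} μ eq = ⊥-elim (ℕ.0≢1+n (ℕ.suc-injective (trans eq (ℕ.+-comm (4 * μ) 2))))
orderable-or-rainbow₂ {n@(suc (suc _))} μ eq k χ =
  [ inj₂ , (λ (gallai : Total.NoRainbow χ default) →
      inj₁ (Upper.contains-pair χ default gallai {0F} {1F} (λ ()) enough)) ]′
      (Total.rainbow-or-gallai χ default)
  where
  -- The palette is not assumed inhabited; an edge supplies a color.
  default = EdgeColoring.color χ {0F} {1F} (λ ())
  enough : ∀ l → 4 * l ℕ.< n → 3 * μ + l + 2 ℕ.≤ n
  enough l few = begin
    3 * μ + l + 2  ≤⟨ ℕ.+-monoˡ-≤ 2 (ℕ.+-monoʳ-≤ (3 * μ) l≤μ) ⟩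
    3 * μ + μ + 2  ≡⟨ cong (_+ 2) (ℕ.+-comm (3 * μ) μ) ⟩
    4 * μ + 2      ≡⟨ sym eq ⟩
    n              ∎
    where
    open ℕ.≤-Reasoning
    l≤μ : l ℕ.≤ μ
    l≤μ = ℕ.≤-pred (ℕ.*-cancelˡ-< 4 l (suc μ) (ℕ.<-≤-trans (subst (4 * l ℕ.<_) eq few)
      (ℕ.≤-trans (ℕ.+-monoʳ-≤ (4 * μ) (ℕ.s≤s (ℕ.s≤s (ℕ.z≤n {2}))))
          (ℕ.≤-reflexive (trans (ℕ.+-comm (4 * μ) 4) (sym (ℕ.*-suc 4 μ)))))))

orderable-or-rainbow₃ : ∀ {n} μ .{{_ : NonZero μ}} → n ≡ 4 * μ + 2 → ∀ k (χ : EdgeColoring (K n) (Fin k)) →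
  ContainsOrderable (Kᵇ 3 (2 * μ)) χ ⊎ ContainsRainbow (K 3) χ
orderable-or-rainbow₃ {n} (suc μ′) eq = go n eq
  where
  μ = suc μ′
  enough : ∀ {n} l → n ≡ 4 * μ + 2 → 2 * l + 2 ℕ.< n → 2 * μ + l + 3 ℕ.≤ n
  enough {n} l eq few = begin
    2 * μ + l + 3        ≡⟨ trans (ℕ.+-assoc (2 * μ) l 3) (cong (_+_ (2 * μ)) (ℕ.+-suc l 2)) ⟩
    2 * μ + (suc l + 2)  ≤⟨ ℕ.+-monoʳ-≤ (2 * μ) (ℕ.+-monoˡ-≤ 2 l<2μ) ⟩
    2 * μ + (2 * μ + 2)  ≡⟨ sym (ℕ.+-assoc (2 * μ) (2 * μ) 2) ⟩
    2 * μ + 2 * μ + 2    ≡⟨ cong (_+ 2) (sym (ℕ.*-distribʳ-+ μ 2 2)) ⟩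
    4 * μ + 2            ≡⟨ sym eq ⟩
    n                    ∎
    where
    open ℕ.≤-Reasoning
    l<2μ : l ℕ.< 2 * μ
    l<2μ = ℕ.*-cancelˡ-< 2 l (2 * μ) (subst (2 * l ℕ.<_) (ℕ.*-assoc 2 2 μ)
        (ℕ.+-cancelʳ-< 2 _ _ (subst (2 * l + 2 ℕ.<_) eq few)))
  -- A small side of three vertices needs three vertices to exist, hence μ ≥ 1.
  3≤ : 3 ℕ.≤ 4 * μ + 2
  3≤ = ℕ.≤-trans (ℕ.+-monoˡ-≤ 2 (ℕ.s≤s (ℕ.z≤n {μ′ + 3 * μ}))) ℕ.≤-refl
  go : ∀ n → n ≡ 4 * μ + 2 → ∀ k (χ : EdgeColoring (K n) (Fin k)) →
      ContainsOrderable (Kᵇ 3 (2 * μ)) χ ⊎ ContainsRainbow (K 3) χ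
  go n eq k χ with subst (3 ℕ.≤_) (sym eq) 3≤
  go (suc (suc (suc _))) eq k χ | ℕ.s≤s (ℕ.s≤s (ℕ.s≤s _)) =
    [ inj₂ , (λ (gallai : Total.NoRainbow χ default) →
        inj₁ (Upper.contains-triple χ default gallai {0F} {1F} {2F} (λ ()) (λ ()) (λ ())
        (λ l → enough l eq))) ]′ (Total.rainbow-or-gallai χ default)
    where
    default = EdgeColoring.color χ {0F} {1F} (λ ())

-- Two colors admit no rainbow triangle, so the bound for all palettes specializes to two colors,
-- and a two-coloring without an orderable copy refutes both properties at once.
minima : ∀ {G n} → (∀ k (χ : EdgeColoring (K n) (Fin k)) →
    ContainsOrderable G χ ⊎ ContainsRainbow (K 3) χ) →
  (∀ {m} → m ℕ.< n → Σ[ χ ∈ EdgeColoring (K m) (Fin 2) ] ¬ ContainsOrderable G χ) →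
  (r′₂[ G ]≡ n) × (CR[ G , K 3 ]≡ n)
minima {G} {n} upper lower = (two-colors upper , least) , (upper , λ m h → least m (two-colors h))
  where
  two-colors : ∀ {m} → (∀ k (χ : EdgeColoring (K m) (Fin k)) →
      ContainsOrderable G χ ⊎ ContainsRainbow (K 3) χ) →
    (χ : EdgeColoring (K m) (Fin 2)) → ContainsOrderable G χ
  two-colors h χ = [ id , ⊥-elim ∘ ¬rainbow₂ χ ]′ (h 2 χ)
  least : ∀ m → ((χ : EdgeColoring (K m) (Fin 2)) → ContainsOrderable G χ) → n ℕ.≤ m
  least m h = ℕ.≮⇒≥ λ m<n → let χ , avoids = lower m<n in avoids (h χ)

<4μ+2 : ∀ {m} μ → m ℕ.< 4 * μ + 2 → m ℕ.≤ 4 * μ + 1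
<4μ+2 {m} μ h = ℕ.≤-pred (subst (m ℕ.<_) (ℕ.+-suc (4 * μ) 1) h)

corollary-K₂ : ∀ μ → PrimePower (4 * μ + 1) →
  (r′₂[ Kᵇ 2 (3 * μ) ]≡ (4 * μ + 2)) × (CR[ Kᵇ 2 (3 * μ) , K 3 ]≡ (4 * μ + 2))
corollary-K₂ μ pp = minima (orderable-or-rainbow₂ μ refl)
    (λ m< → Lower.coloring μ pp (<4μ+2 μ m<) , Lower.avoids-pair μ pp (<4μ+2 μ m<))

corollary-K₃ : ∀ μ .{{_ : NonZero μ}} → PrimePower (4 * μ + 1) →
  (r′₂[ Kᵇ 3 (2 * μ) ]≡ (4 * μ + 2)) × (CR[ Kᵇ 3 (2 * μ) , K 3 ]≡ (4 * μ + 2))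
corollary-K₃ μ pp = minima (orderable-or-rainbow₃ μ refl)
    (λ m< → Lower.coloring μ pp (<4μ+2 μ m<) , Lower.avoids-triple μ pp (<4μ+2 μ m<))

quotient : ∀ μ → 4 * (μ * 3) / 3 ≡ 4 * μ
quotient μ = trans (cong (_/ 3) (sym (ℕ.*-assoc 4 μ 3))) (m*n/n≡m (4 * μ) 3)

double : ∀ μ → 2 * (μ * 2) ≡ 4 * μ
double μ = trans (cong (2 *_) (ℕ.*-comm μ 2)) (sym (ℕ.*-assoc 2 2 μ))

part₂ : ∀ t → 3 ∣ t → PrimePower (4 * t / 3 + 1) →
    (r′₂[ Kᵇ 2 t ]≡ (4 * t / 3 + 2)) × (CR[ Kᵇ 2 t , K 3 ]≡ (4 * t / 3 + 2))
part₂ .(μ * 3) (divides μ refl) pp = subst₂ (λ t q →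
    (r′₂[ Kᵇ 2 t ]≡ (q + 2)) × (CR[ Kᵇ 2 t , K 3 ]≡ (q + 2)))
  (ℕ.*-comm 3 μ) (sym (quotient μ)) (corollary-K₂ μ (subst (λ q → PrimePower (q + 1)) (quotient μ) pp))

part₃ : ∀ t .{{_ : NonZero t}} → 2 ∣ t → PrimePower (2 * t + 1) →
    (r′₂[ Kᵇ 3 t ]≡ (2 * t + 2)) × (CR[ Kᵇ 3 t , K 3 ]≡ (2 * t + 2))
part₃ .(μ * 2) (divides μ@(suc _) refl) pp = subst₂
    (λ t q → (r′₂[ Kᵇ 3 t ]≡ (q + 2)) × (CR[ Kᵇ 3 t , K 3 ]≡ (q + 2)))
  (ℕ.*-comm 2 μ) (sym (double μ)) (corollary-K₃ μ (subst (λ q → PrimePower (q + 1)) (double μ) pp))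

corollary1p10 : (t : ℕ) → .{{_ : NonZero t}} →
    (3 ∣ t → PrimePower (4 * t / 3 + 1) →
    (r′₂[ Kᵇ 2 t ]≡ (4 * t / 3 + 2)) × (CR[ Kᵇ 2 t , K 3 ]≡ (4 * t / 3 + 2)))
    ×
    (2 ∣ t → PrimePower (2 * t + 1) →
    (r′₂[ Kᵇ 3 t ]≡ (2 * t + 2)) × (CR[ Kᵇ 3 t , K 3 ]≡ (2 * t + 2)))
corollary1p10 t = part₂ t , part₃ t
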